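{- (Free Construction.) Let $\mathcal{R}$ be a representable signature, $\mathsf{S}$ a symmetric representable multicategory, and $i$ a map of representable signatures from $\mathcal{R}$ to the underlying signature of $\mathsf{S}$. Then there exists a unique symmetric representable functor $i^\ast : \mathcal{F}_s(\mathcal{R}) \to \mathsf{S}$ such that $i^\ast(a) = i(a)$ for every type $a$ and $i^\ast([f(x_1,\dots,x_n)]) = i(f)$ for every multiarrow $f$ of $\mathcal{R}$.
   Context: Notation: $S_n$ symmetric group; for a list $\gamma=c_1,\dots,c_n$ and $\sigma\in S_n$, $\gamma\cdot\sigma = c_{\sigma(1)},\dots,c_{\sigma(n)}$; an $(n_1,\dots,n_k)$-shuffle is a bijection $\sum_i[n_i]\cong[\sum n_i]$ monotone on each $[n_i]$; $\mathsf{shu}(\gamma_1,\dots,\gamma_k)$ is the set of $(|\gamma_1|,\dots,|\gamma_k|)$-shuffles acting on the concatenation. A representable signature consists of a set $\mathcal{A}$ of atoms and a multigraph $\mathcal{R}$ whose nodes (types) are generated by $a ::= o \in \mathcal{A} \mid (a_1 \otimes \cdots \otimes a_k)$, with sets $\mathcal{R}(a_1,\dots,a_n;b)$ of multiarrows. A symmetric multicategory carries actions $-\cdot\sigma : \mathsf{S}(\gamma,a_1,\dots,a_k;a)\cong\mathsf{S}(\gamma,a_{\sigma(1)},\dots,a_{\sigma(k)};a)$ satisfying the usual axioms; a representable multicategory has chosen objects $(a_1\otimes\cdots\otimes a_k)$ and morphisms $\mathsf{re}:a_1,\dots,a_k\to(a_1\otimes\cdots\otimes a_k)$ such that precomposition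 with $\mathsf{re}$ induces bijections $\mathsf{S}(\gamma,(a_1\otimes\cdots\otimes a_k),\delta;a)\cong\mathsf{S}(\gamma,a_1,\dots,a_k,\delta;a)$. A symmetric representable functor preserves composition, identities, the symmetric actions, tensor objects and $\mathsf{re}$ on the nose. A map of representable signatures $i$ assigns objects $i(a)$ with $i((a_1\otimes\cdots\otimes a_k))=(i(a_1)\otimes\cdots\otimes i(a_k))$ and morphisms $i(f)\in\mathsf{S}(i(a_1),\dots,i(a_n);i(b))$. Terms: $s,t ::= x \mid \langle s_1,\dots,s_k\rangle \mid s[x_1^{a_1},\dots,x_k^{a_k} := t] \mid f(s_1,\dots,s_n)$, up to renaming of bound variables. Symmetric typing rules (contexts: disjoint lists of distinct variables): $x:a\vdash x:a$; if $\gamma_i\vdash s_i:a_i$, $\sigma\in\mathsf{shu}(\gamma_1,\dots,\gamma_k)$ then $(\gamma_1,\dots,\gamma_k)\cdot\sigma\vdash\langle s_1,\dots,s_k\rangle:(a_1\otimes\cdots\otimes a_k)$; if $\gamma\vdash t:(a_1\otimes\cdots\otimes a_k)$, $\delta,x_1:a_1,\dots,x_k:a_k,\delta'\vdash s:b$, $\sigma\in\mathsf{shu}(\delta,\gamma,\delta')$ then $(\delta,\gamma,\delta')\cdot\sigma\vdash s[\vec{x}:=t]:b$; if $f\in\mathcal{R}(a_1,\dots,a_n;b)$, $\gamma_i\vdash s_i:a_i$, $\sigma\in\mathsf{shu}(\gamma_1,\dots,\gamma_n)$ then $(\gamma_1,\dots,\gamma_n)\cdot\sigma\vdash f(s_1,\dots,s_n):b$.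 $\mathrm{Rep}_s(\mathcal{R})(a_1,\dots,a_n;a)$ = terms $s$ with $x_1:a_1,\dots,x_n:a_n\vdash s:a$. Contexts with hole: $\mathtt{C} ::= [\cdot] \mid \langle s_1,\dots,\mathtt{C},\dots,s_k\rangle \mid \mathtt{C}[\vec{x}:=t] \mid s[\vec{x} := \mathtt{C}] \mid f(s_1,\dots,\mathtt{C},\dots,s_n)$; $\mathtt{E}$ same but $s[\vec{x}:=\mathtt{E}]$ requires $\mathtt{E}\neq[\cdot]$; $\mathtt{L} ::= [\cdot]\mid\mathtt{L}[\vec{x}:=t]$; $\mathsf{LT}$ = terms $\mathtt{L}[\langle s_1,\dots,s_k\rangle]$. $\beta$: $s[x_1,\dots,x_k := \mathtt{L}[\langle t_1,\dots,t_k\rangle]] \to_\beta \mathtt{L}[s\{t_1/x_1,\dots,t_k/x_k\}]$ in $\mathtt{C}$-contexts; $\eta$: $s\to_\eta\langle x_1,\dots,x_k\rangle[\vec{x}:=s]$ when $s$ has type $(a_1\otimes\cdots\otimes a_k)$, $x_i$ fresh, $s\notin\mathsf{LT}$, in $\mathtt{E}$-contexts; $\to_{\mathsf{rep}}=\to_\beta\cup\to_\eta$. $\equiv$: smallest congruence containing $\mathtt{C}[s[\vec{x}:=t]]\equiv\mathtt{C}[s][\vec{x}:=t]$ when $\mathtt{C}$ binds no free variable of $t$ and $\vec{x}$ not free in $\mathtt{C}$. $\mathcal{F}_s(\mathcal{R})$: objects are types, $\mathcal{F}_s(\mathcal{R})(\gamma;a)=\mathrm{Rep}_s(\mathcal{R})(\gamma;a)/\sim$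 with $\sim$ the equivalence generated by $\equiv$ and $\to_{\mathsf{rep}}$, composition by substitution, identities $[x]$; the symmetric action sends $[s]$ (typed in $\gamma$) to $[s]$ typed in the permuted context, and the representable structure has $\mathsf{re}=[\langle x_1,\dots,x_k\rangle]$. -}

module Defs where

open import Level using (Level; _⊔_) renaming (suc to lsuc)
open import Data.Bool using (Bool; true; false; if_then_else_)
open import Data.Nat using (ℕ; zero; suc; _+_)
open import Data.List using (List; []; _∷_; _++_; map)
open import Data.List.Properties using (++-assoc; ++-identityʳ; map-++)
open import Data.Product using (Σ; _×_; _,_; proj₁; proj₂)
open import Data.Sum using (_⊎_; inj₁; inj₂)
open import Data.Unit.Polymorphic using (⊤)
open import Relation.Nullary using (¬_)
open import Relation.Binary.PropositionalEquality
  using (_≡_; refl; sym; trans; cong; subst)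
open import Relation.Binary.Construct.Closure.Equivalence using (EqClosure)

module _ {a} {A : Set a} where

  reassoc : ∀ (P B X D E : List A) →
            P ++ ((B ++ (X ++ D)) ++ E) ≡ (P ++ B) ++ (X ++ (D ++ E))
  reassoc P B X D E =
    trans (cong (P ++_) (trans (++-assoc B (X ++ D) E)
                               (cong (B ++_) (++-assoc X D E))))
          (sym (++-assoc P B (X ++ (D ++ E))))

  assoc4 : ∀ (P B C D : List A) → P ++ (B ++ (C ++ D)) ≡ (P ++ (B ++ C)) ++ D
  assoc4 P B C D =
    trans (cong (P ++_) (sym (++-assoc B C D))) (sym (++-assoc P (B ++ C) D))

map-++₃ : ∀ {a b} {A : Set a} {B : Set b} (f : A → B) (P Q U : List A) →
          map f P ++ map f Q ++ map f U ≡ map f (P ++ Q ++ U)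
map-++₃ f P Q U = sym (trans (map-++ f P (Q ++ U)) (cong (map f P ++_) (map-++ f Q U)))

data Var {a} {A : Set a} : List A → A → Set a where
  vz : ∀ {x xs} → Var (x ∷ xs) x
  vs : ∀ {x y xs} → Var xs x → Var (y ∷ xs) x

module _ {a} {A : Set a} where

  inl : ∀ {Γ : List A} Δ {c} → Var Γ c → Var (Γ ++ Δ) c
  inl Δ vz = vz
  inl Δ (vs x) = vs (inl Δ x)

  inr : ∀ (Γ : List A) {Δ c} → Var Δ c → Var (Γ ++ Δ) c
  inr [] x = x
  inr (_ ∷ Γ) x = vs (inr Γ x)

  split : ∀ (Γ : List A) {Δ c} → Var (Γ ++ Δ) c → Var Γ c ⊎ Var Δ c
  split [] x = inj₂ x
  split (_ ∷ Γ) vz = inj₁ vz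
  split (_ ∷ Γ) (vs x) with split Γ x
  ... | inj₁ y = inj₁ (vs y)
  ... | inj₂ z = inj₂ z

  sameVar : ∀ {Γ : List A} {c d} → Var Γ c → Var Γ d → Bool
  sameVar vz vz = true
  sameVar vz (vs _) = false
  sameVar (vs _) vz = false
  sameVar (vs x) (vs y) = sameVar x y

  record Perm (Γ Δ : List A) : Set a where
    field
      to      : ∀ {c} → Var Γ c → Var Δ c
      from    : ∀ {c} → Var Δ c → Var Γ c
      from-to : ∀ {c} (x : Var Γ c) → from (to x) ≡ x
      to-from : ∀ {c} (y : Var Δ c) → to (from y) ≡ y

  idPerm : ∀ {Γ} → Perm Γ Γ
  idPerm = record { to = λ x → x ; from = λ x → x
                  ; from-to = λ _ → refl ; to-from = λ _ → refl }

  _⨾_ : ∀ {Γ Δ Ε} → Perm Γ Δ → Perm Δ Ε → Perm Γ Ε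
  σ ⨾ τ = record
    { to = λ x → Perm.to τ (Perm.to σ x)
    ; from = λ z → Perm.from σ (Perm.from τ z)
    ; from-to = λ x → trans (cong (Perm.from σ) (Perm.from-to τ (Perm.to σ x)))
                            (Perm.from-to σ x)
    ; to-from = λ z → trans (cong (Perm.to τ) (Perm.to-from σ (Perm.from τ z)))
                            (Perm.to-from τ z) }

  IsBlockSum : ∀ (Γ Δ : List A) {Θ Θ'} → Perm Θ Θ' →
               Perm (Γ ++ Θ ++ Δ) (Γ ++ Θ' ++ Δ) → Set a
  IsBlockSum Γ Δ {Θ} {Θ'} τ ρ =
    (∀ {c} (x : Var Γ c) → Perm.to ρ (inl (Θ ++ Δ) x) ≡ inl (Θ' ++ Δ) x)
    × (∀ {c} (t : Var Θ c) → Perm.to ρ (inr Γ (inl Δ t)) ≡ inr Γ (inl Δ (Perm.to τ t)))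
    × (∀ {c} (y : Var Δ c) → Perm.to ρ (inr Γ (inr Θ y)) ≡ inr Γ (inr Θ' y))

  -- positions of Γ ++ a ∷ Δ other than the middle one, matched with the
  -- corresponding positions of Γ ++ Θ ++ Δ
  data Outer (Γ Δ Θ : List A) {m : A} : ∀ {c} → Var (Γ ++ m ∷ Δ) c → Var (Γ ++ Θ ++ Δ) c → Set a where
    outL : ∀ {c} (x : Var Γ c) → Outer Γ Δ Θ (inl (m ∷ Δ) x) (inl (Θ ++ Δ) x)
    outR : ∀ {c} (y : Var Δ c) → Outer Γ Δ Θ (inr Γ (vs y)) (inr Γ (inr Θ y))

  -- ρ is the permutation σ with the block Θ substituted for its middle
  -- position (σ sends the middle position of its source to that of its target)
  IsBlockInsert : ∀ (Γ Δ Γ' Δ' Θ : List A) {m : A} →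
                  Perm (Γ ++ m ∷ Δ) (Γ' ++ m ∷ Δ') →
                  Perm (Γ ++ Θ ++ Δ) (Γ' ++ Θ ++ Δ') → Set a
  IsBlockInsert Γ Δ Γ' Δ' Θ {m} σ ρ =
    (∀ {c} (v : Var (Γ ++ m ∷ Δ) c) (w : Var (Γ ++ Θ ++ Δ) c) →
       Outer Γ Δ Θ v w → Outer Γ' Δ' Θ (Perm.to σ v) (Perm.to ρ w))
    × (∀ {c} (t : Var Θ c) → Perm.to ρ (inr Γ (inl Δ t)) ≡ inr Γ' (inl Δ' t))

mapVar : ∀ {a b} {A : Set a} {B : Set b} (f : A → B) {Γ : List A} {c} →
         Var Γ c → Var (map f Γ) (f c)
mapVar f vz = vz
mapVar f (vs x) = vs (mapVar f x)

record SymRepMulticat (o h : Level) : Set (lsuc (o ⊔ h)) where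
  infixl 5 _·_
  field
    Ob   : Set o
    Hom  : List Ob → Ob → Set h
    id   : ∀ {a} → Hom (a ∷ []) a
    comp : ∀ (Γ Δ : List Ob) {a b Θ} → Hom (Γ ++ a ∷ Δ) b → Hom Θ a → Hom (Γ ++ Θ ++ Δ) b
    _·_  : ∀ {Γ Δ b} → Hom Γ b → Perm Γ Δ → Hom Δ b

    comp-idˡ : ∀ {Θ a} (g : Hom Θ a) →
      comp [] [] id g ≡ subst (λ X → Hom X a) (sym (++-identityʳ Θ)) g
    comp-idʳ : ∀ (Γ Δ : List Ob) {a b} (f : Hom (Γ ++ a ∷ Δ) b) → comp Γ Δ f id ≡ f
    comp-seq : ∀ (Γ Δ Γ' Δ' : List Ob) {a b c Θ}
      (f : Hom (Γ ++ a ∷ Δ) c) (g : Hom (Γ' ++ b ∷ Δ') a) (h : Hom Θ b) →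
      subst (λ X → Hom X c) (reassoc Γ Γ' Θ Δ' Δ) (comp Γ Δ f (comp Γ' Δ' g h))
      ≡ comp (Γ ++ Γ') (Δ' ++ Δ)
          (subst (λ X → Hom X c) (reassoc Γ Γ' (b ∷ []) Δ' Δ) (comp Γ Δ f g)) h
    comp-par : ∀ (Γ Δ Ε : List Ob) {a b c Θ Ξ}
      (f : Hom (Γ ++ a ∷ Δ ++ b ∷ Ε) c) (g : Hom Θ a) (h : Hom Ξ b) →
      comp (Γ ++ Θ ++ Δ) Ε
        (subst (λ X → Hom X c) (assoc4 Γ Θ Δ (b ∷ Ε)) (comp Γ (Δ ++ b ∷ Ε) f g)) h
      ≡ subst (λ X → Hom X c) (assoc4 Γ Θ Δ (Ξ ++ Ε))
          (comp Γ (Δ ++ Ξ ++ Ε)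
            (subst (λ X → Hom X c) (sym (assoc4 Γ (a ∷ []) Δ (Ξ ++ Ε)))
              (comp (Γ ++ a ∷ Δ) Ε
                (subst (λ X → Hom X c) (assoc4 Γ (a ∷ []) Δ (b ∷ Ε)) f) h))
            g)

    ·-id  : ∀ {Γ b} (f : Hom Γ b) → f · idPerm ≡ f
    ·-⨾   : ∀ {Γ Δ Ε b} (f : Hom Γ b) (σ : Perm Γ Δ) (τ : Perm Δ Ε) → (f · σ) · τ ≡ f · (σ ⨾ τ)
    ·-ext : ∀ {Γ Δ b} (f : Hom Γ b) (σ τ : Perm Γ Δ) →
      (∀ {c} (x : Var Γ c) → Perm.to σ x ≡ Perm.to τ x) → f · σ ≡ f · τ
    comp-·ʳ : ∀ (Γ Δ : List Ob) {a b Θ Θ'} (f : Hom (Γ ++ a ∷ Δ) b) (g : Hom Θ a)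
      (τ : Perm Θ Θ') (ρ : Perm (Γ ++ Θ ++ Δ) (Γ ++ Θ' ++ Δ)) →
      IsBlockSum Γ Δ τ ρ → comp Γ Δ f (g · τ) ≡ comp Γ Δ f g · ρ
    comp-·ˡ : ∀ (Γ Δ Γ' Δ' : List Ob) {a b Θ} (f : Hom (Γ ++ a ∷ Δ) b) (g : Hom Θ a)
      (σ : Perm (Γ ++ a ∷ Δ) (Γ' ++ a ∷ Δ')) (ρ : Perm (Γ ++ Θ ++ Δ) (Γ' ++ Θ ++ Δ')) →
      Perm.to σ (inr Γ vz) ≡ inr Γ' vz →
      IsBlockInsert Γ Δ Γ' Δ' Θ σ ρ →
      comp Γ' Δ' (f · σ) g ≡ comp Γ Δ f g · ρ

    ⨂     : List Ob → Ob
    re    : ∀ as → Hom as (⨂ as)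
    re⁻¹  : ∀ (Γ Δ as : List Ob) {b} → Hom (Γ ++ as ++ Δ) b → Hom (Γ ++ ⨂ as ∷ Δ) b
    re⁻¹-comp : ∀ (Γ Δ as : List Ob) {b} (f : Hom (Γ ++ ⨂ as ∷ Δ) b) →
      re⁻¹ Γ Δ as (comp Γ Δ f (re as)) ≡ f
    comp-re⁻¹ : ∀ (Γ Δ as : List Ob) {b} (g : Hom (Γ ++ as ++ Δ) b) →
      comp Γ Δ (re⁻¹ Γ Δ as g) (re as) ≡ g

data Ty {ℓ} (A : Set ℓ) : Set ℓ where
  atom   : A → Ty A
  tensor : List (Ty A) → Ty A

record RepSig (ℓ : Level) : Set (lsuc ℓ) where
  field
    Atom : Set ℓ
    Arr  : List (Ty Atom) → Ty Atom → Set ℓ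

record SigMap {ℓ o h} (R : RepSig ℓ) (S : SymRepMulticat o h) : Set (ℓ ⊔ o ⊔ h) where
  open RepSig R
  open SymRepMulticat S
  field
    obj   : Ty Atom → Ob
    obj-⊗ : ∀ as → obj (tensor as) ≡ ⨂ (map obj as)
    arr   : ∀ {as b} → Arr as b → Hom (map obj as) (obj b)

module FreeRep {ℓ} (R : RepSig ℓ) where
  open RepSig R

  T : Set ℓ
  T = Ty Atom

  Ctx : Set ℓ
  Ctx = List T

  -- simply typed, scoped terms (de Bruijn; bound variables of a let are
  -- x₁ … xₖ = the first k positions of the body's context)
  data Tm : Ctx → T → Set ℓ
  data Tms : Ctx → List T → Set ℓ

  data Tm where
    var  : ∀ {Γ a} → Var Γ a → Tm Γ a
    tup  : ∀ {Γ as} → Tms Γ as → Tm Γ (tensor as)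
    lett : ∀ {Γ b} as → Tm Γ (tensor as) → Tm (as ++ Γ) b → Tm Γ b -- s[x⃗ := t]  (t first, body s)
    app  : ∀ {Γ as b} → Arr as b → Tms Γ as → Tm Γ b

  data Tms where
    []  : ∀ {Γ} → Tms Γ []
    _∷_ : ∀ {Γ a as} → Tm Γ a → Tms Γ as → Tms Γ (a ∷ as)

  _++ₜ_ : ∀ {Γ as bs} → Tms Γ as → Tms Γ bs → Tms Γ (as ++ bs)
  [] ++ₜ us = us
  (t ∷ ts) ++ₜ us = t ∷ (ts ++ₜ us)

  Ren : Ctx → Ctx → Set ℓ
  Ren Γ Δ = ∀ {c} → Var Γ c → Var Δ c

  liftR : ∀ {Γ Δ} as → Ren Γ Δ → Ren (as ++ Γ) (as ++ Δ)
  liftR [] ρ x = ρ x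
  liftR (a ∷ as) ρ vz = vz
  liftR (a ∷ as) ρ (vs x) = vs (liftR as ρ x)

  ren  : ∀ {Γ Δ a} → Ren Γ Δ → Tm Γ a → Tm Δ a
  rens : ∀ {Γ Δ as} → Ren Γ Δ → Tms Γ as → Tms Δ as
  ren ρ (var x) = var (ρ x)
  ren ρ (tup ts) = tup (rens ρ ts)
  ren ρ (lett as t u) = lett as (ren ρ t) (ren (liftR as ρ) u)
  ren ρ (app f ts) = app f (rens ρ ts)
  rens ρ [] = []
  rens ρ (t ∷ ts) = ren ρ t ∷ rens ρ ts

  Sub : Ctx → Ctx → Set ℓ
  Sub Γ Δ = ∀ {c} → Var Γ c → Tm Δ c

  liftS : ∀ {Γ Δ} as → Sub Γ Δ → Sub (as ++ Γ) (as ++ Δ)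
  liftS [] σ x = σ x
  liftS (a ∷ as) σ vz = var vz
  liftS (a ∷ as) σ (vs x) = ren (λ z → vs z) (liftS as σ x)

  sub  : ∀ {Γ Δ a} → Sub Γ Δ → Tm Γ a → Tm Δ a
  subs : ∀ {Γ Δ as} → Sub Γ Δ → Tms Γ as → Tms Δ as
  sub σ (var x) = σ x
  sub σ (tup ts) = tup (subs σ ts)
  sub σ (lett as t u) = lett as (sub σ t) (sub (liftS as σ) u)
  sub σ (app f ts) = app f (subs σ ts)
  subs σ [] = []
  subs σ (t ∷ ts) = sub σ t ∷ subs σ ts

  vars : ∀ {Γ} as → Ren as Γ → Tms Γ as
  vars [] ρ = []
  vars (a ∷ as) ρ = var (ρ vz) ∷ vars as (λ x → ρ (vs x))

  occ  : ∀ {Γ a c} → Tm Γ a → Var Γ c → ℕ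
  occs : ∀ {Γ as c} → Tms Γ as → Var Γ c → ℕ
  occ (var x) y = if sameVar x y then 1 else 0
  occ (tup ts) y = occs ts y
  occ (lett as t u) y = occ t y + occ u (inr as y)
  occ (app f ts) y = occs ts y
  occs [] y = 0
  occs (t ∷ ts) y = occ t y + occs ts y

  BoundLinear  : ∀ {Γ a} → Tm Γ a → Set ℓ
  BoundLinears : ∀ {Γ as} → Tms Γ as → Set ℓ
  BoundLinear (var x) = ⊤
  BoundLinear (tup ts) = BoundLinears ts
  BoundLinear {Γ} (lett as t u) =
    BoundLinear t × BoundLinear u × (∀ {c} (x : Var as c) → occ u (inl Γ x) ≡ 1)
  BoundLinear (app f ts) = BoundLinears ts
  BoundLinears [] = ⊤
  BoundLinears (t ∷ ts) = BoundLinear t × BoundLinears ts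

  Linear : ∀ {Γ a} → Tm Γ a → Set ℓ
  Linear {Γ} s = BoundLinear s × (∀ {c} (x : Var Γ c) → occ s x ≡ 1)

  Rep : Ctx → T → Set ℓ
  Rep Γ a = Σ (Tm Γ a) Linear

  -- contexts L ::= [·] | L[x⃗ := t]   (outermost binding first)

  data LCtx : Ctx → Ctx → Set ℓ where
    hole : ∀ {Γ} → LCtx Γ Γ
    lctx : ∀ {Γ Γ'} bs → Tm Γ (tensor bs) → LCtx (bs ++ Γ) Γ' → LCtx Γ Γ'

  plugL : ∀ {Γ Γ' c} → LCtx Γ Γ' → Tm Γ' c → Tm Γ c
  plugL hole s = s
  plugL (lctx bs u L) s = lett bs u (plugL L s)

  wkL : ∀ {Γ Γ'} → LCtx Γ Γ' → Ren Γ Γ'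
  wkL hole x = x
  wkL (lctx bs u L) x = wkL L (inr bs x)

  data IsLT : ∀ {Γ a} → Tm Γ a → Set ℓ where
    isTup : ∀ {Γ as} (ts : Tms Γ as) → IsLT (tup ts)
    isLet : ∀ {Γ as b} (t : Tm Γ (tensor as)) (u : Tm (as ++ Γ) b) → IsLT u → IsLT (lett as t u)

  βsub : ∀ {Γ Γ' as} → Tms Γ' as → Ren Γ Γ' → Sub (as ++ Γ) Γ'
  βsub [] ρ x = var (ρ x)
  βsub (t ∷ ts) ρ vz = t
  βsub (t ∷ ts) ρ (vs x) = βsub ts ρ x

  swapR : ∀ {Γ} as bs → Ren (as ++ bs ++ Γ) (bs ++ as ++ Γ)
  swapR {Γ} as bs x with split as x
  ... | inj₁ y = inr bs (inl Γ y)
  ... | inj₂ z with split bs z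
  ...   | inj₁ w = inl (as ++ Γ) w
  ...   | inj₂ v = inr bs (inr as v)

  data Beta : ∀ {Γ a} → Tm Γ a → Tm Γ a → Set ℓ where
    beta : ∀ {Γ Γ' as b} (L : LCtx Γ Γ') (ts : Tms Γ' as) (s : Tm (as ++ Γ) b) →
      Beta (lett as (plugL L (tup ts)) s) (plugL L (sub (βsub ts (wkL L)) s))

  data Eta : ∀ {Γ a} → Tm Γ a → Tm Γ a → Set ℓ where
    eta : ∀ {Γ as} (s : Tm Γ (tensor as)) → ¬ IsLT s →
      Eta s (lett as s (tup (vars as (inl Γ))))

  -- C[s[x⃗:=t]] ≡ C[s][x⃗:=t] for one-layer contexts C (these generate the
  -- same congruence as arbitrary C)
  data Comm : ∀ {Γ a} → Tm Γ a → Tm Γ a → Set ℓ where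
    c-tup : ∀ {Γ as bs₁ c bs₂} (ss₁ : Tms Γ bs₁) (t : Tm Γ (tensor as))
      (s : Tm (as ++ Γ) c) (ss₂ : Tms Γ bs₂) →
      Comm (tup (ss₁ ++ₜ (lett as t s ∷ ss₂)))
           (lett as t (tup (rens (inr as) ss₁ ++ₜ (s ∷ rens (inr as) ss₂))))
    c-app : ∀ {Γ as bs₁ c bs₂ d} (f : Arr (bs₁ ++ c ∷ bs₂) d) (ss₁ : Tms Γ bs₁)
      (t : Tm Γ (tensor as)) (s : Tm (as ++ Γ) c) (ss₂ : Tms Γ bs₂) →
      Comm (app f (ss₁ ++ₜ (lett as t s ∷ ss₂)))
           (lett as t (app f (rens (inr as) ss₁ ++ₜ (s ∷ rens (inr as) ss₂))))
    c-def : ∀ {Γ as bs c} (t : Tm Γ (tensor as)) (s : Tm (as ++ Γ) (tensor bs))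
      (u : Tm (bs ++ Γ) c) →
      Comm (lett bs (lett as t s) u)
           (lett as t (lett bs s (ren (liftR bs (inr as)) u)))
    c-body : ∀ {Γ as bs c} (u : Tm Γ (tensor bs)) (t : Tm Γ (tensor as))
      (s : Tm (as ++ bs ++ Γ) c) →
      Comm (lett bs u (lett as (ren (inr bs) t) s))
           (lett as t (lett bs (ren (inr as) u) (ren (swapR as bs) s)))

  BetaComm : ∀ {Γ a} → Tm Γ a → Tm Γ a → Set ℓ
  BetaComm s t = Beta s t ⊎ Comm s t

  data CStep : ∀ {Γ a} → Tm Γ a → Tm Γ a → Set ℓ
  data CSteps : ∀ {Γ as} → Tms Γ as → Tms Γ as → Set ℓ
  data CStep where
    root : ∀ {Γ a} {s t : Tm Γ a} → BetaComm s t → CStep s t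
    tupC : ∀ {Γ as} {ss ss' : Tms Γ as} → CSteps ss ss' → CStep (tup ss) (tup ss')
    letD : ∀ {Γ as b} {t t' : Tm Γ (tensor as)} {u : Tm (as ++ Γ) b} →
      CStep t t' → CStep (lett as t u) (lett as t' u)
    letB : ∀ {Γ as b} {t : Tm Γ (tensor as)} {u u' : Tm (as ++ Γ) b} →
      CStep u u' → CStep (lett as t u) (lett as t u')
    appC : ∀ {Γ as b} {f : Arr as b} {ss ss' : Tms Γ as} → CSteps ss ss' → CStep (app f ss) (app f ss')
  data CSteps where
    hd : ∀ {Γ a as} {s s' : Tm Γ a} {ss : Tms Γ as} → CStep s s' → CSteps (s ∷ ss) (s' ∷ ss)
    tl : ∀ {Γ a as} {s : Tm Γ a} {ss ss' : Tms Γ as} → CSteps ss ss' → CSteps (s ∷ ss) (s ∷ ss')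

  -- closure of η under E-contexts (EStep′: the hole is not at the root)
  data EStep : ∀ {Γ a} → Tm Γ a → Tm Γ a → Set ℓ
  data EStep′ : ∀ {Γ a} → Tm Γ a → Tm Γ a → Set ℓ
  data ESteps : ∀ {Γ as} → Tms Γ as → Tms Γ as → Set ℓ
  data EStep where
    root : ∀ {Γ a} {s t : Tm Γ a} → Eta s t → EStep s t
    deep : ∀ {Γ a} {s t : Tm Γ a} → EStep′ s t → EStep s t
  data EStep′ where
    tupE : ∀ {Γ as} {ss ss' : Tms Γ as} → ESteps ss ss' → EStep′ (tup ss) (tup ss')
    letD : ∀ {Γ as b} {t t' : Tm Γ (tensor as)} {u : Tm (as ++ Γ) b} →
      EStep′ t t' → EStep′ (lett as t u) (lett as t' u)
    letB : ∀ {Γ as b} {t : Tm Γ (tensor as)} {u u' : Tm (as ++ Γ) b} →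
      EStep u u' → EStep′ (lett as t u) (lett as t u')
    appE : ∀ {Γ as b} {f : Arr as b} {ss ss' : Tms Γ as} → ESteps ss ss' → EStep′ (app f ss) (app f ss')
  data ESteps where
    hd : ∀ {Γ a as} {s s' : Tm Γ a} {ss : Tms Γ as} → EStep s s' → ESteps (s ∷ ss) (s' ∷ ss)
    tl : ∀ {Γ a as} {s : Tm Γ a} {ss ss' : Tms Γ as} → ESteps ss ss' → ESteps (s ∷ ss) (s ∷ ss')

  Step : ∀ {Γ a} → Tm Γ a → Tm Γ a → Set ℓ
  Step s t = CStep s t ⊎ EStep s t

  _∼_ : ∀ {Γ a} → Rep Γ a → Rep Γ a → Set ℓ
  _∼_ = EqClosure (λ s t → Step (proj₁ s) (proj₁ t))

  idTm : ∀ {a} → Tm (a ∷ []) a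
  idTm = var vz

  plugSub : ∀ Γ {Δ Θ a} → Tm Θ a → Sub (Γ ++ a ∷ Δ) (Γ ++ Θ ++ Δ)
  plugSub [] {Δ} t vz = ren (inl Δ) t
  plugSub [] {Θ = Θ} t (vs y) = var (inr Θ y)
  plugSub (c ∷ Γ) t vz = var vz
  plugSub (c ∷ Γ) t (vs x) = ren (λ z → vs z) (plugSub Γ t x)

  compTm : ∀ Γ Δ {a b Θ} → Tm (Γ ++ a ∷ Δ) b → Tm Θ a → Tm (Γ ++ Θ ++ Δ) b
  compTm Γ Δ s t = sub (plugSub Γ t) s

  -- symmetric action: the same term, typed in the permuted context
  actTm : ∀ {Γ Δ a} → Perm Γ Δ → Tm Γ a → Tm Δ a
  actTm σ s = ren (Perm.to σ) s

  reTm : ∀ as → Tm as (tensor as)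
  reTm as = tup (vars as (λ x → x))

  genTm : ∀ {as b} → Arr as b → Tm as b
  genTm {as} f = app f (vars as (λ x → x))

record SymRepFunctor {ℓ o h} (R : RepSig ℓ) (S : SymRepMulticat o h)
    (φ : Ty (RepSig.Atom R) → SymRepMulticat.Ob S)
    (φ-⊗ : ∀ as → φ (tensor as) ≡ SymRepMulticat.⨂ S (map φ as))
    : Set (ℓ ⊔ o ⊔ h) where
  open FreeRep R
  open SymRepMulticat S
  field
    F₁     : ∀ {Γ a} → Rep Γ a → Hom (map φ Γ) (φ a)
    F-resp : ∀ {Γ a} {s t : Rep Γ a} → s ∼ t → F₁ s ≡ F₁ t
    F-id   : ∀ {a} (l : Linear (idTm {a})) → F₁ (idTm , l) ≡ id
    F-comp : ∀ Γ Δ {a b Θ} (s : Rep (Γ ++ a ∷ Δ) b) (t : Rep Θ a)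
      (l : Linear (compTm Γ Δ (proj₁ s) (proj₁ t))) →
      F₁ (compTm Γ Δ (proj₁ s) (proj₁ t) , l)
      ≡ subst (λ X → Hom X (φ b)) (map-++₃ φ Γ Θ Δ)
          (comp (map φ Γ) (map φ Δ)
            (subst (λ X → Hom X (φ b)) (map-++ φ Γ (a ∷ Δ)) (F₁ s)) (F₁ t))
    F-act  : ∀ {Γ Δ a} (σ : Perm Γ Δ) (σ' : Perm (map φ Γ) (map φ Δ)) →
      (∀ {c} (x : Var Γ c) → Perm.to σ' (mapVar φ x) ≡ mapVar φ (Perm.to σ x)) →
      (s : Rep Γ a) (l : Linear (actTm σ (proj₁ s))) →
      F₁ (actTm σ (proj₁ s) , l) ≡ F₁ s · σ'
    F-re   : ∀ as (l : Linear (reTm as)) →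
      F₁ (reTm as , l) ≡ subst (Hom (map φ as)) (sym (φ-⊗ as)) (re (map φ as))

Generates : ∀ {ℓ o h} (R : RepSig ℓ) (S : SymRepMulticat o h) (i : SigMap R S) →
  SymRepFunctor R S (SigMap.obj i) (SigMap.obj-⊗ i) → Set (ℓ ⊔ h)
Generates R S i F =
  ∀ {as b} (f : RepSig.Arr R as b) (l : FreeRep.Linear R (FreeRep.genTm R f)) →
  SymRepFunctor.F₁ F (FreeRep.genTm R f , l) ≡ SigMap.arr i f

{-# OPTIONS --safe #-}

-- Write Sem X b for the morphisms of S into b whose inputs are labelled by elements of X,
-- up to relabelling permutations.  Simultaneous composition makes Sem a monad, so a term in
-- context Γ can be interpreted with labels in Γ before anything is known about linearity, and
-- the substitution lemma is the associativity of bind.  A let-bound block is interpreted by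
-- the unique N whose composite with re is the meaning of the body; β, η and the commutations
-- then become monad equations.  A linear term is one whose labelling is bijective, which
-- turns its meaning into an honest morphism.
-- For uniqueness, every linear term is, up to a permutation of its context, built from
-- identities, re and the generators by composition and by packing of let bodies, and packing
-- is determined by composition with re because of β.
module Submission where

open import Defs
open import Level using (Level; _⊔_)
open import Data.Bool using (true; false; if_then_else_)
open import Data.Nat using (ℕ; suc; _+_)
open import Data.Nat.Properties using (+-assoc; suc-injective)
open import Data.Fin using (Fin; zero; suc)
open import Data.Fin.Properties using (+↔⊎)
open import Data.Fin.Permutation using (↔⇒≡)
open import Data.List using (List; []; _∷_; _++_; map; length)
open import Data.List.Properties using (length-++; length-map; ++-identityʳ; map-++)
open import Data.Product using (Σ; ∃; _×_; _,_; proj₁; proj₂)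
open import Data.Sum using (_⊎_; inj₁; inj₂; [_,_]; [_,_]′; map₁; map₂)
open import Data.Sum.Properties using (inj₂-injective)
open import Data.Sum.Function.Propositional using (_⊎-↔_)
open import Data.Empty using (⊥; ⊥-elim)
open import Data.Unit.Polymorphic using (⊤; tt)
open import Function using (_↔_; Inverse; mk↔ₛ′)
open import Function.Properties.Inverse using (↔-sym; ↔-trans)
open import Axiom.UniquenessOfIdentityProofs.WithK using (uip)
open import Relation.Binary.PropositionalEquality hiding ([_])
open import Relation.Binary.Construct.Closure.Equivalence using (gfold; return)

-- Composition in `S` happens at one place of a list, and its laws hold up to casts along
-- associativity of `++`. Both are absorbed before the monad is built: contexts become shapes whose
-- positions form sums, equivariance reduces composition to the first input, and a cast becomes the
-- action of a position-preserving permutation. What is left of a coherence condition is a case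
-- analysis on positions. Meaning is a relation between terms and labelled morphisms. A function on
-- all terms is out of reach, because a let body can be packed only if each bound variable labels
-- exactly one position, and this is read off the meaning of the body. The relation is single
-- valued, and a term has a meaning exactly when it is bound linear; the link with `occ` is a
-- bijection between a fibre of the labelling and `Fin (occ s x)`. Linearity of a composite term is
-- therefore obtained by exhibiting a meaning. In the uniqueness half the obstacle is that a subterm
-- lives in the whole context and is usually not linear there. Each subterm is therefore replaced by
-- a linear core over a context of its own, together with a renaming back.

module _ {a} {A : Set a} where

  -- Positions of variables and the two halves of an append.

  -- Numbers compare variables of two different lists. This is how a cast along an equation of lists
  -- is recognised as the action of a permutation that moves nothing.
  idx : ∀ {Γ : List A} {c} → Var Γ c → ℕ
  idx vz = 0
  idx (vs x) = suc (idx x)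

  idx-injective : ∀ {Γ : List A} {c} (x y : Var Γ c) → idx x ≡ idx y → x ≡ y
  idx-injective vz vz _ = refl
  idx-injective (vs x) (vs y) e = cong vs (idx-injective x y (suc-injective e))

  idx-inl : ∀ {Γ : List A} Δ {c} (x : Var Γ c) → idx (inl Δ x) ≡ idx x
  idx-inl Δ vz = refl
  idx-inl Δ (vs x) = cong suc (idx-inl Δ x)

  idx-inr : ∀ (Γ : List A) {Δ c} (x : Var Δ c) → idx (inr Γ x) ≡ length Γ + idx x
  idx-inr [] x = refl
  idx-inr (_ ∷ Γ) x = cong suc (idx-inr Γ x)

  split-inl : ∀ (Γ : List A) {Δ c} (x : Var Γ c) → split Γ (inl Δ x) ≡ inj₁ x
  split-inl (_ ∷ Γ) vz = refl
  split-inl (_ ∷ Γ) {Δ} (vs x) rewrite split-inl Γ {Δ} x = refl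

  split-inr : ∀ (Γ : List A) {Δ c} (y : Var Δ c) → split Γ (inr Γ y) ≡ inj₂ y
  split-inr [] y = refl
  split-inr (_ ∷ Γ) y rewrite split-inr Γ y = refl

  data AppendView (Γ Δ : List A) {c} : Var (Γ ++ Δ) c → Set a where
    left  : (x : Var Γ c) → AppendView Γ Δ (inl Δ x)
    right : (y : Var Δ c) → AppendView Γ Δ (inr Γ y)

  appendView : ∀ Γ {Δ c} (v : Var (Γ ++ Δ) c) → AppendView Γ Δ v
  appendView [] v = right v
  appendView (_ ∷ Γ) vz = left vz
  appendView (_ ∷ Γ) (vs v) with appendView Γ v
  ... | left x = left (vs x)
  ... | right y = right y

-- Shapes: contexts whose positions under append form a disjoint union on the
-- nose, so that coherence between permutations holds by case analysis.
infixr 6 _⊕_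
data Sh {a} (A : Set a) : Set a where
  leaf : A → Sh A
  lst  : List A → Sh A
  _⊕_  : Sh A → Sh A → Sh A

-- Positions of shapes and their isomorphisms.

module _ {a} {A : Set a} where

  El : Sh A → A → Set a
  El (leaf x) c = x ≡ c
  El (lst Γ) c = Var Γ c
  El (X ⊕ Y) c = El X c ⊎ El Y c

  enum : Sh A → List A
  enum (leaf x) = x ∷ []
  enum (lst Γ) = Γ
  enum (X ⊕ Y) = enum X ++ enum Y

  enc : ∀ X {c} → El X c → Var (enum X) c
  enc (leaf x) refl = vz
  enc (lst Γ) x = x
  enc (X ⊕ Y) (inj₁ x) = inl (enum Y) (enc X x)
  enc (X ⊕ Y) (inj₂ y) = inr (enum X) (enc Y y)

  dec : ∀ X {c} → Var (enum X) c → El X c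
  dec (leaf x) vz = refl
  dec (lst Γ) x = x
  dec (X ⊕ Y) v = [ (λ x → inj₁ (dec X x)) , (λ y → inj₂ (dec Y y)) ] (split (enum X) v)

  dec-inl : ∀ X Y {c} (x : Var (enum X) c) → dec (X ⊕ Y) (inl (enum Y) x) ≡ inj₁ (dec X x)
  dec-inl X Y x rewrite split-inl (enum X) {enum Y} x = refl

  dec-inr : ∀ X Y {c} (y : Var (enum Y) c) → dec (X ⊕ Y) (inr (enum X) y) ≡ inj₂ (dec Y y)
  dec-inr X Y y rewrite split-inr (enum X) y = refl

  dec-enc : ∀ X {c} (x : El X c) → dec X (enc X x) ≡ x
  dec-enc (leaf _) refl = refl
  dec-enc (lst Γ) x = refl
  dec-enc (X ⊕ Y) (inj₁ x) = trans (dec-inl X Y (enc X x)) (cong inj₁ (dec-enc X x))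
  dec-enc (X ⊕ Y) (inj₂ y) = trans (dec-inr X Y (enc Y y)) (cong inj₂ (dec-enc Y y))

  enc-dec : ∀ X {c} (v : Var (enum X) c) → enc X (dec X v) ≡ v
  enc-dec (leaf _) vz = refl
  enc-dec (lst Γ) x = refl
  enc-dec (X ⊕ Y) v with appendView (enum X) v
  ... | left x = trans (cong (enc (X ⊕ Y)) (dec-inl X Y x)) (cong (inl (enum Y)) (enc-dec X x))
  ... | right y = trans (cong (enc (X ⊕ Y)) (dec-inr X Y y)) (cong (inr (enum X)) (enc-dec Y y))

  record Iso (X Y : Sh A) : Set a where
    no-eta-equality
    field
      to      : ∀ {c} → El X c → El Y c
      from    : ∀ {c} → El Y c → El X c
      from-to : ∀ {c} (x : El X c) → from (to x) ≡ x
      to-from : ∀ {c} (y : El Y c) → to (from y) ≡ y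
  open Iso public

  to-injective : ∀ {X Y} (σ : Iso X Y) {c} {x y : El X c} → to σ x ≡ to σ y → x ≡ y
  to-injective σ {x = x} {y} e = trans (sym (from-to σ x)) (trans (cong (from σ) e) (from-to σ y))

  idI : ∀ {X} → Iso X X
  idI = record { to = λ x → x ; from = λ x → x ; from-to = λ _ → refl ; to-from = λ _ → refl }

  infixl 5 _⨟_
  _⨟_ : ∀ {X Y Z} → Iso X Y → Iso Y Z → Iso X Z
  σ ⨟ τ = record
    { to = λ x → to τ (to σ x) ; from = λ z → from σ (from τ z)
    ; from-to = λ x → trans (cong (from σ) (from-to τ _)) (from-to σ x)
    ; to-from = λ z → trans (cong (to τ) (to-from σ _)) (to-from τ z) }

  symI : ∀ {X Y} → Iso X Y → Iso Y X
  symI σ = record { to = from σ ; from = to σ ; from-to = to-from σ ; to-from = from-to σ }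

  infixr 6 _⊕I_
  _⊕I_ : ∀ {X X' Y Y'} → Iso X X' → Iso Y Y' → Iso (X ⊕ Y) (X' ⊕ Y')
  σ ⊕I τ = record
    { to = λ { (inj₁ x) → inj₁ (to σ x) ; (inj₂ y) → inj₂ (to τ y) }
    ; from = λ { (inj₁ x) → inj₁ (from σ x) ; (inj₂ y) → inj₂ (from τ y) }
    ; from-to = λ { (inj₁ x) → cong inj₁ (from-to σ x) ; (inj₂ y) → cong inj₂ (from-to τ y) }
    ; to-from = λ { (inj₁ x) → cong inj₁ (to-from σ x) ; (inj₂ y) → cong inj₂ (to-from τ y) } }

  assocI : ∀ {X Y Z} → Iso ((X ⊕ Y) ⊕ Z) (X ⊕ (Y ⊕ Z))
  assocI = record
    { to = λ { (inj₁ (inj₁ x)) → inj₁ x ; (inj₁ (inj₂ y)) → inj₂ (inj₁ y) ; (inj₂ z) → inj₂ (inj₂ z) }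
    ; from = λ { (inj₁ x) → inj₁ (inj₁ x) ; (inj₂ (inj₁ y)) → inj₁ (inj₂ y) ; (inj₂ (inj₂ z)) → inj₂ z }
    ; from-to = λ { (inj₁ (inj₁ x)) → refl ; (inj₁ (inj₂ y)) → refl ; (inj₂ z) → refl }
    ; to-from = λ { (inj₁ x) → refl ; (inj₂ (inj₁ y)) → refl ; (inj₂ (inj₂ z)) → refl } }

  rotI : ∀ {X Y Z} → Iso (X ⊕ (Y ⊕ Z)) (Y ⊕ (X ⊕ Z))
  rotI = record
    { to = λ { (inj₁ x) → inj₂ (inj₁ x) ; (inj₂ (inj₁ y)) → inj₁ y ; (inj₂ (inj₂ z)) → inj₂ (inj₂ z) }
    ; from = λ { (inj₁ y) → inj₂ (inj₁ y) ; (inj₂ (inj₁ x)) → inj₁ x ; (inj₂ (inj₂ z)) → inj₂ (inj₂ z) }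
    ; from-to = λ { (inj₁ x) → refl ; (inj₂ (inj₁ y)) → refl ; (inj₂ (inj₂ z)) → refl }
    ; to-from = λ { (inj₁ x) → refl ; (inj₂ (inj₁ y)) → refl ; (inj₂ (inj₂ z)) → refl } }

  nilˡI : ∀ {X} → Iso (lst [] ⊕ X) X
  nilˡI = record
    { to = λ { (inj₂ x) → x } ; from = inj₂
    ; from-to = λ { (inj₂ x) → refl } ; to-from = λ _ → refl }

  nilʳI : ∀ {X} → Iso X (X ⊕ lst [])
  nilʳI = record
    { to = inj₁ ; from = λ { (inj₁ x) → x }
    ; from-to = λ _ → refl ; to-from = λ { (inj₁ x) → refl } }

  consI : ∀ {x Γ} → Iso (lst (x ∷ Γ)) (leaf x ⊕ lst Γ)
  consI = record
    { to = λ { vz → inj₁ refl ; (vs v) → inj₂ v }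
    ; from = λ { (inj₁ refl) → vz ; (inj₂ v) → vs v }
    ; from-to = λ { vz → refl ; (vs v) → refl }
    ; to-from = λ { (inj₁ refl) → refl ; (inj₂ v) → refl } }

  enumI : ∀ X → Iso X (lst (enum X))
  enumI X = record { to = enc X ; from = dec X ; from-to = dec-enc X ; to-from = enc-dec X }

  listPerm : ∀ {X Y : Sh A} → Iso X Y → Perm (enum X) (enum Y)
  listPerm {X} {Y} σ = record
    { to = λ v → enc Y (to σ (dec X v))
    ; from = λ v → enc X (from σ (dec Y v))
    ; from-to = λ v → trans (cong (λ z → enc X (from σ z)) (dec-enc Y _))
        (trans (cong (enc X) (from-to σ _)) (enc-dec X v))
    ; to-from = λ v → trans (cong (λ z → enc Y (to σ z)) (dec-enc X _))
        (trans (cong (enc Y) (to-from σ _)) (enc-dec Y v)) }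

  listPerm-inl : ∀ {X Y Z : Sh A} (σ : Iso (X ⊕ Y) Z) {c} (x : Var (enum X) c) →
    Perm.to (listPerm σ) (inl (enum Y) x) ≡ enc Z (to σ (inj₁ (dec X x)))
  listPerm-inl {X} {Y} {Z} σ x = cong (λ z → enc Z (to σ z)) (dec-inl X Y x)

  listPerm-inr : ∀ {X Y Z : Sh A} (σ : Iso (X ⊕ Y) Z) {c} (y : Var (enum Y) c) →
    Perm.to (listPerm σ) (inr (enum X) y) ≡ enc Z (to σ (inj₂ (dec Y y)))
  listPerm-inr {X} {Y} {Z} σ y = cong (λ z → enc Z (to σ z)) (dec-inr X Y y)

  -- `σ` is injective and every `inj₁ z` is already its own image, so the image of a right-hand
  -- position cannot fall into `Z`.
  cancel-to : ∀ {X Y Z} (σ : Iso (Z ⊕ X) (Z ⊕ Y)) →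
    (∀ {c} (z : El Z c) → to σ (inj₁ z) ≡ inj₁ z) →
    ∀ {c} (x : El X c) → Σ (El Y c) λ y → to σ (inj₂ x) ≡ inj₂ y
  cancel-to σ fix x with to σ (inj₂ x) in e
  ... | inj₂ y = y , refl
  ... | inj₁ z with () ← to-injective σ (trans e (sym (fix z)))

  cancelI : ∀ {X Y Z} (σ : Iso (Z ⊕ X) (Z ⊕ Y)) →
    (∀ {c} (z : El Z c) → to σ (inj₁ z) ≡ inj₁ z) →
    Σ (Iso X Y) λ τ → ∀ {c} (x : El X c) → to σ (inj₂ x) ≡ inj₂ (to τ x)
  cancelI {X} {Y} {Z} σ fix = τ , λ x → proj₂ (cancel-to σ fix x)
    where
    fix⁻¹ : ∀ {c} (z : El Z c) → from σ (inj₁ z) ≡ inj₁ z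
    fix⁻¹ z = trans (cong (from σ) (sym (fix z))) (from-to σ (inj₁ z))
    τ : Iso X Y
    τ = record
      { to = λ x → proj₁ (cancel-to σ fix x)
      ; from = λ y → proj₁ (cancel-to (symI σ) fix⁻¹ y)
      ; from-to = λ x → inj₂-injective (trans (sym (proj₂ (cancel-to (symI σ) fix⁻¹ _)))
          (trans (cong (from σ) (sym (proj₂ (cancel-to σ fix x)))) (from-to σ (inj₂ x))))
      ; to-from = λ y → inj₂-injective (trans (sym (proj₂ (cancel-to σ fix _)))
          (trans (cong (to σ) (sym (proj₂ (cancel-to (symI σ) fix⁻¹ y)))) (to-from σ (inj₂ y)))) }

  rem : ∀ {Γ : List A} {c} → Var Γ c → List A
  rem {_ ∷ Γ} vz = Γ
  rem {x ∷ Γ} (vs v) = x ∷ rem v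

  skip : ∀ {Γ : List A} {c d} (v : Var Γ c) → Var (rem v) d → Var Γ d
  skip vz w = vs w
  skip (vs v) vz = vz
  skip (vs v) (vs w) = vs (skip v w)

  -- Brings a chosen position to the head and keeps the order of the others; it is used to treat an
  -- arbitrary input as if it were the first.
  pickI : ∀ {Γ : List A} {c} (v : Var Γ c) → Iso (leaf c ⊕ lst (rem v)) (lst Γ)
  pickI vz = symI consI
  pickI (vs v) = (idI ⊕I consI) ⨟ rotI ⨟ (idI ⊕I pickI v) ⨟ symI consI

  pickI-head : ∀ {Γ : List A} {c} (v : Var Γ c) → to (pickI v) (inj₁ refl) ≡ v
  pickI-head vz = refl
  pickI-head (vs v) = cong vs (pickI-head v)

  pickI-skip : ∀ {Γ : List A} {c d} (v : Var Γ c) (w : Var (rem v) d) → to (pickI v) (inj₂ w) ≡ skip v w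
  pickI-skip vz w = refl
  pickI-skip (vs v) vz = refl
  pickI-skip (vs v) (vs w) = cong vs (pickI-skip v w)

-- Morphisms over shapes: symmetric action, composition at the first input, tensors.

module Shaped {o h} (S : SymRepMulticat o h) where
  open SymRepMulticat S

  -- `enum` is not injective, so `Hom (enum X) b` would not determine `X`; the wrapper keeps the
  -- shape in the type.
  record HX (X : Sh Ob) (b : Ob) : Set h where
    no-eta-equality
    pattern
    constructor ⟨_⟩
    field raw : Hom (enum X) b
  open HX public

  hx-ext : ∀ {X b} {f g : HX X b} → raw f ≡ raw g → f ≡ g
  hx-ext {f = ⟨ _ ⟩} {⟨ _ ⟩} refl = refl

  opaque
    act : ∀ {X Y b} → Iso X Y → HX X b → HX Y b
    act σ f = ⟨ raw f · listPerm σ ⟩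

  opaque
    unfolding act
    act-ext : ∀ {X Y b} {σ τ : Iso X Y} (f : HX X b) →
      (∀ {c} (x : El X c) → to σ x ≡ to τ x) → act σ f ≡ act τ f
    act-ext {X} {Y} {σ = σ} {τ} f e = hx-ext (·-ext (raw f) (listPerm σ) (listPerm τ) (λ v → cong (enc Y) (e (dec X v))))

    act-⨟ : ∀ {X Y Z b} (f : HX X b) (σ : Iso X Y) (τ : Iso Y Z) → act τ (act σ f) ≡ act (σ ⨟ τ) f
    act-⨟ {Y = Y} {Z} f σ τ = hx-ext (trans (·-⨾ (raw f) (listPerm σ) (listPerm τ))
      (·-ext (raw f) (listPerm σ ⨾ listPerm τ) (listPerm (σ ⨟ τ)) (λ v → cong (λ z → enc Z (to τ z)) (dec-enc Y _))))

    act-fixed : ∀ {X b} {σ : Iso X X} (f : HX X b) → (∀ {c} (x : El X c) → to σ x ≡ x) → act σ f ≡ f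
    act-fixed {X} {σ = σ} f e = hx-ext (trans (·-ext (raw f) (listPerm σ) idPerm
      (λ v → trans (cong (enc X) (e (dec X v))) (enc-dec X v))) (·-id (raw f)))

  act-id : ∀ {X b} (f : HX X b) → act idI f ≡ f
  act-id f = act-fixed f λ _ → refl

  act-inverse : ∀ {X Y b} (σ : Iso X Y) (f : HX Y b) → act σ (act (symI σ) f) ≡ f
  act-inverse σ f = trans (act-⨟ f (symI σ) σ) (act-fixed f (to-from σ))

  -- Once `e` is `refl`, a permutation that preserves numbers is pointwise the identity, because a
  -- variable of a given type is determined by its number.
  subst-· : ∀ {Γ Δ b} (e : Γ ≡ Δ) (ρ : Perm Γ Δ) → (∀ {c} (v : Var Γ c) → idx v ≡ idx (Perm.to ρ v)) →
    (f : Hom Γ b) → subst (λ Z → Hom Z b) e f ≡ f · ρ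
  subst-· refl ρ i f = trans (sym (·-id f)) (·-ext f idPerm ρ (λ v → idx-injective v _ (i v)))

  opaque
    unfolding act
    subst-act : ∀ {X Y b} (e : enum X ≡ enum Y) (σ : Iso X Y) →
      (∀ {c} (x : El X c) → idx (enc X x) ≡ idx (enc Y (to σ x))) →
      (f : HX X b) → subst (λ Z → Hom Z b) e (raw f) ≡ raw (act σ f)
    subst-act {X} {Y} e σ i f = subst-· e (listPerm σ)
      (λ v → trans (cong idx (sym (enc-dec X v))) (i (dec X v))) (raw f)

  insert : ∀ (P D X : Sh Ob) {c} → El (P ⊕ D) c → El (P ⊕ (X ⊕ D)) c
  insert P D X (inj₁ p) = inj₁ p
  insert P D X (inj₂ d) = inj₂ (inj₂ d)

  -- The block `X` is rotated to the front, `σ` acts on what remains, and `X` is rotated back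
  -- between the two target blocks.
  insertI : ∀ {P D P' D' : Sh Ob} X → Iso (P ⊕ D) (P' ⊕ D') → Iso (P ⊕ (X ⊕ D)) (P' ⊕ (X ⊕ D'))
  insertI X σ = rotI ⨟ (idI ⊕I σ) ⨟ rotI

  opaque
    compAt : ∀ P D {a b Θ} → HX (P ⊕ (leaf a ⊕ D)) b → HX Θ a → HX (P ⊕ (Θ ⊕ D)) b
    compAt P D f g = ⟨ comp (enum P) (enum D) (raw f) (raw g) ⟩

    -- Composition at the first input. By `compAt-front` it determines composition at every place,
    -- so the monad is computed with `cmp` alone.
    cmp : ∀ {D a b Θ} → HX (leaf a ⊕ D) b → HX Θ a → HX (Θ ⊕ D) b
    cmp {D} f g = ⟨ comp [] (enum D) (raw f) (raw g) ⟩

  insertI-insert : ∀ {P D P' D' : Sh Ob} X (σ : Iso (P ⊕ D) (P' ⊕ D')) {c} (z : El (P ⊕ D) c) →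
    to (insertI X σ) (insert P D X z) ≡ insert P' D' X (to σ z)
  insertI-insert {P} {D} {P'} {D'} X σ = helper
    where
    lem : ∀ {c} (w : El (P' ⊕ D') c) → to (rotI {X = X} {P'} {D'}) (inj₂ w) ≡ insert P' D' X w
    lem (inj₁ _) = refl
    lem (inj₂ _) = refl
    helper : ∀ {c} (z : El (P ⊕ D) c) → to (insertI X σ) (insert P D X z) ≡ insert P' D' X (to σ z)
    helper (inj₁ p) = lem (to σ (inj₁ p))
    helper (inj₂ d) = lem (to σ (inj₂ d))

  outer : ∀ (P D Θ : Sh Ob) {m c} (z : El (P ⊕ D) c) →
    Outer (enum P) (enum D) (enum Θ) (enc (P ⊕ (leaf m ⊕ D)) (insert P D (leaf m) z))
                                     (enc (P ⊕ (Θ ⊕ D)) (insert P D Θ z))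
  outer P D Θ (inj₁ p) = outL (enc P p)
  outer P D Θ (inj₂ d) = outR (enc D d)

  opaque
    unfolding act compAt
    -- `insertI (leaf a) σ` and `insertI Θ σ` move the outer positions in the same way and fix the
    -- inserted block, which is what `IsBlockInsert` demands of the two permutations.
    compAt-act : ∀ {P D P' D' a b Θ} (σ : Iso (P ⊕ D) (P' ⊕ D')) (f : HX (P ⊕ (leaf a ⊕ D)) b) (g : HX Θ a) →
      compAt P' D' (act (insertI (leaf a) σ) f) g ≡ act (insertI Θ σ) (compAt P D f g)
    compAt-act {P} {D} {P'} {D'} {a} {b} {Θ} σ f g =
      hx-ext (comp-·ˡ (enum P) (enum D) (enum P') (enum D') (raw f) (raw g) (listPerm (insertI (leaf a) σ)) (listPerm (insertI Θ σ)) middle (outside , inside))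
      where
      A B A' B' : Sh Ob
      A = P ⊕ (leaf a ⊕ D)
      B = P ⊕ (Θ ⊕ D)
      A' = P' ⊕ (leaf a ⊕ D')
      B' = P' ⊕ (Θ ⊕ D')
      middle : Perm.to (listPerm (insertI (leaf a) σ)) (inr (enum P) vz) ≡ inr (enum P') vz
      middle = cong (λ z → enc A' (to (insertI (leaf a) σ) z)) (dec-enc A (inj₂ (inj₁ refl)))
      inside : ∀ {c} (t : Var (enum Θ) c) →
        Perm.to (listPerm (insertI Θ σ)) (inr (enum P) (inl (enum D) t)) ≡ inr (enum P') (inl (enum D') t)
      inside t = trans (listPerm-inr (insertI Θ σ) (inl (enum D) t))
        (trans (cong (λ z → enc B' (to (insertI Θ σ) (inj₂ z))) (dec-inl Θ D t))
          (cong (λ v → inr (enum P') (inl (enum D') v)) (enc-dec Θ t)))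
      step : ∀ {c} (z : El (P ⊕ D) c) →
        Outer (enum P') (enum D') (enum Θ)
          (enc A' (to (insertI (leaf a) σ) (insert P D (leaf a) z))) (enc B' (to (insertI Θ σ) (insert P D Θ z)))
      step z = subst₂ (Outer (enum P') (enum D') (enum Θ))
        (cong (enc A') (sym (insertI-insert {P} {D} (leaf a) σ z)))
        (cong (enc B') (sym (insertI-insert {P} {D} Θ σ z)))
        (outer P' D' Θ (to σ z))
      outside : ∀ {c} (v : Var (enum A) c) (w : Var (enum B) c) → Outer (enum P) (enum D) (enum Θ) v w →
        Outer (enum P') (enum D') (enum Θ) (Perm.to (listPerm (insertI (leaf a) σ)) v) (Perm.to (listPerm (insertI Θ σ)) w)
      outside _ _ (outL x) = subst₂ (Outer (enum P') (enum D') (enum Θ))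
        (sym (listPerm-inl (insertI (leaf a) σ) x)) (sym (listPerm-inl (insertI Θ σ) x)) (step (inj₁ (dec P x)))
      outside _ _ (outR y) = subst₂ (Outer (enum P') (enum D') (enum Θ))
        (sym (listPerm-inr (insertI (leaf a) σ) (vs y)))
        (sym (trans (listPerm-inr (insertI Θ σ) (inr (enum Θ) y))
          (cong (λ z → enc B' (to (insertI Θ σ) (inj₂ z))) (dec-inr Θ D y))))
        (step (inj₂ (dec D y)))

    cmp-actˡ : ∀ {D D' a b Θ} (σ : Iso D D') (f : HX (leaf a ⊕ D) b) (g : HX Θ a) →
      cmp (act (idI ⊕I σ) f) g ≡ act (idI ⊕I σ) (cmp f g)
    cmp-actˡ {D} {D'} {a} {b} {Θ} σ f g =
      hx-ext (comp-·ˡ [] (enum D) [] (enum D') (raw f) (raw g) (listPerm {X = leaf a ⊕ D} {Y = leaf a ⊕ D'} (idI ⊕I σ)) (listPerm ρ) refl (outside , inside))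
      where
      ρ : Iso (Θ ⊕ D) (Θ ⊕ D')
      ρ = idI ⊕I σ
      inside : ∀ {c} (t : Var (enum Θ) c) → Perm.to (listPerm ρ) (inl (enum D) t) ≡ inl (enum D') t
      inside t = trans (listPerm-inl ρ t) (cong (inl (enum D')) (enc-dec Θ t))
      outside : ∀ {c} (v : Var (a ∷ enum D) c) (w : Var (enum Θ ++ enum D) c) → Outer [] (enum D) (enum Θ) v w →
        Outer [] (enum D') (enum Θ) (Perm.to (listPerm {X = leaf a ⊕ D} {Y = leaf a ⊕ D'} (idI ⊕I σ)) v) (Perm.to (listPerm ρ) w)
      outside _ _ (outR y) = subst (Outer [] (enum D') (enum Θ) _) (sym (listPerm-inr ρ y)) (outR _)

    cmp-actʳ : ∀ {D a b Θ Θ'} (f : HX (leaf a ⊕ D) b) (τ : Iso Θ Θ') (g : HX Θ a) →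
      cmp f (act τ g) ≡ act (τ ⊕I idI) (cmp f g)
    cmp-actʳ {D} {a} {b} {Θ} {Θ'} f τ g =
      hx-ext (comp-·ʳ [] (enum D) (raw f) (raw g) (listPerm τ) (listPerm ρ)
        ((λ ()) , listPerm-inl ρ , λ y → trans (listPerm-inr ρ y) (cong (inr (enum Θ')) (enc-dec D y))))
      where
      ρ : Iso (Θ ⊕ D) (Θ' ⊕ D)
      ρ = τ ⊕I idI

  cmp-act : ∀ {D D' a b Θ Θ'} (σ : Iso D D') (τ : Iso Θ Θ') (f : HX (leaf a ⊕ D) b) (g : HX Θ a) →
    cmp (act (idI ⊕I σ) f) (act τ g) ≡ act (τ ⊕I σ) (cmp f g)
  cmp-act σ τ f g = trans (cmp-actˡ σ f (act τ g)) (trans (cong (act (idI ⊕I σ)) (cmp-actʳ f τ g))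
    (trans (act-⨟ _ _ _) (act-ext _ (λ { (inj₁ _) → refl ; (inj₂ _) → refl }))))

  idX : ∀ {a} → HX (leaf a) a
  idX = ⟨ id ⟩

  opaque
    unfolding act cmp
    cmp-idʳ : ∀ {D a b} (f : HX (leaf a ⊕ D) b) → cmp f idX ≡ f
    cmp-idʳ {D} f = hx-ext (comp-idʳ [] (enum D) (raw f))

    cmp-idˡ : ∀ {a Θ} (g : HX Θ a) → cmp (act nilʳI idX) g ≡ act nilʳI g
    cmp-idˡ {a} {Θ} g = hx-ext (trans (cong (λ f → comp [] [] f (raw g)) is-id)
        (trans (comp-idˡ (raw g))
          (subst-act {X = Θ} {Y = Θ ⊕ lst []} (sym (++-identityʳ (enum Θ))) nilʳI (λ x → sym (idx-inl [] (enc Θ x))) g)))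
      where
      is-id : raw (act nilʳI (idX {a})) ≡ id
      is-id = trans (·-ext _ _ idPerm (λ { vz → refl })) (·-id _)

    -- reassociation does not move positions, so the casts of comp-seq are actions
    cmp-seq : ∀ {D E a b c Θ} (f : HX (leaf a ⊕ D) c) (g : HX (leaf b ⊕ E) a) (h : HX Θ b) →
      act assocI (cmp f (cmp g h)) ≡ cmp (act assocI (cmp f g)) h
    cmp-seq {D} {E} {a} {b} {c} {Θ} f g h = hx-ext (trans (sym
        (subst-act (reassoc [] [] (enum Θ) (enum E) (enum D)) (assocI {X = Θ}) (same Θ) (cmp f (cmp g h))))
      (trans (comp-seq [] (enum D) [] (enum E) (raw f) (raw g) (raw h))
        (cong (λ z → comp [] (enum E ++ enum D) z (raw h))
          (subst-act (reassoc [] [] (b ∷ []) (enum E) (enum D)) (assocI {X = leaf b}) (same (leaf b)) (cmp f g)))))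
      where
      same : ∀ Θ {d} (x : El ((Θ ⊕ E) ⊕ D) d) →
        idx (enc ((Θ ⊕ E) ⊕ D) x) ≡ idx (enc (Θ ⊕ (E ⊕ D)) (to assocI x))
      same Θ (inj₁ (inj₁ x)) = trans (idx-inl (enum D) _) (trans (idx-inl (enum E) (enc Θ x)) (sym (idx-inl (enum E ++ enum D) (enc Θ x))))
      same Θ (inj₁ (inj₂ y)) = trans (idx-inl (enum D) _) (trans (idx-inr (enum Θ) (enc E y))
        (sym (trans (idx-inr (enum Θ) _) (cong (length (enum Θ) +_) (idx-inl (enum D) (enc E y))))))
      same Θ (inj₂ z) = trans (idx-inr (enum Θ ++ enum E) (enc D z))
        (trans (cong (_+ idx (enc D z)) (length-++ (enum Θ)))
        (trans (+-assoc (length (enum Θ)) _ _)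
        (sym (trans (idx-inr (enum Θ) _) (cong (length (enum Θ) +_) (idx-inr (enum E) (enc D z)))))))

  opaque
    unfolding act cmp
    raw-nil : ∀ {X b} (k : HX (lst [] ⊕ X) b) → raw (act nilˡI k) ≡ raw k
    raw-nil {X} k = trans (·-ext (raw k) (listPerm {X = lst [] ⊕ X} nilˡI) idPerm (λ v → enc-dec X v)) (·-id (raw k))

    compAt-nil : ∀ {D a b Θ} (f : HX (lst [] ⊕ (leaf a ⊕ D)) b) (g : HX Θ a) →
      act nilˡI (compAt (lst []) D f g) ≡ cmp (act nilˡI f) g
    compAt-nil {D} f g = hx-ext (trans (raw-nil (compAt (lst []) D f g))
      (cong (λ z → comp [] (enum D) z (raw g)) (sym (raw-nil f))))

  -- Equivariance along the regrouping of `P` and `D` into one block behind an empty left context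
  -- carries the composition to the first input; the rest is bookkeeping of rotations.
  compAt-front : ∀ {P D a b Θ} (f : HX (P ⊕ (leaf a ⊕ D)) b) (g : HX Θ a) →
    compAt P D f g ≡ act rotI (cmp (act rotI f) g)
  compAt-front {P} {D} {a} {b} {Θ} f g = sym (begin
    act rotI (cmp (act rotI f) g)
      ≡⟨ cong (λ z → act rotI (cmp z g)) (sym (trans (act-⨟ f _ _) (act-ext f cases))) ⟩
    act rotI (cmp (act nilˡI (act (insertI (leaf a) σ) f)) g)
      ≡⟨ cong (act rotI) (sym (compAt-nil _ g)) ⟩
    act rotI (act nilˡI (compAt (lst []) (P ⊕ D) (act (insertI (leaf a) σ) f) g))
      ≡⟨ cong (λ z → act rotI (act nilˡI z)) (compAt-act σ f g) ⟩
    act rotI (act nilˡI (act (insertI Θ σ) (compAt P D f g)))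
      ≡⟨ cong (act rotI) (act-⨟ _ _ _) ⟩
    act rotI (act (insertI Θ σ ⨟ nilˡI) (compAt P D f g))
      ≡⟨ trans (act-⨟ _ _ _) (act-fixed _ cases') ⟩
    compAt P D f g ∎)
    where
    open ≡-Reasoning
    σ : Iso (P ⊕ D) (lst [] ⊕ (P ⊕ D))
    σ = symI nilˡI
    cases : ∀ {X c} (x : El (P ⊕ (X ⊕ D)) c) →
      to (insertI X σ ⨟ nilˡI) x ≡ to rotI x
    cases (inj₁ _) = refl
    cases (inj₂ (inj₁ _)) = refl
    cases (inj₂ (inj₂ _)) = refl
    cases' : ∀ {c} (x : El (P ⊕ (Θ ⊕ D)) c) → to (insertI Θ σ ⨟ nilˡI ⨟ rotI) x ≡ x
    cases' (inj₁ _) = refl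
    cases' (inj₂ (inj₁ _)) = refl
    cases' (inj₂ (inj₂ _)) = refl

  castH : ∀ {Γ Δ b} → Γ ≡ Δ → Hom Γ b → Hom Δ b
  castH {b = b} = subst (λ Z → Hom Z b)

  castH-unique : ∀ {Γ Δ b} (e e' : Γ ≡ Δ) (f : Hom Γ b) → castH e f ≡ castH e' f
  castH-unique refl refl f = refl

  comp-castˡ : ∀ {P P'} D {a b Ξ} (e : P ≡ P') (e₁ : P ++ a ∷ D ≡ P' ++ a ∷ D)
    (e₂ : P ++ Ξ ++ D ≡ P' ++ Ξ ++ D) (f : Hom (P ++ a ∷ D) b) (g : Hom Ξ a) →
    comp P' D (castH e₁ f) g ≡ castH e₂ (comp P D f g)
  comp-castˡ D refl refl refl f g = refl

  castH-injective : ∀ {Γ Δ b} (e : Γ ≡ Δ) {f g : Hom Γ b} → castH e f ≡ castH e g → f ≡ g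
  castH-injective refl p = p

  opaque
    unfolding compAt cmp
    -- This is `comp-par` with both of its left-hand contexts empty. The casts on the right are
    -- along loops and disappear by uniqueness of identity proofs; those on the left only pass from
    -- `Θ′` to `Θ′ ++ []` and are pulled out by `comp-castˡ`.
    compAt-par : ∀ {D a b c Θ Ξ} (f : HX (leaf a ⊕ (leaf b ⊕ D)) c) (g : HX Θ a) (h : HX Ξ b) →
      compAt Θ D (cmp f g) h ≡ cmp (compAt (leaf a) D f h) g
    compAt-par {D} {a} {b} {c} {Θ} {Ξ} f g h = hx-ext (castH-injective (assoc4 [] Θ′ [] (Ξ′ ++ D′)) (begin
      castH (assoc4 [] Θ′ [] (Ξ′ ++ D′)) (comp Θ′ D′ (comp [] (b ∷ D′) (raw f) (raw g)) (raw h))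
        ≡⟨ sym (comp-castˡ D′ (sym (++-identityʳ Θ′)) (assoc4 [] Θ′ [] (b ∷ D′)) _ _ (raw h)) ⟩
      comp (Θ′ ++ []) D′ (castH (assoc4 [] Θ′ [] (b ∷ D′)) (comp [] (b ∷ D′) (raw f) (raw g))) (raw h)
        ≡⟨ comp-par [] [] D′ (raw f) (raw g) (raw h) ⟩
      castH (assoc4 [] Θ′ [] (Ξ′ ++ D′)) (comp [] (Ξ′ ++ D′)
        (castH (sym (assoc4 [] (a ∷ []) [] (Ξ′ ++ D′)))
          (comp (a ∷ []) D′ (castH (assoc4 [] (a ∷ []) [] (b ∷ D′)) (raw f)) (raw h))) (raw g))
        ≡⟨ cong (λ z → castH (assoc4 [] Θ′ [] (Ξ′ ++ D′)) (comp [] (Ξ′ ++ D′) z (raw g)))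
             (trans (castH-unique _ refl _)
               (cong (λ z → comp (a ∷ []) D′ z (raw h)) (castH-unique (assoc4 [] (a ∷ []) [] (b ∷ D′)) refl (raw f)))) ⟩
      castH (assoc4 [] Θ′ [] (Ξ′ ++ D′)) (comp [] (Ξ′ ++ D′) (comp (a ∷ []) D′ (raw f) (raw h)) (raw g)) ∎))
      where
      open ≡-Reasoning
      Θ′ Ξ′ D′ : List Ob
      Θ′ = enum Θ
      Ξ′ = enum Ξ
      D′ = enum D

  cmp-par : ∀ {D a b c Θ Ξ} (f : HX (leaf a ⊕ (leaf b ⊕ D)) c) (g : HX Θ a) (h : HX Ξ b) →
    cmp (act rotI (cmp f g)) h ≡ act rotI (cmp (act rotI (cmp (act rotI f) h)) g)
  cmp-par f g h = begin
    cmp (act rotI (cmp f g)) h ≡⟨ sym (act-fixed _ (λ { (inj₁ _) → refl ; (inj₂ (inj₁ _)) → refl ; (inj₂ (inj₂ _)) → refl })) ⟩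
    act (rotI ⨟ rotI) (cmp (act rotI (cmp f g)) h) ≡⟨ sym (act-⨟ _ rotI rotI) ⟩
    act rotI (act rotI (cmp (act rotI (cmp f g)) h)) ≡⟨ cong (act rotI) (sym (compAt-front (cmp f g) h)) ⟩
    act rotI (compAt _ _ (cmp f g) h) ≡⟨ cong (act rotI) (trans (compAt-par f g h) (cong (λ z → cmp z g) (compAt-front f h))) ⟩
    act rotI (cmp (act rotI (cmp (act rotI f) h)) g) ∎
    where open ≡-Reasoning

  opaque
    unfolding cmp
    reX : ∀ as → HX (lst as) (⨂ as)
    reX as = ⟨ re as ⟩

    unre : ∀ {D b} as → HX (lst as ⊕ D) b → HX (leaf (⨂ as) ⊕ D) b
    unre {D} as f = ⟨ re⁻¹ [] (enum D) as (raw f) ⟩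

    cmp-unre : ∀ {D b} as (f : HX (lst as ⊕ D) b) → cmp (unre as f) (reX as) ≡ f
    cmp-unre {D} as f = hx-ext (comp-re⁻¹ [] (enum D) as (raw f))

    unre-cmp : ∀ {D b} as (f : HX (leaf (⨂ as) ⊕ D) b) → unre as (cmp f (reX as)) ≡ f
    unre-cmp {D} as f = hx-ext (re⁻¹-comp [] (enum D) as (raw f))

-- The monad of labelled morphisms.

module Monad {o h} (S : SymRepMulticat o h) where
  open SymRepMulticat S using (Ob; ⨂)
  open Shaped S

  act-tri : ∀ {X Y Z b} {σ : Iso X Y} {τ : Iso Y Z} {ρ : Iso X Z} (f : HX X b) →
    (∀ {c} (x : El X c) → to τ (to σ x) ≡ to ρ x) → act τ (act σ f) ≡ act ρ f
  act-tri f e = trans (act-⨟ f _ _) (act-ext f e)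

  act-sq : ∀ {X Y Y' Z b} {σ : Iso X Y} {τ : Iso Y Z} {σ' : Iso X Y'} {τ' : Iso Y' Z} (f : HX X b) →
    (∀ {c} (x : El X c) → to τ (to σ x) ≡ to τ' (to σ' x)) → act τ (act σ f) ≡ act τ' (act σ' f)
  act-sq f e = trans (act-tri f e) (sym (act-⨟ f _ _))

  -- Sem X b is the free algebra of the symmetric multicategory on the family X,
  -- up to the relabelling equivalence _≈_.
  record Sem {x} (X : Ob → Set x) (b : Ob) : Set (o ⊔ h ⊔ x) where
    no-eta-equality
    pattern
    constructor sem
    field
      shape : Sh Ob
      lab   : ∀ {c} → El shape c → X c
      hom   : HX shape b
  open Sem public

  infix 4 _≈_
  -- No quotient is formed: the relabelling isomorphism stays available as data, and
  -- `packed-injective` and `gen-injective` depend on inspecting it.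
  record _≈_ {x} {X : Ob → Set x} {b} (m n : Sem X b) : Set (o ⊔ h ⊔ x) where
    no-eta-equality
    field
      iso    : Iso (shape m) (shape n)
      lab-eq : ∀ {c} (v : El (shape m) c) → lab n (to iso v) ≡ lab m v
      hom-eq : act iso (hom m) ≡ hom n
  open _≈_ public

  ≈-refl : ∀ {x} {X : Ob → Set x} {b} {m : Sem X b} → m ≈ m
  ≈-refl = record { iso = idI ; lab-eq = λ _ → refl ; hom-eq = act-id _ }

  ≈-sym : ∀ {x} {X : Ob → Set x} {b} {m n : Sem X b} → m ≈ n → n ≈ m
  ≈-sym {n = n} p = record
    { iso = symI (iso p)
    ; lab-eq = λ v → trans (sym (lab-eq p _)) (cong (lab n) (to-from (iso p) v))
    ; hom-eq = trans (cong (act (symI (iso p))) (sym (hom-eq p)))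
        (trans (act-⨟ _ _ _) (act-fixed _ (from-to (iso p)))) }

  ≈-trans : ∀ {x} {X : Ob → Set x} {b} {m n k : Sem X b} → m ≈ n → n ≈ k → m ≈ k
  ≈-trans p q = record
    { iso = iso p ⨟ iso q
    ; lab-eq = λ v → trans (lab-eq q _) (lab-eq p v)
    ; hom-eq = trans (sym (act-⨟ _ _ _)) (trans (cong (act (iso q)) (hom-eq p)) (hom-eq q)) }

  ≡⇒≈ : ∀ {x} {X : Ob → Set x} {b} {m n : Sem X b} → m ≡ n → m ≈ n
  ≡⇒≈ refl = ≈-refl

  headI : ∀ {a : Ob} {Θ D} → Iso (lst (a ∷ Θ) ⊕ D) (leaf a ⊕ (lst Θ ⊕ D))
  headI = (consI ⊕I idI) ⨟ assocI

  -- The inputs of `g` count as finished as soon as they appear, so the rotation puts them behind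
  -- the pending block `P`.
  stp : ∀ {a P D Ξ b} → HX (leaf a ⊕ (P ⊕ D)) b → HX Ξ a → HX (P ⊕ (Ξ ⊕ D)) b
  stp f g = act rotI (cmp f g)

  stp-act : ∀ {a P P' D D' Ξ Ξ' b} (π : Iso P P') (δ : Iso D D') (ξ : Iso Ξ Ξ')
    (f : HX (leaf a ⊕ (P ⊕ D)) b) (g : HX Ξ a) →
    stp (act (idI ⊕I (π ⊕I δ)) f) (act ξ g) ≡ act (π ⊕I (ξ ⊕I δ)) (stp f g)
  stp-act π δ ξ f g = trans (cong (act rotI) (cmp-act (π ⊕I δ) ξ f g))
    (act-sq _ λ { (inj₁ _) → refl ; (inj₂ (inj₁ _)) → refl ; (inj₂ (inj₂ _)) → refl })

  -- The inputs listed in Θ are still to be substituted, those of D are finished.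
  bindL : ∀ {y} {Y : Ob → Set y} Θ {D b} → HX (lst Θ ⊕ D) b →
    (∀ {c} → Var Θ c → Sem Y c) → (∀ {c} → El D c → Y c) → Sem Y b
  bindL [] {D} f e ρ = sem D ρ (act nilˡI f)
  bindL (a ∷ Θ) f e ρ = bindL Θ (stp (act headI f) (hom (e vz))) (λ v → e (vs v)) [ lab (e vz) , ρ ]′

  bindL-cong₁ : ∀ {y} {Y : Ob → Set y} Θ {D D' b} (δ : Iso D D')
    {f : HX (lst Θ ⊕ D) b} {f' : HX (lst Θ ⊕ D') b}
    {e e' : ∀ {c} → Var Θ c → Sem Y c} {ρ : ∀ {c} → El D c → Y c} {ρ' : ∀ {c} → El D' c → Y c} →
    act (idI ⊕I δ) f ≡ f' → (∀ {c} (v : Var Θ c) → e v ≈ e' v) → (∀ {c} (d : El D c) → ρ' (to δ d) ≡ ρ d) →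
    bindL Θ f e ρ ≈ bindL Θ f' e' ρ'
  bindL-cong₁ [] δ {f} refl _ r = record
    { iso = δ ; lab-eq = r ; hom-eq = act-sq f λ { (inj₂ _) → refl } }
  bindL-cong₁ (a ∷ Θ) δ {f} {e = e} {e'} refl p r = bindL-cong₁ Θ (iso (p vz) ⊕I δ)
    (trans (sym (stp-act idI δ (iso (p vz)) _ _))
      (cong₂ stp (act-sq f λ { (inj₁ vz) → refl ; (inj₁ (vs _)) → refl ; (inj₂ _) → refl }) (hom-eq (p vz))))
    (λ v → p (vs v))
    λ { (inj₁ x) → lab-eq (p vz) x ; (inj₂ d) → r d }

  pick : ∀ {Θ : List Ob} {a D} (v : Var Θ a) → Iso (lst Θ ⊕ D) (leaf a ⊕ (lst (rem v) ⊕ D))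
  pick v = (symI (pickI v) ⊕I idI) ⨟ assocI

  -- Any pending input may be substituted first; this is where comp-par enters.
  extract : ∀ {y} {Y : Ob → Set y} {Θ D a b} (v : Var Θ a)
    (f : HX (lst Θ ⊕ D) b) (e : ∀ {c} → Var Θ c → Sem Y c) (ρ : ∀ {c} → El D c → Y c) →
    bindL Θ f e ρ ≈ bindL (rem v) (stp (act (pick v) f) (hom (e v))) (λ w → e (skip v w)) [ lab (e v) , ρ ]′
  extract {Θ = _ ∷ Θ} vz f e ρ = ≡⇒≈ (cong (λ z → bindL Θ (stp z (hom (e vz))) (λ v → e (vs v)) [ lab (e vz) , ρ ]′)
    (act-ext f λ { (inj₁ vz) → refl ; (inj₁ (vs _)) → refl ; (inj₂ _) → refl }))
  extract {Θ = c ∷ Θ} {D} {a} {b} (vs v) f e ρ =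
    ≈-trans (extract v _ (λ w → e (vs w)) _)
      (bindL-cong₁ (rem v) rotI states (λ _ → ≈-refl)
        λ { (inj₁ _) → refl ; (inj₂ (inj₁ _)) → refl ; (inj₂ (inj₂ _)) → refl })
    where
    P = lst (rem v)
    Ξc = shape (e vz)
    Ξa = shape (e (vs v))
    gc = hom (e vz)
    ga = hom (e (vs v))
    k : HX (leaf c ⊕ (leaf a ⊕ (P ⊕ D))) b
    k = act (idI ⊕I pick v) (act headI f)
    F = stp (act (pick (vs v)) f) ga
    -- Both orders of substitution are relabellings of this composite. `cmp-par` brings the order
    -- `gc`, `ga` to it, and `cases₄` compares the two relabellings.
    Z : HX (Ξc ⊕ (Ξa ⊕ (P ⊕ D))) b
    Z = cmp (act rotI (cmp (act rotI k) ga)) gc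
    moved : ∀ {d} (z : El (leaf a ⊕ P) d) →
      to (assocI {Z = Ξc ⊕ D}) (inj₁ z) ≡
      to (idI {X = leaf a} ⊕I rotI {X = Ξc} {Y = P} {Z = D}) (to (rotI {X = Ξc} {Y = leaf a} {Z = P ⊕ D}) (inj₂ (to (assocI {Z = D}) (inj₁ z))))
    moved (inj₁ _) = refl
    moved (inj₂ _) = refl
    cases₁ : ∀ {d} (x : El (Ξc ⊕ (lst Θ ⊕ D)) d) →
      to (pick {D = Ξc ⊕ D} v) (to (rotI {X = Ξc} {Y = lst Θ} {Z = D}) x) ≡
      to (idI {X = leaf a} ⊕I rotI {X = Ξc} {Y = P} {Z = D})
        (to (rotI {X = Ξc} {Y = leaf a} {Z = P ⊕ D}) (to (idI {X = Ξc} ⊕I pick {D = D} v) x))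
    cases₁ (inj₁ x) = refl
    cases₁ (inj₂ (inj₂ x)) = refl
    cases₁ (inj₂ (inj₁ w)) = moved (from (pickI v) w)
    moved' : ∀ {d} (z : El (leaf a ⊕ P) d) →
      to (assocI {Z = D}) (inj₁ (from (idI {X = leaf a} ⊕I consI) (from (rotI {X = leaf a} {Y = leaf c} {Z = P}) (inj₂ z)))) ≡
      to (idI {X = leaf a} ⊕I symI (headI {c} {rem v} {D})) (to (rotI {X = leaf c} {Y = leaf a} {Z = P ⊕ D}) (inj₂ (to (assocI {Z = D}) (inj₁ z))))
    moved' (inj₁ _) = refl
    moved' (inj₂ _) = refl
    cases₂ : ∀ {d} (x : El (lst (c ∷ Θ) ⊕ D) d) →
      to (pick {D = D} (vs v)) x ≡ to (idI {X = leaf a} ⊕I symI (headI {c} {rem v} {D}))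
        (to (rotI {X = leaf c} {Y = leaf a} {Z = P ⊕ D}) (to (idI {X = leaf c} ⊕I pick {D = D} v) (to (headI {c} {Θ} {D}) x)))
    cases₂ (inj₂ d) = refl
    cases₂ (inj₁ vz) = refl
    cases₂ (inj₁ (vs w)) = moved' (from (pickI v) w)
    cases₃ : ∀ {d} (x : El (Ξa ⊕ (leaf c ⊕ (P ⊕ D))) d) →
      to (headI {c} {rem v} {Ξa ⊕ D}) (to (rotI {X = Ξa} {Y = lst (c ∷ rem v)} {Z = D}) (to (idI {X = Ξa} ⊕I symI (headI {c} {rem v} {D})) x))
      ≡ to (idI {X = leaf c} ⊕I rotI {X = Ξa} {Y = P} {Z = D}) (to (rotI {X = Ξa} {Y = leaf c} {Z = P ⊕ D}) x)
    cases₃ (inj₁ _) = refl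
    cases₃ (inj₂ (inj₁ refl)) = refl
    cases₃ (inj₂ (inj₂ (inj₁ _))) = refl
    cases₃ (inj₂ (inj₂ (inj₂ _))) = refl
    cases₄ : ∀ {d} (x : El (Ξc ⊕ (Ξa ⊕ (P ⊕ D))) d) →
      to (idI {X = P} ⊕I rotI {X = Ξa} {Y = Ξc} {Z = D}) (to (rotI {X = Ξa} {Y = P} {Z = Ξc ⊕ D})
        (to (idI {X = Ξa} ⊕I rotI {X = Ξc} {Y = P} {Z = D}) (to (rotI {X = Ξc} {Y = Ξa} {Z = P ⊕ D}) x)))
      ≡ to (rotI {X = Ξc} {Y = P} {Z = Ξa ⊕ D}) (to (idI {X = Ξc} ⊕I rotI {X = Ξa} {Y = P} {Z = D}) x)
    cases₄ (inj₁ _) = refl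
    cases₄ (inj₂ (inj₁ _)) = refl
    cases₄ (inj₂ (inj₂ (inj₁ _))) = refl
    cases₄ (inj₂ (inj₂ (inj₂ _))) = refl
    open ≡-Reasoning
    one : act (pick v) (stp (act headI f) gc) ≡ act (idI ⊕I rotI) (act rotI (cmp k gc))
    one = begin
      act (pick v) (act rotI (cmp (act headI f) gc)) ≡⟨ act-sq _ cases₁ ⟩
      act ((rotI ⨟ (idI ⊕I rotI))) (act (idI ⊕I pick v) (cmp (act headI f) gc))
        ≡⟨ cong (act _) (sym (cmp-actˡ (pick v) _ gc)) ⟩
      act ((rotI ⨟ (idI ⊕I rotI))) (cmp k gc) ≡⟨ sym (act-⨟ _ _ _) ⟩
      act (idI ⊕I rotI) (act rotI (cmp k gc)) ∎
    two : act headI F ≡ act (idI ⊕I rotI) (act rotI (cmp (act rotI k) ga))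
    two = begin
      act headI (act rotI (cmp (act (pick (vs v)) f) ga))
        ≡⟨ cong (λ z → act headI (act rotI (cmp z ga))) (trans (act-ext f cases₂)
             (sym (trans (cong (act _) (trans (cong (act rotI) (act-⨟ f _ _)) (act-⨟ f _ _))) (act-⨟ f _ _)))) ⟩
      act headI (act rotI (cmp (act (idI ⊕I symI headI) (act rotI k)) ga))
        ≡⟨ cong (λ z → act headI (act rotI z)) (cmp-actˡ (symI headI) (act rotI k) ga) ⟩
      act headI (act rotI (act (idI ⊕I symI headI) (cmp (act rotI k) ga)))
        ≡⟨ cong (act headI) (act-⨟ _ _ _) ⟩
      act headI (act ((idI ⊕I symI headI) ⨟ rotI) (cmp (act rotI k) ga))
        ≡⟨ act-sq _ cases₃ ⟩
      act (idI ⊕I rotI) (act rotI (cmp (act rotI k) ga)) ∎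
    states : act (idI ⊕I rotI) (stp (act (pick v) (stp (act headI f) gc)) ga) ≡ stp (act headI F) gc
    states = begin
      act (idI ⊕I rotI) (act rotI (cmp (act (pick v) (stp (act headI f) gc)) ga))
        ≡⟨ cong (λ z → act (idI ⊕I rotI) (act rotI z)) (trans (cong (λ z → cmp z ga) one) (cmp-actˡ rotI _ ga)) ⟩
      act (idI ⊕I rotI) (act rotI (act (idI ⊕I rotI) (cmp (act rotI (cmp k gc)) ga)))
        ≡⟨ cong (λ z → act (idI ⊕I rotI) (act rotI (act (idI ⊕I rotI) z))) (cmp-par k gc ga) ⟩
      act (idI ⊕I rotI) (act rotI (act (idI ⊕I rotI) (act rotI Z)))
        ≡⟨ trans (cong (act _) (cong (act _) (act-⨟ Z _ _))) (trans (cong (act _) (act-⨟ Z _ _)) (act-sq Z cases₄)) ⟩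
      act rotI (act (idI ⊕I rotI) Z) ≡⟨ cong (act rotI) (sym (cmp-actˡ rotI _ gc)) ⟩
      act rotI (cmp (act (idI ⊕I rotI) (act rotI (cmp (act rotI k) ga))) gc)
        ≡⟨ cong (λ z → act rotI (cmp z gc)) (sym two) ⟩
      stp (act headI F) gc ∎

  -- The head of `Θ` sits at `to τ vz` in `Θ'`. There `extract` allows it to be substituted first,
  -- and `cancelI` yields the reordering `τ'` of the inputs still pending, to which the induction
  -- hypothesis applies.
  bindL-cong : ∀ {y} {Y : Ob → Set y} Θ {Θ' D D' b} (τ : Iso (lst Θ) (lst Θ')) (δ : Iso D D')
    {f : HX (lst Θ ⊕ D) b} {f' : HX (lst Θ' ⊕ D') b}
    {e : ∀ {c} → Var Θ c → Sem Y c} {e' : ∀ {c} → Var Θ' c → Sem Y c}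
    {ρ : ∀ {c} → El D c → Y c} {ρ' : ∀ {c} → El D' c → Y c} →
    act (τ ⊕I δ) f ≡ f' → (∀ {c} (v : Var Θ c) → e v ≈ e' (to τ v)) →
    (∀ {c} (d : El D c) → ρ' (to δ d) ≡ ρ d) →
    bindL Θ f e ρ ≈ bindL Θ' f' e' ρ'
  bindL-cong [] {[]} τ δ {f} {e = e} refl p r = bindL-cong₁ [] δ {e = e} {e} (act-ext f λ { (inj₂ _) → refl }) (λ _ → ≈-refl) r
  bindL-cong [] {_ ∷ _} τ δ refl p r = ⊥-elim (no-var (from τ vz))
    where
    no-var : ∀ {c : Ob} → Var [] c → ⊥
    no-var ()
  bindL-cong (a ∷ Θ) {Θ'} {D} {D'} τ δ {f} {_} {e} {e'} {ρ} {ρ'} refl p r =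
    ≈-trans (bindL-cong Θ τ' (iso (p vz) ⊕I δ) homs labels
              λ { (inj₁ x) → lab-eq (p vz) x ; (inj₂ d) → r d })
            (≈-sym (extract v _ e' ρ'))
    where
    v = to τ vz
    fixed : from (pickI v) v ≡ inj₁ refl
    fixed = trans (cong (from (pickI v)) (sym (pickI-head v))) (from-to (pickI v) _)
    cancelled : Σ (Iso (lst Θ) (lst (rem v))) λ σ → ∀ {c} (w : Var Θ c) →
      from (pickI v) (to τ (vs w)) ≡ inj₂ (to σ w)
    cancelled = cancelI (symI consI ⨟ τ ⨟ symI (pickI v))
      λ { refl → fixed }
    τ' = proj₁ cancelled
    labels : ∀ {c} (w : Var Θ c) → e (vs w) ≈ e' (skip v (to τ' w))
    labels w = subst (λ z → e (vs w) ≈ e' z)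
      (trans (sym (to-from (pickI v) _)) (trans (cong (to (pickI v)) (proj₂ cancelled w)) (pickI-skip v _)))
      (p (vs w))
    cases : ∀ {c} (x : El (lst (a ∷ Θ) ⊕ D) c) →
      to (idI {X = leaf a} ⊕I (τ' ⊕I δ)) (to (headI {a} {Θ} {D}) x) ≡ to (pick v) (to (τ ⊕I δ) x)
    cases (inj₁ vz) = cong (λ z → to (assocI {Z = D'}) (inj₁ z)) (sym fixed)
    cases (inj₁ (vs w)) = cong (λ z → to (assocI {Z = D'}) (inj₁ z)) (sym (proj₂ cancelled w))
    cases (inj₂ d) = refl
    homs : act (τ' ⊕I (iso (p vz) ⊕I δ)) (stp (act headI f) (hom (e vz)))
      ≡ stp (act (pick v) (act (τ ⊕I δ) f)) (hom (e' v))
    homs = trans (sym (stp-act τ' δ (iso (p vz)) _ _)) (cong₂ stp (act-sq f cases) (hom-eq (p vz)))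

  opaque
    bindP : ∀ {y} {Y : Ob → Set y} P {D b} → HX (P ⊕ D) b →
      (∀ {c} → El P c → Sem Y c) → (∀ {c} → El D c → Y c) → Sem Y b
    bindP P f e ρ = bindL (enum P) (act (enumI P ⊕I idI) f) (λ v → e (dec P v)) ρ

    bindP-cong : ∀ {y} {Y : Ob → Set y} {P P' D D' b} (τ : Iso P P') (δ : Iso D D')
      {f : HX (P ⊕ D) b} {f' : HX (P' ⊕ D') b}
      {e : ∀ {c} → El P c → Sem Y c} {e' : ∀ {c} → El P' c → Sem Y c}
      {ρ : ∀ {c} → El D c → Y c} {ρ' : ∀ {c} → El D' c → Y c} →
      act (τ ⊕I δ) f ≡ f' → (∀ {c} (v : El P c) → e v ≈ e' (to τ v)) →
      (∀ {c} (d : El D c) → ρ' (to δ d) ≡ ρ d) →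
      bindP P f e ρ ≈ bindP P' f' e' ρ'
    bindP-cong {P = P} {P'} τ δ {f} {e = e} {e'} refl p r =
      bindL-cong (enum P) (symI (enumI P) ⨟ τ ⨟ enumI P') δ
        (act-sq f λ { (inj₁ x) → cong (λ z → inj₁ (enc P' (to τ z))) (dec-enc P x) ; (inj₂ _) → refl })
        (λ v → subst (λ z → e (dec P v) ≈ e' z) (sym (dec-enc P' _)) (p (dec P v)))
        r

    bindP-leaf : ∀ {y} {Y : Ob → Set y} {a P D b} {f : HX ((leaf a ⊕ P) ⊕ D) b}
      {e : ∀ {c} → El (leaf a ⊕ P) c → Sem Y c} {ρ : ∀ {c} → El D c → Y c} →
      bindP (leaf a ⊕ P) f e ρ ≈
      bindP P (stp (act assocI f) (hom (e (inj₁ refl)))) (λ v → e (inj₂ v)) [ lab (e (inj₁ refl)) , ρ ]′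
    bindP-leaf {a = a} {P} {D} {f = f} {e} {ρ} = bindL-cong₁ (enum P) idI (trans (act-fixed _ fixed) (trans
        (cong₂ stp (act-sq f cases) (sym (act-id _))) (trans (stp-act (enumI P) idI idI _ _)
        (act-ext _ λ { (inj₁ _) → refl ; (inj₂ (inj₁ _)) → refl ; (inj₂ (inj₂ _)) → refl }))))
      (λ _ → ≈-refl) (λ { (inj₁ _) → refl ; (inj₂ _) → refl })
      where
      fixed : ∀ {X Y : Sh Ob} {c} (x : El (X ⊕ Y) c) → to (idI {X = X} ⊕I idI {X = Y}) x ≡ x
      fixed (inj₁ _) = refl
      fixed (inj₂ _) = refl
      cases : ∀ {c} (x : El ((leaf a ⊕ P) ⊕ D) c) →
        to (headI {D = D}) (to (enumI (leaf a ⊕ P) ⊕I idI {X = D}) x) ≡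
        to (idI {X = leaf a} ⊕I (enumI P ⊕I idI {X = D})) (to (assocI {X = leaf a} {P} {D}) x)
      cases (inj₁ (inj₁ refl)) = refl
      cases (inj₁ (inj₂ _)) = refl
      cases (inj₂ _) = refl

  ret : ∀ {x} {X : Ob → Set x} {d} → X d → Sem X d
  ret {d = d} x = sem (leaf d) (λ { refl → x }) idX

  opaque
    bind : ∀ {x y} {X : Ob → Set x} {Y : Ob → Set y} {b} → Sem X b → (∀ {c} → X c → Sem Y c) → Sem Y b
    -- At the start every input is pending, so the finished block is the empty list and its
    -- labelling the empty function.
    bind m k = bindP (shape m) (act nilʳI (hom m)) (λ v → k (lab m v)) (λ ())

    bind-cong : ∀ {x y} {X : Ob → Set x} {Y : Ob → Set y} {b} {m n : Sem X b}
      {k l : ∀ {c} → X c → Sem Y c} → m ≈ n → (∀ {c} (x : X c) → k x ≈ l x) → bind m k ≈ bind n l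
    bind-cong {l = l} p q = bindP-cong (iso p) idI
      (trans (act-sq _ λ _ → refl) (cong (act nilʳI) (hom-eq p)))
      (λ v → ≈-trans (q _) (≡⇒≈ (cong l (sym (lab-eq p v))))) (λ ())

  bindL-ret : ∀ {y} {Y : Ob → Set y} Θ {D b} {f : HX (lst Θ ⊕ D) b}
    (r : ∀ {c} → Var Θ c → Y c) (ρ : ∀ {c} → El D c → Y c) →
    bindL Θ f (λ v → ret (r v)) ρ ≈ sem (lst Θ ⊕ D) [ r , ρ ]′ f
  bindL-ret [] {f = f} r ρ = record { iso = symI nilˡI ; lab-eq = λ _ → refl ; hom-eq = act-inverse (symI nilˡI) f }
  bindL-ret (a ∷ Θ) {D} {f = f} r ρ = ≈-trans (bindL-ret Θ (λ v → r (vs v)) _) record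
    { iso = rotI ⨟ symI headI
    ; lab-eq = λ { (inj₁ _) → refl ; (inj₂ (inj₁ refl)) → refl ; (inj₂ (inj₂ _)) → refl }
    ; hom-eq = trans (cong (λ z → act _ (act rotI z)) (cmp-idʳ (act headI f)))
        (trans (cong (act _) (act-⨟ f headI rotI)) (trans (act-⨟ f _ _) (act-fixed f
          λ { (inj₁ vz) → refl ; (inj₁ (vs _)) → refl ; (inj₂ _) → refl }))) }

  opaque
    unfolding bindP
    bindP-ret : ∀ {y} {Y : Ob → Set y} P {D b} {f : HX (P ⊕ D) b} {e : ∀ {c} → El P c → Sem Y c}
      (r : ∀ {c} → El P c → Y c) (ρ : ∀ {c} → El D c → Y c) → (∀ {c} (v : El P c) → e v ≈ ret (r v)) →
      bindP P f e ρ ≈ sem (P ⊕ D) [ r , ρ ]′ f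
    bindP-ret P {D} {f = f} r ρ p = ≈-trans
      (bindL-cong₁ (enum P) idI (act-fixed _ λ { (inj₁ _) → refl ; (inj₂ _) → refl }) (λ v → p (dec P v)) (λ _ → refl))
      (≈-trans (bindL-ret (enum P) (λ v → r (dec P v)) ρ) record
      { iso = symI (enumI P) ⊕I idI
      ; lab-eq = λ { (inj₁ _) → refl ; (inj₂ _) → refl }
      ; hom-eq = trans (act-⨟ f _ _) (act-fixed f λ { (inj₁ x) → cong inj₁ (dec-enc P x) ; (inj₂ _) → refl }) })

  opaque
    unfolding bind
    -- The inputs behind the head are merely renamed, so `bindP-ret` disposes of them and one
    -- composition at the head is left. This is the bridge from `bind` to composition in `S`: the
    -- left unit law, the opening of tensors and the preservation of composition all cross it.
    bind-front : ∀ {x y} {X : Ob → Set x} {Y : Ob → Set y} {a D b} {l : ∀ {c} → El (leaf a ⊕ D) c → X c}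
      {f : HX (leaf a ⊕ D) b} {k : ∀ {c} → X c → Sem Y c} {g : Sem Y a} (r : ∀ {c} → El D c → Y c) →
      k (l (inj₁ refl)) ≈ g → (∀ {c} (d : El D c) → k (l (inj₂ d)) ≈ ret (r d)) →
      bind (sem (leaf a ⊕ D) l f) k ≈ sem (shape g ⊕ D) [ lab g , r ]′ (cmp f (hom g))
    bind-front {D = D} {l = l} {f} {k} {g} r p q =
      ≈-trans (bindP-cong idI idI {e' = [ (λ { refl → g }) , (λ v → k (l (inj₂ v))) ]′} {ρ' = λ ()} refl
        (λ { (inj₁ refl) → p ; (inj₂ _) → ≈-refl }) (λ ()))
      (≈-trans bindP-leaf (≈-trans (bindP-ret D r _ q) record
        { iso = rotI ⨟ (idI ⊕I symI nilʳI)
        ; lab-eq = λ { (inj₁ _) → refl ; (inj₂ (inj₁ _)) → refl }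
        ; hom-eq = trans (act-⨟ _ _ _) (trans (cong (act _) (trans
            (cong (λ z → cmp z (hom g)) (trans (cong (act assocI) (act-⨟ f _ _)) (trans (act-⨟ f _ _) (act-ext f
              λ { (inj₁ _) → refl ; (inj₂ _) → refl }))))
            (cmp-actˡ nilʳI f (hom g))))
            (trans (act-⨟ _ _ _) (act-fixed _ λ { (inj₁ _) → refl ; (inj₂ _) → refl }))) }))

  bind-retˡ : ∀ {x y} {X : Ob → Set x} {Y : Ob → Set y} {a} (v : X a) {k : ∀ {c} → X c → Sem Y c} →
    bind (ret v) k ≈ k v
  bind-retˡ {a = a} v {k} = ≈-trans
    (bind-cong {n = sem (leaf a ⊕ lst []) [ (λ { refl → v }) , (λ ()) ]′ (act nilʳI idX)}
      record { iso = nilʳI ; lab-eq = λ { refl → refl } ; hom-eq = refl } (λ _ → ≈-refl))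
    (≈-trans (bind-front (λ ()) ≈-refl (λ ())) record
      { iso = symI nilʳI
      ; lab-eq = λ { (inj₁ _) → refl }
      ; hom-eq = trans (cong (act _) (cmp-idˡ (hom (k v)))) (act-inverse (symI nilʳI) (hom (k v))) })

  opaque
    unfolding bind
    bind-relabel : ∀ {x y} {X : Ob → Set x} {Y : Ob → Set y} {b} (m : Sem X b) {k : ∀ {c} → X c → Sem Y c}
      (g : ∀ {c} → X c → Y c) → (∀ {c} (x : X c) → k x ≈ ret (g x)) →
      bind m k ≈ sem (shape m) (λ v → g (lab m v)) (hom m)
    bind-relabel m g p = ≈-trans (bindP-ret (shape m) (λ v → g (lab m v)) _ (λ v → p (lab m v))) record
      { iso = symI nilʳI ; lab-eq = λ { (inj₁ _) → refl } ; hom-eq = act-inverse (symI nilʳI) (hom m) }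

  mixI : ∀ {P E Q D : Sh Ob} → Iso ((P ⊕ E) ⊕ (Q ⊕ D)) ((P ⊕ Q) ⊕ (E ⊕ D))
  mixI = assocI ⨟ (idI ⊕I rotI) ⨟ symI assocI

  -- Substituting the outcome of a substitution into g for the head of f amounts to
  -- substituting into f ∘ g.
  bindL-nested : ∀ {y} {Y : Ob → Set y} Θ {a Q D E b} {f : HX (leaf a ⊕ (Q ⊕ D)) b} {g : HX (lst Θ ⊕ E) a}
    {l : ∀ {c} → Var Θ c → Sem Y c} {e : ∀ {c} → El Q c → Sem Y c}
    {ρE : ∀ {c} → El E c → Y c} {ρD : ∀ {c} → El D c → Y c} →
    bindP (lst Θ ⊕ Q) (act mixI (cmp f g)) [ l , e ]′ [ ρE , ρD ]′ ≈
    bindP Q (stp f (hom (bindL Θ g l ρE))) e [ lab (bindL Θ g l ρE) , ρD ]′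
  bindL-nested [] {f = f} {g} = bindP-cong nilˡI idI
    (trans (act-sq _ λ { (inj₁ (inj₂ _)) → refl ; (inj₂ (inj₁ _)) → refl ; (inj₂ (inj₂ _)) → refl })
      (cong (act rotI) (sym (cmp-actʳ f nilˡI g))))
    (λ { (inj₂ _) → ≈-refl }) (λ { (inj₁ _) → refl ; (inj₂ _) → refl })
  bindL-nested (b ∷ Θ) {a} {Q} {D} {E} {f = f} {g} {l} {e} {ρE} {ρD} =
    ≈-trans (bindP-cong headI idI {e' = [ (λ { refl → l vz }) , [ (λ v → l (vs v)) , e ]′ ]′} {ρ' = [ ρE , ρD ]′} refl
      (λ { (inj₁ vz) → ≈-refl ; (inj₁ (vs _)) → ≈-refl ; (inj₂ _) → ≈-refl })
      (λ _ → refl))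
    (≈-trans bindP-leaf
    (≈-trans (bindP-cong idI (symI assocI) states (λ _ → ≈-refl)
      λ { (inj₁ _) → refl ; (inj₂ (inj₁ _)) → refl ; (inj₂ (inj₂ _)) → refl })
    (bindL-nested Θ)))
    where
    u = hom (l vz)
    Ξ = shape (l vz)
    K : HX (leaf b ⊕ ((lst Θ ⊕ E) ⊕ (Q ⊕ D))) _
    K = act assocI (act (headI ⊕I idI) (cmp f g))
    Z : HX ((Ξ ⊕ (lst Θ ⊕ E)) ⊕ (Q ⊕ D)) _
    Z = cmp f (cmp (act headI g) u)
    open ≡-Reasoning
    nested : cmp K u ≡ act assocI Z
    nested = sym (trans (cmp-seq f (act headI g) u)
      (cong (λ z → cmp (act assocI z) u) (cmp-actʳ f headI g)))
    cases₁ : ∀ {c} (x : El ((lst (b ∷ Θ) ⊕ E) ⊕ (Q ⊕ D)) c) →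
      to (assocI {X = leaf b} {lst Θ ⊕ Q} {E ⊕ D}) (to (headI {b} {Θ} {Q} ⊕I idI {X = E ⊕ D}) (to (mixI {lst (b ∷ Θ)} {E} {Q} {D}) x)) ≡
      to (idI {X = leaf b} ⊕I mixI {lst Θ} {E} {Q} {D}) (to (assocI {X = leaf b} {lst Θ ⊕ E} {Q ⊕ D}) (to (headI {b} {Θ} {E} ⊕I idI {X = Q ⊕ D}) x))
    cases₁ (inj₁ (inj₁ vz)) = refl
    cases₁ (inj₁ (inj₁ (vs _))) = refl
    cases₁ (inj₁ (inj₂ _)) = refl
    cases₁ (inj₂ (inj₁ _)) = refl
    cases₁ (inj₂ (inj₂ _)) = refl
    reordered : act assocI (act (headI ⊕I idI) (act mixI (cmp f g))) ≡ act (idI ⊕I mixI) K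
    reordered = trans (cong (act assocI) (act-⨟ _ _ _)) (trans (act-sq _ cases₁)
      (sym (cong (act (idI ⊕I mixI)) (act-⨟ _ _ _))))
    cases₂ : ∀ {c} (x : El ((Ξ ⊕ (lst Θ ⊕ E)) ⊕ (Q ⊕ D)) c) →
      to (idI {X = lst Θ ⊕ Q} ⊕I symI (assocI {X = Ξ} {E} {D})) (to (rotI {X = Ξ} {lst Θ ⊕ Q} {E ⊕ D})
        (to (idI {X = Ξ} ⊕I mixI {lst Θ} {E} {Q} {D}) (to (assocI {X = Ξ}) x))) ≡
      to (mixI {lst Θ} {Ξ ⊕ E} {Q} {D}) (to (rotI {X = Ξ} {lst Θ} {E} ⊕I idI {X = Q ⊕ D}) x)
    cases₂ (inj₁ (inj₁ _)) = refl
    cases₂ (inj₁ (inj₂ (inj₁ _))) = refl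
    cases₂ (inj₁ (inj₂ (inj₂ _))) = refl
    cases₂ (inj₂ (inj₁ _)) = refl
    cases₂ (inj₂ (inj₂ _)) = refl
    states : act (idI ⊕I symI assocI) (stp (act assocI (act (headI ⊕I idI) (act mixI (cmp f g)))) u) ≡
      act mixI (cmp f (stp (act headI g) u))
    states = begin
      act (idI ⊕I symI assocI) (act rotI (cmp (act assocI (act (headI ⊕I idI) (act mixI (cmp f g)))) u))
        ≡⟨ cong (λ z → act (idI ⊕I symI assocI) (act rotI z))
             (trans (cong (λ z → cmp z u) reordered) (trans (cmp-actˡ mixI K u) (cong (act _) nested))) ⟩
      act (idI ⊕I symI assocI) (act rotI (act (idI ⊕I mixI) (act assocI Z)))
        ≡⟨ trans (cong (act _) (cong (act _) (act-⨟ Z _ _))) (trans (cong (act _) (act-⨟ Z _ _)) (act-sq Z cases₂)) ⟩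
      act mixI (act (rotI ⊕I idI) Z) ≡⟨ cong (act mixI) (sym (cmp-actʳ f rotI _)) ⟩
      act mixI (cmp f (stp (act headI g) u)) ∎

  -- The inner result is named up to an equation, so that the opaque `bind` can be supplied for it
  -- through `bind-bindL`.
  bindL-nested′ : ∀ {y} {Y : Ob → Set y} Θ {a Q D E b} {f : HX (leaf a ⊕ (Q ⊕ D)) b} {g : HX (lst Θ ⊕ E) a}
    {l : ∀ {c} → Var Θ c → Sem Y c} {e : ∀ {c} → El Q c → Sem Y c}
    {ρE : ∀ {c} → El E c → Y c} {ρD : ∀ {c} → El D c → Y c} {R : Sem Y a} → bindL Θ g l ρE ≡ R →
    bindP (lst Θ ⊕ Q) (act mixI (cmp f g)) [ l , e ]′ [ ρE , ρD ]′ ≈ bindP Q (stp f (hom R)) e [ lab R , ρD ]′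
  bindL-nested′ Θ refl = bindL-nested Θ

  opaque
    unfolding bind bindP
    bind-bindP : ∀ {x y} {X : Ob → Set x} {Y : Ob → Set y} {b} (m : Sem X b) {k : ∀ {c} → X c → Sem Y c} →
      bind m k ≈ bindP (shape m) (act nilʳI (hom m)) (λ v → k (lab m v)) (λ ())
    bind-bindP m = ≈-refl

    bind-bindL : ∀ {x y} {X : Ob → Set x} {Y : Ob → Set y} {b} (m : Sem X b) {k : ∀ {c} → X c → Sem Y c} →
      bindL (enum (shape m)) (act (enumI (shape m) ⊕I idI) (act nilʳI (hom m))) (λ v → k (lab m (dec (shape m) v))) (λ ())
        ≡ bind m k
    bind-bindL m = refl

  -- Associativity has to be generalised to a substitution in progress: a pending input still owes
  -- `bind (e v) l`, a finished one only `l`. Each inductive step is an instance of `bindL-nested`,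
  -- which rests on `cmp-seq`.
  bindL-bind : ∀ {y z} {Y : Ob → Set y} {Z : Ob → Set z} Θ {D b} {f : HX (lst Θ ⊕ D) b}
    {e : ∀ {c} → Var Θ c → Sem Y c} {ρ : ∀ {c} → El D c → Y c} {l : ∀ {c} → Y c → Sem Z c} →
    bind (bindL Θ f e ρ) l ≈ bindP (lst Θ ⊕ D) (act nilʳI f) [ (λ v → bind (e v) l) , (λ d → l (ρ d)) ]′ (λ ())
  bindL-bind [] {f = f} = ≈-trans (bind-bindP _) (≈-sym (bindP-cong nilˡI idI (trans (act-⨟ _ _ _) (sym (act-tri f λ { (inj₂ _) → refl })))
    (λ { (inj₂ _) → ≈-refl }) (λ ())))
  bindL-bind (a ∷ Θ) {D} {f = f} {e} {ρ} {l} =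
    ≈-trans (bindL-bind Θ)
    (≈-trans (bindP-cong {P' = lst (enum Ξ) ⊕ (lst Θ ⊕ D)} (rotI ⨟ (enumI Ξ ⊕I idI)) nilʳI
      {e' = [ (λ v → l (lab (e vz) (dec Ξ v))) , [ (λ v → bind (e (vs v)) l) , (λ d → l (ρ d)) ]′ ]′}
      {ρ' = [ (λ ()) , (λ ()) ]′} states
      (λ { (inj₁ _) → ≈-refl
         ; (inj₂ (inj₁ x)) → ≡⇒≈ (cong (λ z → l (lab (e vz) z)) (sym (dec-enc Ξ x)))
         ; (inj₂ (inj₂ _)) → ≈-refl })
      (λ ()))
    (≈-trans (bindL-nested′ (enum Ξ) {l = λ v → l (lab (e vz) (dec Ξ v))} (bind-bindL (e vz)))
    (≈-sym (≈-trans (bindP-cong headI idI {e' = [ (λ { refl → bind (e vz) l }) , [ (λ v → bind (e (vs v)) l) , (λ d → l (ρ d)) ]′ ]′}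
        {ρ' = λ ()} refl
        (λ { (inj₁ vz) → ≈-refl ; (inj₁ (vs _)) → ≈-refl ; (inj₂ _) → ≈-refl }) (λ ()))
      (≈-trans bindP-leaf (≡⇒≈ (cong (λ z → bindP (lst Θ ⊕ D) (stp z (hom (bind (e vz) l)))
          [ (λ v → bind (e (vs v)) l) , (λ d → l (ρ d)) ]′ [ lab (bind (e vz) l) , (λ ()) ]′)
        (trans (cong (act assocI) (act-⨟ f _ _)) (act-sq f cases₁)))))))))
    where
    Ξ : Sh Ob
    Ξ = shape (e vz)
    g : HX Ξ a
    g = hom (e vz)
    cases₁ : ∀ {c} (x : El (lst (a ∷ Θ) ⊕ D) c) →
      to (assocI {X = leaf a} {lst Θ ⊕ D} {lst []}) (to (headI {a} {Θ} {D} ⊕I idI {X = lst []}) (to nilʳI x)) ≡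
      to (idI {X = leaf a} ⊕I nilʳI) (to (headI {a} {Θ} {D}) x)
    cases₁ (inj₁ vz) = refl
    cases₁ (inj₁ (vs _)) = refl
    cases₁ (inj₂ _) = refl
    cases₂ : ∀ {c} (x : El (Ξ ⊕ (lst Θ ⊕ D)) c) →
      to ((rotI {X = lst Θ} {Ξ} {D} ⨟ (enumI Ξ ⊕I idI {X = lst Θ ⊕ D})) ⊕I nilʳI {X = lst []}) (to nilʳI (to (rotI {X = Ξ} {lst Θ} {D}) x)) ≡
      to (mixI {lst (enum Ξ)} {lst []} {lst Θ ⊕ D} {lst []}) (to ((nilʳI ⨟ (enumI Ξ ⊕I idI {X = lst []})) ⊕I nilʳI {X = lst Θ ⊕ D}) x)
    cases₂ (inj₁ _) = refl
    cases₂ (inj₂ (inj₁ _)) = refl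
    cases₂ (inj₂ (inj₂ _)) = refl
    states : act ((rotI ⨟ (enumI Ξ ⊕I idI)) ⊕I nilʳI) (act nilʳI (stp (act headI f) g)) ≡
      act mixI (cmp (act (idI ⊕I nilʳI) (act headI f)) (act (enumI Ξ ⊕I idI) (act nilʳI g)))
    states = trans (cong (act _) (act-⨟ _ _ _)) (trans (act-sq _ cases₂) (cong (act mixI)
      (sym (trans (cong (cmp _) (act-⨟ g _ _)) (cmp-act nilʳI _ (act headI f) g)))))

  bind-assoc : ∀ {x y z} {X : Ob → Set x} {Y : Ob → Set y} {Z : Ob → Set z} {b} (m : Sem X b)
    {k : ∀ {c} → X c → Sem Y c} {l : ∀ {c} → Y c → Sem Z c} →
    bind (bind m k) l ≈ bind m (λ x → bind (k x) l)
  bind-assoc m {k} {l} = ≈-trans (≡⇒≈ (cong (λ z → bind z l) (sym (bind-bindL m)))) (≈-trans (bindL-bind (enum (shape m))) (≈-trans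
    (bindP-cong (symI nilʳI ⨟ symI (enumI (shape m))) idI {e' = λ v → bind (k (lab m v)) l} {ρ' = λ ()}
      (trans (cong (act _) (trans (cong (act nilʳI) (act-⨟ _ _ _)) (act-⨟ _ _ _)))
        (trans (act-⨟ _ _ _) (act-ext _ λ x → cong inj₁ (dec-enc (shape m) x))))
      (λ { (inj₁ _) → ≈-refl }) (λ ()))
    (≈-sym (bind-bindP m))))

-- Separating the positions that carry given labels.

module _ {a} {A : Set a} where

  Unique : ∀ {x} {X : A → Set x} (Θ : Sh A) → (∀ {c} → El Θ c → X c) → ∀ {d} → X d → Set (a ⊔ x)
  Unique Θ lab {d} y = Σ (El Θ d) λ v → lab v ≡ y × (∀ w → lab w ≡ y → w ≡ v)

  isolate : ∀ (Θ : Sh A) {d} (v : El Θ d) →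
    Σ (Sh A) λ Θ' → Σ (Iso (leaf d ⊕ Θ') Θ) λ σ → to σ (inj₁ refl) ≡ v
  isolate Θ v = lst (rem (enc Θ v)) , (pickI (enc Θ v) ⨟ symI (enumI Θ)) ,
    trans (cong (dec Θ) (pickI-head (enc Θ v))) (dec-enc Θ v)

  record Splitting {x} {X : A → Set x} (as : List A) (Θ : Sh A) (lab : ∀ {c} → El Θ c → Var as c ⊎ X c) : Set (a ⊔ x) where
    field
      rest      : Sh A
      splitI    : Iso (lst as ⊕ rest) Θ
      rest-lab  : ∀ {c} → El rest c → X c
      split-lab : ∀ {c} (v : El (lst as ⊕ rest) c) → lab (to splitI v) ≡ map₂ rest-lab v

  -- Induction on `as`. The position labelled by the head is brought to the front; since no other
  -- position carries that label, all the remaining labels lie over the tail or in `X`, and they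
  -- still satisfy the uniqueness condition.
  splitting : ∀ {x} {X : A → Set x} (as : List A) (Θ : Sh A) (lab : ∀ {c} → El Θ c → Var as c ⊎ X c) →
    (∀ {c} (y : Var as c) → Unique {X = λ c → Var as c ⊎ X c} Θ lab (inj₁ y)) → Splitting {X = X} as Θ lab
  splitting {X = X} [] Θ lab uniq = record
    { rest = Θ ; splitI = nilˡI
    ; rest-lab = λ v → strip (lab v)
    ; split-lab = λ { (inj₂ v) → strip-eq (lab v) } }
    where
    strip : ∀ {c} → Var {A = A} [] c ⊎ X c → X c
    strip (inj₂ y) = y
    strip-eq : ∀ {c} (z : Var {A = A} [] c ⊎ X c) → z ≡ inj₂ (strip z)
    strip-eq (inj₂ y) = refl
  splitting {X = X} (b ∷ as) Θ lab uniq = record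
    { rest = rest
    ; splitI = (consI ⊕I idI) ⨟ assocI ⨟ (idI ⊕I splitI) ⨟ σ
    ; rest-lab = rest-lab
    ; split-lab = λ { (inj₁ vz) → trans (cong lab σ-head) (proj₁ (proj₂ (uniq vz)))
                    ; (inj₁ (vs v)) → trans (lab₁-eq _) (cong (map₁ vs) (split-lab (inj₁ v)))
                    ; (inj₂ v) → trans (lab₁-eq _) (cong (map₁ vs) (split-lab (inj₂ v))) } }
    where
    v₀ = proj₁ (uniq vz)
    Θ₁ = proj₁ (isolate Θ v₀)
    σ = proj₁ (proj₂ (isolate Θ v₀))
    σ-head : to σ (inj₁ refl) ≡ v₀
    σ-head = proj₂ (proj₂ (isolate Θ v₀))
    classify : ∀ {c} (w : El Θ₁ c) (z : Var (b ∷ as) c ⊎ X c) → lab (to σ (inj₂ w)) ≡ z →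
      Σ (Var as c ⊎ X c) λ y → z ≡ map₁ vs y
    classify w (inj₁ vz) e with () ← to-injective σ {x = inj₂ w} {inj₁ refl}
      (trans (proj₂ (proj₂ (uniq vz)) _ e) (sym σ-head))
    classify w (inj₁ (vs x)) e = inj₁ x , refl
    classify w (inj₂ y) e = inj₂ y , refl
    lab₁ : ∀ {c} → El Θ₁ c → Var as c ⊎ X c
    lab₁ w = proj₁ (classify w _ refl)
    lab₁-eq : ∀ {c} (w : El Θ₁ c) → lab (to σ (inj₂ w)) ≡ map₁ vs (lab₁ w)
    lab₁-eq w = proj₂ (classify w _ refl)
    map₁-vs-injective : ∀ {c} {y z : Var as c ⊎ X c} → map₁ (vs {y = b}) y ≡ map₁ vs z → y ≡ z
    map₁-vs-injective {y = inj₁ _} {inj₁ _} refl = refl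
    map₁-vs-injective {y = inj₂ _} {inj₂ _} refl = refl
    uniq₁ : ∀ {c} (y : Var as c) → Unique {X = λ c → Var as c ⊎ X c} Θ₁ lab₁ (inj₁ y)
    uniq₁ y with from σ (proj₁ (uniq (vs y))) in e
    ... | inj₁ refl with () ← trans (sym (proj₁ (proj₂ (uniq vz)))) (trans (cong lab (trans (sym σ-head)
            (trans (cong (to σ) (sym e)) (to-from σ _)))) (proj₁ (proj₂ (uniq (vs y)))))
    ... | inj₂ w = w
      , map₁-vs-injective (trans (sym (lab₁-eq w)) (trans (cong lab (trans (cong (to σ) (sym e)) (to-from σ _)))
          (proj₁ (proj₂ (uniq (vs y))))))
      , λ w' p → inj₂-injective (trans (sym (from-to σ (inj₂ w')))
          (trans (cong (from σ) (proj₂ (proj₂ (uniq (vs y))) _ (trans (lab₁-eq w') (cong (map₁ vs) p)))) e))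
    open Splitting (splitting as Θ₁ lab₁ uniq₁)

-- Fibres of labellings, and labels used exactly once.

module Fibers {o h} (S : SymRepMulticat o h) where
  open SymRepMulticat S using (Ob; ⨂)
  open Shaped S
  open Monad S

  record Fiber {x} {X : Ob → Set x} {b} (m : Sem X b) {d} (y : X d) : Set (o ⊔ x) where
    constructor fib
    field
      pos     : El (shape m) d
      pos-lab : lab m pos ≡ y
  open Fiber public

  -- Linearity in one label: contractibility of the fibre, stated on positions only because label
  -- equations are proof-irrelevant.
  record One {x} {X : Ob → Set x} {b} (m : Sem X b) {d} (y : X d) : Set (o ⊔ x) where
    constructor one
    field
      centre : Fiber m y
      unique : ∀ w → lab m w ≡ y → w ≡ pos centre
  open One public

  fiber-≡ : ∀ {x} {X : Ob → Set x} {b} {m : Sem X b} {d} {y : X d} {p q : Fiber m y} → pos p ≡ pos q → p ≡ q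
  fiber-≡ {p = fib v refl} {fib _ refl} refl = refl

  Fiber-≈ : ∀ {x} {X : Ob → Set x} {b} {m n : Sem X b} {d} {y : X d} → m ≈ n → Fiber m y ↔ Fiber n y
  Fiber-≈ p = mk↔ₛ′ (λ (fib v e) → fib (to (iso p) v) (trans (lab-eq p v) e))
    (λ (fib w e) → fib (from (iso p) w) (trans (lab-eq (≈-sym p) w) e))
    (λ _ → fiber-≡ (to-from (iso p) _)) (λ _ → fiber-≡ (from-to (iso p) _))

  One-≈ : ∀ {x} {X : Ob → Set x} {b} {m n : Sem X b} {d} {y : X d} → m ≈ n → One m y → One n y
  One-≈ p (one (fib v e) u) = one (fib (to (iso p) v) (trans (lab-eq p v) e))
    λ w e' → trans (sym (to-from (iso p) w)) (cong (to (iso p)) (u _ (trans (lab-eq (≈-sym p) w) e')))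

  One⇒Fin1 : ∀ {x} {X : Ob → Set x} {b} {m : Sem X b} {d} {y : X d} → One m y → Fiber m y ↔ Fin 1
  One⇒Fin1 (one p u) = mk↔ₛ′ (λ _ → zero) (λ _ → p) (λ { zero → refl ; (suc ()) }) (λ (fib w e') → fiber-≡ (sym (u w e')))

  Fin1⇒One : ∀ {x} {X : Ob → Set x} {b} {m : Sem X b} {d} {y : X d} → Fiber m y ↔ Fin 1 → One m y
  Fin1⇒One i = one (Inverse.from i zero) λ w e → cong pos (trans (sym (Inverse.strictlyInverseʳ i (fib w e)))
      (cong (Inverse.from i) (only _)))
    where
    only : (z : Fin 1) → z ≡ zero
    only zero = refl

  Fiber-bindL : ∀ {y} {Y : Ob → Set y} Θ {D b} {f : HX (lst Θ ⊕ D) b}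
    {e : ∀ {c} → Var Θ c → Sem Y c} {ρ : ∀ {c} → El D c → Y c} {d} {z : Y d} →
    Fiber (bindL Θ f e ρ) z ↔ ((∃ λ c → Σ (Var Θ c) λ v → Fiber (e v) z) ⊎ (Σ (El D d) λ x → ρ x ≡ z))
  Fiber-bindL [] = mk↔ₛ′ (λ { (fib x p) → inj₂ (x , p) }) (λ { (inj₂ (x , p)) → fib x p }) (λ { (inj₂ _) → refl }) (λ { (fib _ _) → refl })
  Fiber-bindL (a ∷ Θ) = ↔-trans (Fiber-bindL Θ) (mk↔ₛ′
    (λ { (inj₁ (c , v , p)) → inj₁ (c , vs v , p) ; (inj₂ (inj₁ x , p)) → inj₁ (a , vz , fib x p) ; (inj₂ (inj₂ x , p)) → inj₂ (x , p) })
    (λ { (inj₁ (c , vs v , p)) → inj₁ (c , v , p) ; (inj₁ (_ , vz , fib x p)) → inj₂ (inj₁ x , p) ; (inj₂ (x , p)) → inj₂ (inj₂ x , p) })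
    (λ { (inj₁ (_ , vs _ , _)) → refl ; (inj₁ (_ , vz , _)) → refl ; (inj₂ _) → refl })
    (λ { (inj₁ _) → refl ; (inj₂ (inj₁ _ , _)) → refl ; (inj₂ (inj₂ _ , _)) → refl }))

  opaque
    unfolding bind bindP
    -- This is `Fiber-bindL` without finished inputs, with a position of `m` traded for the label it
    -- carries. The occurrence counts for terms are derived from this decomposition.
    Fiber-bind : ∀ {x y} {X : Ob → Set x} {Y : Ob → Set y} {b} (m : Sem X b) {k : ∀ {c} → X c → Sem Y c} {d} {z : Y d} →
      Fiber (bind m k) z ↔ (∃ λ c → Σ (X c) λ w → Fiber m w × Fiber (k w) z)
    Fiber-bind {X = X} m {k} {d} {z} = ↔-trans (Fiber-bindL (enum Θ)) (mk↔ₛ′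
      (λ { (inj₁ (c , v , p)) → c , lab m (dec Θ v) , fib (dec Θ v) refl , p ; (inj₂ (() , _)) })
      (λ { (c , w , fib v e , p) → inj₁ (c , enc Θ v ,
             subst (λ w → Fiber (k w) z) (trans (sym e) (cong (lab m) (sym (dec-enc Θ v)))) p) })
      (λ { (c , w , fib v e , p) → back (dec-enc Θ v) e _ })
      (λ { (inj₁ (c , v , p)) → cong inj₁ (forth (enc-dec Θ v) _) ; (inj₂ (() , _)) }))
      where
      Θ : Sh Ob
      Θ = shape m
      back : ∀ {c} {v v' : El Θ c} (q : v' ≡ v) {w : X c} (e : lab m v ≡ w) {p : Fiber (k w) z}
        (r : w ≡ lab m v') →
        _≡_ {A = ∃ λ c → Σ (X c) λ w → Fiber m w × Fiber (k w) z}
          (c , lab m v' , fib v' refl , subst (λ w → Fiber (k w) z) r p) (c , w , fib v e , p)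
      back refl refl refl = refl
      forth : ∀ {c} {v v' : Var (enum Θ) c} (q : v' ≡ v) {p : Fiber (k (lab m (dec Θ v))) z}
        (r : lab m (dec Θ v) ≡ lab m (dec Θ v')) →
        _≡_ {A = ∃ λ c → Σ (Var (enum Θ) c) λ v → Fiber (k (lab m (dec Θ v))) z}
          (c , v' , subst (λ w → Fiber (k w) z) r p) (c , v , p)
      forth refl refl = refl

  Fiber-ret : ∀ {x} {X : Ob → Set x} {a} (v : X a) {d} {z : X d} →
    Fiber (ret {X = X} v) z ↔ (_≡_ {A = ∃ X} (a , v) (d , z))
  Fiber-ret {X = X} v = mk↔ₛ′ (λ { (fib refl refl) → refl }) (λ { refl → fib refl refl }) (λ { refl → refl }) (λ { (fib refl refl) → refl })

  One-ret : ∀ {x} {X : Ob → Set x} {a} (v : X a) → One (ret {X = X} v) v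
  One-ret v = one (fib refl refl) λ { refl _ → refl }

  One-bind : ∀ {x y} {X : Ob → Set x} {Y : Ob → Set y} {b} {m : Sem X b} {k : ∀ {c} → X c → Sem Y c}
    {d e} {w : X d} {z : Y e} → (∀ {c} (w' : X c) → Fiber (k w') z → _≡_ {A = ∃ X} (c , w') (d , w)) →
    One m w → One (k w) z → One (bind m k) z
  One-bind {X = X} {m = m} {k} {d} {e} {w} {z} only (one p u) (one p' u') =
    Fin1⇒One (↔-trans (Fiber-bind m) (mk↔ₛ′ (λ _ → zero) (λ _ → d , w , p , p') (λ { zero → refl ; (suc ()) }) same))
    where
    same : ∀ (q : ∃ λ c → Σ (X c) λ w → Fiber m w × Fiber (k w) z) → (d , w , p , p') ≡ q
    same (c , w₁ , q , q') with refl ← only w₁ q' =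
      cong₂ (λ q q' → d , w , q , q') (fiber-≡ (sym (u _ (pos-lab q)))) (fiber-≡ (sym (u' _ (pos-lab q'))))

  isolated : ∀ {x} {X : Ob → Set x} {b} (m : Sem X b) {d} {y : X d} → One m y →
    Σ (Sh Ob) λ D → Σ (∀ {c} → El D c → X c) λ l → Σ (HX (leaf d ⊕ D) b) λ f →
      (m ≈ sem (leaf d ⊕ D) [ (λ { refl → y }) , l ]′ f) × (∀ (v : El D d) → l v ≢ y)
  isolated {X = X} m {d} {y} (one (fib v p) u) with isolate (shape m) v
  ... | D , σ , σ-head = D , (λ w → lab m (to σ (inj₂ w))) , act (symI σ) (hom m) ,
      ≈-sym record { iso = σ
             ; lab-eq = λ { (inj₁ refl) → trans (cong (lab m) σ-head) p ; (inj₂ _) → refl }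
             ; hom-eq = act-inverse σ (hom m) } ,
      λ w e → absurd w (to-injective σ {x = inj₂ w} {inj₁ refl} (trans (u _ e) (sym σ-head)))
    where
    absurd : ∀ (w : El D d) → _≡_ {A = El (leaf d ⊕ D) d} (inj₂ w) (inj₁ refl) → ⊥
    absurd w ()

-- Meanings in context: packing along tensors, the interpretation relation, the substitution lemma.

module Contexts {ℓ o h} (R : RepSig ℓ) (S : SymRepMulticat o h) (i : SigMap R S) where
  open RepSig R
  open FreeRep R
  open SymRepMulticat S using (Ob; Hom; ⨂; re)
  open SigMap i renaming (obj to φ; obj-⊗ to φ-⊗)
  open Shaped S
  open Monad S
  open Fibers S

  -- Labels must be indexed by objects of `S`, but `φ` need not be injective. Keeping the typed
  -- variable inside keeps variables of different types apart even if their objects coincide.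
  data VarO (Γ : Ctx) : Ob → Set ℓ where
    at : ∀ {c} → Var Γ c → VarO Γ (φ c)

  -- Equations between labels are read back as equations between pairs of a type and a variable,
  -- since an equation between objects in the image of `φ` says nothing about the types.
  unAt : ∀ {Γ} → ∃ (VarO Γ) → ∃ (Var Γ)
  unAt (_ , at x) = _ , x

  mapO : ∀ {Γ Δ} → Ren Γ Δ → ∀ {d} → VarO Γ d → VarO Δ d
  mapO ρ (at x) = at (ρ x)

  Sm : Ctx → Ob → Set (ℓ ⊔ o ⊔ h)
  Sm Γ d = Sem (VarO Γ) d

  Env : Ctx → Ctx → Set (ℓ ⊔ o ⊔ h)
  Env Γ Δ = ∀ {c} → Var Γ c → Sm Δ (φ c)

  on : ∀ {Γ Δ} → Env Γ Δ → ∀ {d} → VarO Γ d → Sm Δ d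
  on k (at x) = k x

  infixl 8 _⟪_⟫
  _⟪_⟫ : ∀ {Γ Δ d} → Sm Γ d → Env Γ Δ → Sm Δ d
  m ⟪ k ⟫ = bind m (on k)

  v : ∀ {Γ c} → Var Γ c → Sm Γ (φ c)
  v x = ret (at x)

  vr : ∀ {Γ Δ} → Ren Γ Δ → Env Γ Δ
  vr ρ x = v (ρ x)

  infixr 7 _▸_
  _▸_ : ∀ {a Γ Δ} → Sm Δ (φ a) → Env Γ Δ → Env (a ∷ Γ) Δ
  (m ▸ k) vz = m
  (m ▸ k) (vs x) = k x

  ⟪⟫-cong : ∀ {Γ Δ d} {m n : Sm Γ d} {k l : Env Γ Δ} → m ≈ n → (∀ {c} (x : Var Γ c) → k x ≈ l x) →
    m ⟪ k ⟫ ≈ n ⟪ l ⟫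
  ⟪⟫-cong p q = bind-cong p λ { (at x) → q x }

  ⟪⟫-congʳ : ∀ {Γ Δ d} (m : Sm Γ d) {k l : Env Γ Δ} → (∀ {c} (x : Var Γ c) → k x ≈ l x) → m ⟪ k ⟫ ≈ m ⟪ l ⟫
  ⟪⟫-congʳ m = ⟪⟫-cong ≈-refl

  ⟪⟫-congˡ : ∀ {Γ Δ d} {m n : Sm Γ d} {k : Env Γ Δ} → m ≈ n → m ⟪ k ⟫ ≈ n ⟪ k ⟫
  ⟪⟫-congˡ p = ⟪⟫-cong p λ _ → ≈-refl

  ⟪⟫-assoc : ∀ {Γ Δ Ε d} (m : Sm Γ d) {k : Env Γ Δ} {l : Env Δ Ε} → m ⟪ k ⟫ ⟪ l ⟫ ≈ m ⟪ (λ x → k x ⟪ l ⟫) ⟫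
  ⟪⟫-assoc m = ≈-trans (bind-assoc m) (bind-cong ≈-refl λ { (at x) → ≈-refl })

  ⟪⟫-sq : ∀ {Γ Δ Δ' Ε d} (m : Sm Γ d) {k : Env Γ Δ} {l : Env Δ Ε} {k' : Env Γ Δ'} {l' : Env Δ' Ε} →
    (∀ {c} (x : Var Γ c) → k x ⟪ l ⟫ ≈ k' x ⟪ l' ⟫) → m ⟪ k ⟫ ⟪ l ⟫ ≈ m ⟪ k' ⟫ ⟪ l' ⟫
  ⟪⟫-sq m p = ≈-trans (⟪⟫-assoc m) (≈-trans (⟪⟫-congʳ m p) (≈-sym (⟪⟫-assoc m)))

  ⟪⟫-tri : ∀ {Γ Δ Ε d} (m : Sm Γ d) {k : Env Γ Δ} {l : Env Δ Ε} {k' : Env Γ Ε} →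
    (∀ {c} (x : Var Γ c) → k x ⟪ l ⟫ ≈ k' x) → m ⟪ k ⟫ ⟪ l ⟫ ≈ m ⟪ k' ⟫
  ⟪⟫-tri m p = ≈-trans (⟪⟫-assoc m) (⟪⟫-congʳ m p)

  v-⟪⟫ : ∀ {Γ Δ c} (x : Var Γ c) {k : Env Γ Δ} → v x ⟪ k ⟫ ≈ k x
  v-⟪⟫ x = bind-retˡ (at x)

  ⟪⟫-relabel : ∀ {Γ Δ d} (m : Sm Γ d) {k : Env Γ Δ} (ρ : Ren Γ Δ) → (∀ {c} (x : Var Γ c) → k x ≈ v (ρ x)) →
    m ⟪ k ⟫ ≈ sem (shape m) (λ x → mapO ρ (lab m x)) (hom m)
  ⟪⟫-relabel m ρ p = bind-relabel m (mapO ρ) λ { (at x) → p x }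

  ⟪v⟫ : ∀ {Γ d} (m : Sm Γ d) {k : Env Γ Γ} → (∀ {c} (x : Var Γ c) → k x ≈ v x) → m ⟪ k ⟫ ≈ m
  ⟪v⟫ m p = ≈-trans (⟪⟫-relabel m (λ x → x) p) record { iso = idI ; lab-eq = λ x → same (lab m x) ; hom-eq = act-id _ }
    where
    same : ∀ {Γ d} (x : VarO Γ d) → x ≡ mapO (λ y → y) x
    same (at _) = refl

  decO : ∀ Γ {d} → Var (map φ Γ) d → VarO Γ d
  decO (_ ∷ Γ) vz = at vz
  decO (_ ∷ Γ) (vs x) = mapO vs (decO Γ x)

  encO : ∀ {Γ d} → VarO Γ d → Var (map φ Γ) d
  encO (at x) = mapVar φ x

  encO-vs : ∀ {a Γ d} (x : VarO Γ d) → encO (mapO (vs {y = a}) x) ≡ vs (encO x)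
  encO-vs (at x) = refl

  encO-decO : ∀ Γ {d} (x : Var (map φ Γ) d) → encO (decO Γ x) ≡ x
  encO-decO (_ ∷ Γ) vz = refl
  encO-decO (_ ∷ Γ) (vs x) = trans (encO-vs (decO Γ x)) (cong vs (encO-decO Γ x))

  decO-mapVar : ∀ {Γ c} (x : Var Γ c) → decO Γ (mapVar φ x) ≡ at x
  decO-mapVar vz = refl
  decO-mapVar (vs x) = cong (mapO vs) (decO-mapVar x)

  decO-encO : ∀ {Γ d} (x : VarO Γ d) → decO Γ (encO x) ≡ x
  decO-encO (at x) = decO-mapVar x

  gen : ∀ {as d} → HX (lst (map φ as)) d → Sm as d
  gen {as} f = sem (lst (map φ as)) (decO as) f

  -- The labels of `gen` are pairwise distinct, so an isomorphism respecting them is the identity.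
  -- Through this lemma equations up to `≈` become equations in `S`.
  gen-injective : ∀ {as d} {f g : HX (lst (map φ as)) d} → gen {as} f ≈ gen g → f ≡ g
  gen-injective {as} {f = f} p = trans (sym (act-fixed f λ x →
      trans (sym (encO-decO as _)) (trans (cong encO (lab-eq p x)) (encO-decO as x)))) (hom-eq p)

  One-gen : ∀ {as d} (f : HX (lst (map φ as)) d) {c} (x : VarO as c) → One (gen f) x
  One-gen {as} f x = one (fib (encO x) (decO-encO x)) λ w e → trans (sym (encO-decO as w)) (cong encO e)

  linear⇒gen : ∀ {Γ d} (m : Sm Γ d) → (∀ {c} (x : Var Γ c) → One m (at x)) →
    Σ (HX (lst (map φ Γ)) d) λ f → m ≈ gen f
  linear⇒gen {Γ} m ones = act σ (hom m) , record
    { iso = σ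
    ; lab-eq = λ x → decO-encO (lab m x)
    ; hom-eq = refl }
    where
    find : ∀ {d} (x : VarO Γ d) → One m x
    find (at x) = ones x
    σ : Iso (shape m) (lst (map φ Γ))
    σ = record
      { to = λ x → encO (lab m x)
      ; from = λ x → pos (centre (find (decO Γ x)))
      ; from-to = λ x → sym (unique (find (decO Γ (encO (lab m x)))) x (sym (decO-encO (lab m x))))
      ; to-from = λ x → trans (cong encO (pos-lab (centre (find (decO Γ x))))) (encO-decO Γ x) }

  reO : ∀ as → HX (lst (map φ as)) (φ (tensor as))
  reO as = subst (HX (lst (map φ as))) (sym (φ-⊗ as)) (reX (map φ as))

  cmp-re-injective : ∀ {t D b} as (e : t ≡ ⨂ as) {f g : HX (leaf t ⊕ D) b} →
    cmp f (subst (HX (lst as)) (sym e) (reX as)) ≡ cmp g (subst (HX (lst as)) (sym e) (reX as)) → f ≡ g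
  cmp-re-injective as refl {f} {g} p = trans (sym (unre-cmp as f)) (trans (cong (unre as) p) (unre-cmp as g))

  cmp-re-surjective : ∀ {t D b} as (e : t ≡ ⨂ as) (g : HX (lst as ⊕ D) b) →
    Σ (HX (leaf t ⊕ D) b) λ f → cmp f (subst (HX (lst as)) (sym e) (reX as)) ≡ g
  cmp-re-surjective as refl g = unre as g , cmp-unre as g

  unpack : ∀ {Γ} as → Env (tensor as ∷ Γ) (as ++ Γ)
  unpack {Γ} as = (gen (reO as) ⟪ vr (inl Γ) ⟫) ▸ vr (inr as)

  -- Precomposition with `re` at the head variable, expressed by substitution so that it applies to
  -- every meaning, linear or not.
  opened : ∀ {Γ d} as → Sm (tensor as ∷ Γ) d → Sm (as ++ Γ) d
  opened as N = N ⟪ unpack as ⟫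

  strip : ∀ {a Γ d} (z : VarO (a ∷ Γ) d) → (_≡_ {A = ∃ (VarO (a ∷ Γ))} (d , z) (φ a , at vz)) ⊎ Σ (VarO Γ d) λ w → z ≡ mapO vs w
  strip (at vz) = inj₁ refl
  strip (at (vs x)) = inj₂ (at x , refl)

  packed : ∀ {Γ d a D} → (∀ {c} → El D c → VarO Γ c) → HX (leaf (φ a) ⊕ D) d → Sm (a ∷ Γ) d
  packed {a = a} {D} l f = sem (leaf (φ a) ⊕ D) [ (λ { refl → at vz }) , (λ x → mapO vs (l x)) ]′ f

  One-packed : ∀ {Γ d a D} (l : ∀ {c} → El D c → VarO Γ c) (f : HX (leaf (φ a) ⊕ D) d) → One (packed l f) (at vz)
  One-packed {Γ} {a = a} l f = one (fib (inj₁ refl) refl) λ { (inj₁ e) _ → cong inj₁ (uip e refl) ; (inj₂ w) e → ⊥-elim (clash (l w) e) }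
    where
    clash : ∀ (x : VarO Γ (φ a)) → mapO vs x ≢ at vz
    clash x e = clash' (φ a) x (cong (λ z → unAt (_ , z)) e)
      where
      clash' : ∀ d (x : VarO Γ d) → unAt (_ , mapO (vs {y = a}) x) ≢ (a , vz)
      clash' _ (at x) ()

  -- A head variable used once can be isolated as a leaf in front; the other labels then avoid it
  -- and are weakenings of labels over `Γ`. In this form `opened` is a single composition with `re`.
  pack-one : ∀ {Γ d a} (N : Sm (a ∷ Γ) d) → One N (at vz) →
    Σ (Sh Ob) λ D → Σ (∀ {c} → El D c → VarO Γ c) λ l → Σ (HX (leaf (φ a) ⊕ D) d) λ f → N ≈ packed l f
  pack-one {Γ} {a = a} N u with isolated N u
  ... | D , l , f , p , away = D , (λ x → proj₁ (stripped x)) , f , ≈-trans p record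
      { iso = idI ; lab-eq = λ { (inj₁ refl) → refl ; (inj₂ x) → sym (proj₂ (stripped x)) } ; hom-eq = act-id f }
    where
    stripped : ∀ {c} (x : El D c) → Σ (VarO Γ c) λ w → l x ≡ mapO vs w
    stripped x = helper x (strip (l x))
      where
      helper : ∀ {c} (x : El D c) → (_≡_ {A = ∃ (VarO (a ∷ Γ))} (c , l x) (φ a , at vz)) ⊎ (Σ (VarO Γ c) λ w → l x ≡ mapO vs w) →
        Σ (VarO Γ c) λ w → l x ≡ mapO vs w
      helper x (inj₂ q) = q
      helper {c} x (inj₁ e) = ⊥-elim (lem c x (l x) refl e)
        where
        lem : ∀ c (x : El D c) z → l x ≡ z → _≢_ {A = ∃ (VarO (a ∷ Γ))} (c , z) (φ a , at vz)
        lem _ x _ q refl = away x q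

  opened-packed : ∀ {Γ d as D} (l : ∀ {c} → El D c → VarO Γ c) (f : HX (leaf (φ (tensor as)) ⊕ D) d) →
    opened as (packed l f) ≈ sem (lst (map φ as) ⊕ D) [ (λ x → mapO (inl Γ) (decO as x)) , (λ x → mapO (inr as) (l x)) ]′ (cmp f (reO as))
  opened-packed {Γ} {as = as} l f = bind-front (λ x → mapO (inr as) (l x))
    (⟪⟫-relabel (gen (reO as)) (inl Γ) (λ _ → ≈-refl))
    (λ x → outer-lab (l x))
    where
    outer-lab : ∀ {c} (z : VarO Γ c) → on (unpack as) (mapO vs z) ≈ ret (mapO (inr as) z)
    outer-lab (at x) = ≈-refl

  splitO : ∀ as {Γ d} → VarO (as ++ Γ) d → Var (map φ as) d ⊎ VarO Γ d
  splitO as (at x) = [ (λ y → inj₁ (mapVar φ y)) , (λ y → inj₂ (at y)) ]′ (split as x)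

  joinO : ∀ as {Γ d} → Var (map φ as) d ⊎ VarO Γ d → VarO (as ++ Γ) d
  joinO as {Γ} = [ (λ x → mapO (inl Γ) (decO as x)) , mapO (inr as) ]′

  joinO-splitO : ∀ as {Γ d} (x : VarO (as ++ Γ) d) → joinO as (splitO as x) ≡ x
  joinO-splitO as {Γ} (at x) with appendView as x
  ... | left y rewrite split-inl as {Γ} y | decO-mapVar y = refl
  ... | right y rewrite split-inr as y = refl

  splitO-inl : ∀ as {Γ d} (x : VarO as d) → splitO as (mapO (inl Γ) x) ≡ inj₁ (encO x)
  splitO-inl as {Γ} (at x) rewrite split-inl as {Γ} x = refl

  splitO-inr : ∀ as {Γ d} (x : VarO Γ d) → splitO as (mapO (inr as) x) ≡ inj₂ x
  splitO-inr as (at x) rewrite split-inr as x = refl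

  splitO-joinO : ∀ as {Γ d} (z : Var (map φ as) d ⊎ VarO Γ d) → splitO as (joinO as z) ≡ z
  splitO-joinO as (inj₁ x) = trans (splitO-inl as (decO as x)) (cong inj₁ (encO-decO as x))
  splitO-joinO as (inj₂ y) = splitO-inr as y

  repacked : ∀ as {Γ d D} → (∀ {c} → El D c → VarO Γ c) → HX (leaf (φ (tensor as)) ⊕ D) d → Sm (as ++ Γ) d
  repacked as {Γ} {D = D} l f =
    sem (lst (map φ as) ⊕ D) [ (λ x → mapO (inl Γ) (decO as x)) , (λ x → mapO (inr as) (l x)) ]′ (cmp f (reO as))

  -- The isomorphism fixes the positions labelled by `as`, whose labels are distinct from each other
  -- and from those over `Γ`. It therefore restricts to the remaining positions, and `re` can be
  -- cancelled.
  packed-injective : ∀ as {Γ d D D'} {l : ∀ {c} → El D c → VarO Γ c} {l' : ∀ {c} → El D' c → VarO Γ c}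
    {f : HX (leaf (φ (tensor as)) ⊕ D) d} {f' : HX (leaf (φ (tensor as)) ⊕ D') d} →
    repacked as l f ≈ repacked as l' f' → packed l f ≈ packed l' f'
  packed-injective as {Γ} {D = D} {D'} {l} {l'} {f} {f'} r = record
      { iso = idI ⊕I τ
      ; lab-eq = λ { (inj₁ refl) → refl ; (inj₂ x) → cong (mapO vs) (l-eq x) }
      ; hom-eq = cmp-re-injective (map φ as) (φ-⊗ as) (trans (cmp-actˡ τ f (reO as))
          (trans (act-ext _ λ { (inj₁ x) → sym (fixes x) ; (inj₂ x) → sym (τ-eq x) }) (hom-eq r))) }
    where
    view : ∀ {D'} (l' : ∀ {c} → El D' c → VarO Γ c) {c} (x : El (lst (map φ as) ⊕ D') c) →
      splitO as ([ (λ x → mapO (inl Γ) (decO as x)) , (λ x → mapO (inr as) (l' x)) ]′ x) ≡ map₂ l' x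
    view l' (inj₁ x) = splitO-joinO as (inj₁ x)
    view l' (inj₂ x) = splitO-joinO as (inj₂ (l' x))
    labels : ∀ {c} (x : El (lst (map φ as) ⊕ D) c) → map₂ l' (to (iso r) x) ≡ map₂ l x
    labels x = trans (sym (view l' (to (iso r) x))) (trans (cong (splitO as) (lab-eq r x)) (view l x))
    fixes : ∀ {c} (x : Var (map φ as) c) → to (iso r) (inj₁ x) ≡ inj₁ x
    fixes x with to (iso r) (inj₁ x) | labels (inj₁ x)
    ... | inj₁ _ | refl = refl
    τ = proj₁ (cancelI (iso r) fixes)
    τ-eq : ∀ {c} (x : El D c) → to (iso r) (inj₂ x) ≡ inj₂ (to τ x)
    τ-eq = proj₂ (cancelI (iso r) fixes)
    l-eq : ∀ {c} (x : El D c) → l' (to τ x) ≡ l x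
    l-eq x = inj₂-injective (trans (cong (map₂ l') (sym (τ-eq x))) (labels (inj₂ x)))

  -- The injective half of the universal property of `re`, carried over to meanings by the normal
  -- form of `pack-one`.
  opened-injective : ∀ {Γ d} as (N N' : Sm (tensor as ∷ Γ) d) → One N (at vz) → One N' (at vz) →
    opened as N ≈ opened as N' → N ≈ N'
  opened-injective as N N' u u' p =
    ≈-trans q (≈-trans (packed-injective as (≈-trans (≈-sym (opened-packed l f)) (≈-trans (≈-sym (⟪⟫-congˡ q))
      (≈-trans p (≈-trans (⟪⟫-congˡ q') (opened-packed l' f')))))) (≈-sym q'))
    where
    l = proj₁ (proj₂ (pack-one N u))
    f = proj₁ (proj₂ (proj₂ (pack-one N u)))
    q = proj₂ (proj₂ (proj₂ (pack-one N u)))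
    l' = proj₁ (proj₂ (pack-one N' u'))
    f' = proj₁ (proj₂ (proj₂ (pack-one N' u')))
    q' = proj₂ (proj₂ (proj₂ (pack-one N' u')))

  -- The surjective half: `splitting` gathers the bound positions into one block in front, in the
  -- order of `as`, and there the inverse to composition with `re` applies.
  opened-surjective : ∀ {Γ d} as (m : Sm (as ++ Γ) d) → (∀ {c} (x : Var as c) → One m (at (inl Γ x))) →
    Σ (Sm (tensor as ∷ Γ) d) λ N → One N (at vz) × opened as N ≈ m
  opened-surjective {Γ} {d} as m ones = packed rest-lab f , One-packed rest-lab f , ≈-trans (opened-packed rest-lab f) record
      { iso = splitI
      ; lab-eq = λ x → trans (sym (joinO-splitO as _)) (trans (cong (joinO as) (split-lab x)) (joined x))
      ; hom-eq = trans (cong (act splitI) (proj₂ solved)) (act-inverse splitI (hom m)) }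
    where
    find : ∀ {d} (x : VarO as d) → One m (mapO (inl Γ) x)
    find (at x) = ones x
    open Splitting (splitting {X = VarO Γ} (map φ as) (shape m) (λ x → splitO as (lab m x)) λ y →
      pos (centre (find (decO as y))) ,
      trans (cong (splitO as) (pos-lab (centre (find (decO as y))))) (splitO-joinO as (inj₁ y)) ,
      λ w e → unique (find (decO as y)) w (trans (sym (joinO-splitO as (lab m w))) (cong (joinO as) e)))
    solved : Σ (HX (leaf (φ (tensor as)) ⊕ rest) d) λ f → cmp f (reO as) ≡ act (symI splitI) (hom m)
    solved = cmp-re-surjective (map φ as) (φ-⊗ as) (act (symI splitI) (hom m))
    f = proj₁ solved
    joined : ∀ {c} (x : El (lst (map φ as) ⊕ rest) c) →
      joinO as (map₂ rest-lab x) ≡ [ (λ x → mapO (inl Γ) (decO as x)) , (λ x → mapO (inr as) (rest-lab x)) ]′ x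
    joined (inj₁ _) = refl
    joined (inj₂ _) = refl

  -- N is the meaning of the body u with its bound variables packed into one tensor.
  -- It is pinned down by u ⊩ opened as N, i.e. through composition with re, so that
  -- no naturality of re⁻¹ is ever needed.
  mutual
    infix 4 _⊩_ _⊩s_
    _⊩_ : ∀ {Γ a} → Tm Γ a → Sm Γ (φ a) → Set (ℓ ⊔ o ⊔ h)
    var x ⊩ m = m ≈ v x
    _⊩_ {Γ} (tup {as = as} ts) m = Σ (Env as Γ) λ e → (ts ⊩s e) × m ≈ gen (reO as) ⟪ e ⟫
    _⊩_ {Γ} (lett {b = b} as t u) m = Σ (Sm Γ (φ (tensor as))) λ n → Σ (Sm (tensor as ∷ Γ) (φ b)) λ N →
      (t ⊩ n) × One N (at vz) × (u ⊩ opened as N) × m ≈ N ⟪ n ▸ v ⟫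
    _⊩_ {Γ} (app {as = as} f ts) m = Σ (Env as Γ) λ e → (ts ⊩s e) × m ≈ gen ⟨ arr f ⟩ ⟪ e ⟫

    _⊩s_ : ∀ {Γ as} → Tms Γ as → Env as Γ → Set (ℓ ⊔ o ⊔ h)
    [] ⊩s e = ⊤
    (t ∷ ts) ⊩s e = (t ⊩ e vz) × (ts ⊩s λ x → e (vs x))

  ⊩-≈ : ∀ {Γ a} (s : Tm Γ a) {m n : Sm Γ (φ a)} → m ≈ n → s ⊩ m → s ⊩ n
  ⊩-≈ (var x) p q = ≈-trans (≈-sym p) q
  ⊩-≈ (tup ts) p (e , d , q) = (λ x → e x) , d , ≈-trans (≈-sym p) q
  ⊩-≈ (lett as t u) p (n , N , d , u₁ , d' , q) = n , N , d , u₁ , d' , ≈-trans (≈-sym p) q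
  ⊩-≈ (app f ts) p (e , d , q) = (λ x → e x) , d , ≈-trans (≈-sym p) q

  ⊩s-≈ : ∀ {Γ as} (ts : Tms Γ as) {e e' : Env as Γ} → (∀ {c} (x : Var as c) → e x ≈ e' x) → ts ⊩s e → ts ⊩s e'
  ⊩s-≈ [] p d = tt
  ⊩s-≈ (t ∷ ts) p (d , ds) = ⊩-≈ t (p vz) d , ⊩s-≈ ts (λ x → p (vs x)) ds

  -- Only the let needs an argument: the meaning of the body determines `N` by `opened-injective`.
  ⊩-functional : ∀ {Γ a} (s : Tm Γ a) {m n : Sm Γ (φ a)} → s ⊩ m → s ⊩ n → m ≈ n
  ⊩s-functional : ∀ {Γ as} (ts : Tms Γ as) {e e' : Env as Γ} → ts ⊩s e → ts ⊩s e' → ∀ {c} (x : Var as c) → e x ≈ e' x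
  ⊩-functional (var x) p q = ≈-trans p (≈-sym q)
  ⊩-functional (tup ts) (e , d , p) (e' , d' , p') =
    ≈-trans p (≈-trans (⟪⟫-congʳ _ (⊩s-functional ts d d')) (≈-sym p'))
  ⊩-functional (lett as t u) (n , N , d , w , b , p) (n' , N' , d' , w' , b' , p') =
    ≈-trans p (≈-trans (⟪⟫-cong (opened-injective as N N' w w' (⊩-functional u b b'))
      (λ { vz → ⊩-functional t d d' ; (vs x) → ≈-refl })) (≈-sym p'))
  ⊩-functional (app f ts) (e , d , p) (e' , d' , p') =
    ≈-trans p (≈-trans (⟪⟫-congʳ _ (⊩s-functional ts d d')) (≈-sym p'))
  ⊩s-functional (t ∷ ts) (d , ds) (d' , ds') vz = ⊩-functional t d d'
  ⊩s-functional (t ∷ ts) (d , ds) (d' , ds') (vs x) = ⊩s-functional ts ds ds' x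

  Fiber-v-absurd : ∀ {Γ c d} {x : Var Γ c} {y : Var Γ d} → _≢_ {A = ∃ (Var Γ)} (c , x) (d , y) → Fiber (v x) (at y) → ⊥
  Fiber-v-absurd ne p = ne (cong unAt (Inverse.to (Fiber-ret _) p))

  ∉-weakened : ∀ {a Γ Δ d} (m : Sm Γ d) (ρ : Ren Γ Δ) {y : Var Δ a} → (∀ {c} (x : Var Γ c) → _≢_ {A = ∃ (Var Δ)} (c , ρ x) (a , y)) →
    Fiber (m ⟪ vr ρ ⟫) (at y) → ⊥
  ∉-weakened m ρ ne p with Inverse.to (Fiber-bind m) p
  ... | _ , at x , _ , q = Fiber-v-absurd (ne x) q

  weakened-∌vz : ∀ {a Γ d} (m : Sm Γ d) → Fiber (m ⟪ vr (vs {y = a}) ⟫) (at vz) → ⊥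
  weakened-∌vz m = ∉-weakened m vs λ _ ()

  infix 9 ⇑_
  ⇑_ : ∀ {a Γ Δ} → Env Γ Δ → Env (a ∷ Γ) (a ∷ Δ)
  ⇑ k = v vz ▸ λ x → k x ⟪ vr vs ⟫

  One-⇑ : ∀ {a Γ Δ d} (N : Sm (a ∷ Γ) d) (k : Env Γ Δ) → One N (at vz) → One (N ⟪ ⇑ k ⟫) (at vz)
  One-⇑ {a} {Γ} N k u = One-bind only u (One-ret (at vz))
    where
    only : ∀ {c} (w : VarO (a ∷ Γ) c) → Fiber (on (⇑ k) w) (at vz) → _≡_ {A = ∃ (VarO (a ∷ Γ))} (c , w) (φ a , at vz)
    only (at vz) p = refl
    only (at (vs x)) p = ⊥-elim (weakened-∌vz (k x) p)

  -- Opening a tensor commutes with substitution for the other variables. `K` is specified by its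
  -- values up to `≈`, so that lifted renamings and lifted environments are both instances.
  opened-⇑ : ∀ {Γ Δ as b} (k : Env Γ Δ) (K : Env (as ++ Γ) (as ++ Δ)) →
    (∀ {c} (x : Var as c) → K (inl Γ x) ≈ v (inl Δ x)) → (∀ {c} (x : Var Γ c) → K (inr as x) ≈ k x ⟪ vr (inr as) ⟫) →
    (N : Sm (tensor as ∷ Γ) b) → opened as N ⟪ K ⟫ ≈ opened as (N ⟪ ⇑ k ⟫)
  opened-⇑ k K pl pr N = ⟪⟫-sq N λ
    { vz → ≈-trans (⟪⟫-tri _ λ x → ≈-trans (v-⟪⟫ _) (pl x)) (≈-sym (v-⟪⟫ vz))
    ; (vs x) → ≈-trans (v-⟪⟫ _) (≈-trans (pr x) (≈-sym (⟪⟫-tri (k x) λ y → v-⟪⟫ (vs y)))) }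

  lett-⟪⟫ : ∀ {Γ Δ as b} {t : Tm Δ (tensor as)} {u : Tm (as ++ Δ) b} (k : Env Γ Δ) (K : Env (as ++ Γ) (as ++ Δ)) →
    (∀ {c} (x : Var as c) → K (inl Γ x) ≈ v (inl Δ x)) → (∀ {c} (x : Var Γ c) → K (inr as x) ≈ k x ⟪ vr (inr as) ⟫) →
    (n : Sm Γ (φ (tensor as))) (N : Sm (tensor as ∷ Γ) (φ b)) → One N (at vz) →
    t ⊩ n ⟪ k ⟫ → u ⊩ opened as N ⟪ K ⟫ → lett as t u ⊩ N ⟪ n ▸ v ⟫ ⟪ k ⟫
  lett-⟪⟫ {as = as} {u = u} k K pl pr n N w d b =
    n ⟪ k ⟫ , N ⟪ ⇑ k ⟫ , d , One-⇑ N k w ,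
    ⊩-≈ u (opened-⇑ k K pl pr N) b ,
    ⟪⟫-sq N λ { vz → ≈-sym (v-⟪⟫ vz)
              ; (vs x) → ≈-trans (v-⟪⟫ x) (≈-sym (≈-trans (⟪⟫-assoc (k x)) (⟪v⟫ (k x) λ y → v-⟪⟫ (vs y)))) }

  liftR-inl : ∀ {Γ Δ} as (ρ : Ren Γ Δ) {c} (x : Var as c) → liftR as ρ (inl Γ x) ≡ inl Δ x
  liftR-inl (_ ∷ as) ρ vz = refl
  liftR-inl (_ ∷ as) ρ (vs x) = cong vs (liftR-inl as ρ x)

  liftR-inr : ∀ {Γ Δ} as (ρ : Ren Γ Δ) {c} (x : Var Γ c) → liftR as ρ (inr as x) ≡ inr as (ρ x)
  liftR-inr [] ρ x = refl
  liftR-inr (_ ∷ as) ρ x = cong vs (liftR-inr as ρ x)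

  ⊩-ren : ∀ {Γ Δ a} (ρ : Ren Γ Δ) (s : Tm Γ a) {m : Sm Γ (φ a)} → s ⊩ m → ren ρ s ⊩ m ⟪ vr ρ ⟫
  ⊩s-rens : ∀ {Γ Δ as} (ρ : Ren Γ Δ) (ts : Tms Γ as) {e : Env as Γ} → ts ⊩s e → rens ρ ts ⊩s λ x → e x ⟪ vr ρ ⟫
  ⊩-ren ρ (var x) p = ≈-trans (⟪⟫-congˡ p) (v-⟪⟫ x)
  ⊩-ren ρ (tup ts) (e , d , p) = (λ x → e x ⟪ vr ρ ⟫) , ⊩s-rens ρ ts d , ≈-trans (⟪⟫-congˡ p) (⟪⟫-assoc _)
  ⊩-ren ρ (lett as t u) (n , N , d , w , b , p) = ⊩-≈ (ren ρ (lett as t u)) (≈-sym (⟪⟫-congˡ p))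
    (lett-⟪⟫ (vr ρ) (vr (liftR as ρ)) (λ x → ≡⇒≈ (cong v (liftR-inl as ρ x)))
      (λ x → ≈-trans (≡⇒≈ (cong v (liftR-inr as ρ x))) (≈-sym (v-⟪⟫ (ρ x)))) n N w (⊩-ren ρ t d) (⊩-ren (liftR as ρ) u b))
  ⊩-ren ρ (app f ts) (e , d , p) = (λ x → e x ⟪ vr ρ ⟫) , ⊩s-rens ρ ts d , ≈-trans (⟪⟫-congˡ p) (⟪⟫-assoc _)
  ⊩s-rens ρ [] d = tt
  ⊩s-rens ρ (t ∷ ts) (d , ds) = ⊩-ren ρ t d , ⊩s-rens ρ ts ds

  liftE : ∀ {Γ Δ} as → Env Γ Δ → Env (as ++ Γ) (as ++ Δ)
  liftE [] k = k
  liftE (a ∷ as) k = ⇑ liftE as k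

  liftE-inl : ∀ {Γ Δ} as (k : Env Γ Δ) {c} (x : Var as c) → liftE as k (inl Γ x) ≈ v (inl Δ x)
  liftE-inl (_ ∷ as) k vz = ≈-refl
  liftE-inl (_ ∷ as) k (vs x) = ≈-trans (⟪⟫-congˡ (liftE-inl as k x)) (v-⟪⟫ _)

  liftE-inr : ∀ {Γ Δ} as (k : Env Γ Δ) {c} (x : Var Γ c) → liftE as k (inr as x) ≈ k x ⟪ vr (inr as) ⟫
  liftE-inr [] k x = ≈-sym (⟪v⟫ (k x) λ _ → ≈-refl)
  liftE-inr (_ ∷ as) k x = ≈-trans (⟪⟫-congˡ (liftE-inr as k x)) (⟪⟫-tri (k x) λ y → v-⟪⟫ _)

  ⊩-liftS : ∀ {Γ Δ} as {σ : Sub Γ Δ} {k : Env Γ Δ} → (∀ {c} (x : Var Γ c) → σ x ⊩ k x) →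
    ∀ {c} (x : Var (as ++ Γ) c) → liftS as σ x ⊩ liftE as k x
  ⊩-liftS [] d x = d x
  ⊩-liftS (_ ∷ as) d vz = ≈-refl
  ⊩-liftS (_ ∷ as) d (vs x) = ⊩-ren vs _ (⊩-liftS as d x)

  ⊩-sub : ∀ {Γ Δ a} {σ : Sub Γ Δ} {k : Env Γ Δ} → (∀ {c} (x : Var Γ c) → σ x ⊩ k x) →
    (s : Tm Γ a) {m : Sm Γ (φ a)} → s ⊩ m → sub σ s ⊩ m ⟪ k ⟫
  ⊩s-subs : ∀ {Γ Δ as} {σ : Sub Γ Δ} {k : Env Γ Δ} → (∀ {c} (x : Var Γ c) → σ x ⊩ k x) →
    (ts : Tms Γ as) {e : Env as Γ} → ts ⊩s e → subs σ ts ⊩s λ x → e x ⟪ k ⟫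
  ⊩-sub {σ = σ} q (var x) p = ⊩-≈ (σ x) (≈-sym (≈-trans (⟪⟫-congˡ p) (v-⟪⟫ x))) (q x)
  ⊩-sub {k = k} q (tup ts) (e , d , p) = (λ x → e x ⟪ k ⟫) , ⊩s-subs q ts d , ≈-trans (⟪⟫-congˡ p) (⟪⟫-assoc _)
  ⊩-sub {σ = σ} {k} q (lett as t u) (n , N , d , w , b , p) = ⊩-≈ (sub σ (lett as t u)) (≈-sym (⟪⟫-congˡ p))
    (lett-⟪⟫ k (liftE as k) (liftE-inl as k) (liftE-inr as k) n N w (⊩-sub q t d) (⊩-sub (⊩-liftS as q) u b))
  ⊩-sub {k = k} q (app f ts) (e , d , p) = (λ x → e x ⟪ k ⟫) , ⊩s-subs q ts d , ≈-trans (⟪⟫-congˡ p) (⟪⟫-assoc _)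
  ⊩s-subs q [] d = tt
  ⊩s-subs q (t ∷ ts) (d , ds) = ⊩-sub q t d , ⊩s-subs q ts ds

-- Occurrence counts as cardinalities of fibres.

module _ {a} {A : Set a} where

  vs-injective : ∀ {b Γ c d} {x : Var Γ c} {y : Var Γ d} →
    _≡_ {A = ∃ (Var (b ∷ Γ))} (c , vs x) (d , vs y) → _≡_ {A = ∃ (Var {A = A} Γ)} (c , x) (d , y)
  vs-injective refl = refl

  inl≢inr : ∀ (Γ : List A) {Δ c d} (x : Var Γ c) (y : Var Δ d) → _≢_ {A = ∃ (Var (Γ ++ Δ))} (c , inl Δ x) (d , inr Γ y)
  inl≢inr (_ ∷ Γ) vz y ()
  inl≢inr (_ ∷ Γ) {Δ} {c} {d} (vs x) y e = inl≢inr Γ x y (vs-injective e)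

  inr-injective : ∀ (Γ : List A) {Δ c d} {x : Var Δ c} {y : Var Δ d} →
    _≡_ {A = ∃ (Var (Γ ++ Δ))} (c , inr Γ x) (d , inr Γ y) → _≡_ {A = ∃ (Var Δ)} (c , x) (d , y)
  inr-injective [] e = e
  inr-injective (_ ∷ Γ) e = inr-injective Γ (vs-injective e)

  sameVar-refl : ∀ {Γ : List A} {c} (x : Var Γ c) → sameVar x x ≡ true
  sameVar-refl vz = refl
  sameVar-refl (vs x) = sameVar-refl x

  sameVar-sound : ∀ {Γ : List A} {c d} (x : Var Γ c) (y : Var Γ d) → sameVar x y ≡ true → _≡_ {A = ∃ (Var Γ)} (c , x) (d , y)
  sameVar-sound vz vz e = refl
  sameVar-sound (vs x) (vs y) e with refl ← sameVar-sound x y e = refl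

module Occurrences {ℓ o h} (R : RepSig ℓ) (S : SymRepMulticat o h) (i : SigMap R S) where
  open RepSig R
  open FreeRep R
  open SymRepMulticat S using (Ob; Hom; ⨂; re)
  open SigMap i renaming (obj to φ; obj-⊗ to φ-⊗)
  open Shaped S
  open Monad S
  open Fibers S
  open Contexts R S i

  Fiber-⟪⟫ : ∀ {Γ Δ d} (m : Sm Γ d) (k : Env Γ Δ) {e} {z : VarO Δ e} →
    Fiber (m ⟪ k ⟫) z ↔ (∃ λ c → Σ (Var Γ c) λ y → Fiber m (at y) × Fiber (k y) z)
  Fiber-⟪⟫ {Γ} m k {z = z} = ↔-trans (Fiber-bind m) (mk↔ₛ′ fwd (λ (c , y , p , q) → φ c , at y , p , q) (λ _ → refl) bwd-fwd)
    where
    fwd : (∃ λ d → Σ (VarO Γ d) λ w → Fiber m w × Fiber (on k w) z) → (∃ λ c → Σ (Var Γ c) λ y → Fiber m (at y) × Fiber (k y) z)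
    fwd (_ , at {c} y , p , q) = c , y , p , q
    bwd-fwd : ∀ t → (let (c , y , p , q) = fwd t in φ c , at y , p , q) ≡ t
    bwd-fwd (_ , at y , p , q) = refl

  fiber-v : ∀ {Γ c d} {x : Var Γ c} {y : Var Γ d} → Fiber (v x) (at y) → _≡_ {A = ∃ (Var Γ)} (c , x) (d , y)
  fiber-v p = cong unAt (Inverse.to (Fiber-ret _) p)

  fiber-v-unique : ∀ {Γ c} {x : Var Γ c} (p q : Fiber (v x) (at x)) → p ≡ q
  fiber-v-unique p q = fiber-≡ (uip (pos p) (pos q))

  one-fiber : ∀ {Γ b} {m : Sm Γ b} {d} {x : VarO Γ d} → One m x → (p q : Fiber m x) → p ≡ q
  one-fiber (one _ u) p q = fiber-≡ (trans (u _ (pos-lab p)) (sym (u _ (pos-lab q))))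

  Fiber-gen⟪⟫ : ∀ {as Δ d} (f : HX (lst (map φ as)) d) (e : Env as Δ) {b} {z : VarO Δ b} →
    Fiber (gen {as} f ⟪ e ⟫) z ↔ (∃ λ c → Σ (Var as c) λ y → Fiber (e y) z)
  Fiber-gen⟪⟫ {as} f e = ↔-trans (Fiber-⟪⟫ (gen f) e) (mk↔ₛ′ (λ { (c , y , _ , q) → c , y , q })
    (λ { (c , y , q) → c , y , centre (One-gen {as} f (at y)) , q }) (λ _ → refl)
    (λ { (c , y , p , q) → cong (λ p → c , y , p , q) (one-fiber (One-gen f (at y)) _ p) }))

  -- `N` uses its head once, so the occurrences inside `n` enter with multiplicity one; the
  -- injectivity of `ρ` at `x` excludes contributions of other variables.
  Fiber-▸ : ∀ {a Γ Δ d} (N : Sm (a ∷ Γ) d) (n : Sm Δ (φ a)) (ρ : Ren Γ Δ) {e} {x : Var Γ e} →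
    (∀ {c} {y : Var Γ c} → _≡_ {A = ∃ (Var Δ)} (c , ρ y) (e , ρ x) → _≡_ {A = ∃ (Var Γ)} (c , y) (e , x)) →
    One N (at vz) → Fiber (N ⟪ n ▸ vr ρ ⟫) (at (ρ x)) ↔ (Fiber n (at (ρ x)) ⊎ Fiber N (at (vs x)))
  Fiber-▸ {a} {Γ} {Δ} N n ρ {e} {x} inj u = ↔-trans (Fiber-⟪⟫ N (n ▸ vr ρ)) (mk↔ₛ′ fwd bwd
      (λ { (inj₁ _) → refl ; (inj₂ p) → fwd-vs p _ }) bwd-fwd)
    where
    E : Set _
    E = ∃ λ c → Σ (Var (a ∷ Γ) c) λ y → Fiber N (at y) × Fiber ((n ▸ vr ρ) y) (at (ρ x))
    fwd : E → Fiber n (at (ρ x)) ⊎ Fiber N (at (vs x))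
    fwd (_ , vz , p , q) = inj₁ q
    fwd (_ , vs y , p , q) with refl ← inj (fiber-v q) = inj₂ p
    bwd : Fiber n (at (ρ x)) ⊎ Fiber N (at (vs x)) → E
    bwd (inj₁ q) = _ , vz , centre u , q
    bwd (inj₂ p) = _ , vs x , p , fib refl refl
    fwd-vs : ∀ p q → fwd (_ , vs x , p , q) ≡ inj₂ p
    fwd-vs p q with inj {y = x} (fiber-v q)
    ... | refl = refl
    bwd-fwd : ∀ z → bwd (fwd z) ≡ z
    bwd-fwd (_ , vz , p , q) = cong (λ p → _ , vz , p , q) (one-fiber u _ p)
    bwd-fwd (_ , vs y , p , q) with refl ← inj (fiber-v q) = cong (λ q → _ , vs x , p , q) (fiber-v-unique _ q)

  Fiber-opened : ∀ {Γ d} as (N : Sm (tensor as ∷ Γ) d) {e} (x : Var Γ e) → One N (at vz) →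
    Fiber (opened as N) (at (inr as x)) ↔ Fiber N (at (vs x))
  Fiber-opened as N x u = ↔-trans (Fiber-▸ N (gen (reO as) ⟪ vr (inl _) ⟫) (inr as) (inr-injective as) u)
    (mk↔ₛ′ (λ { (inj₁ p) → ⊥-elim (∉-weakened (gen (reO as)) (inl _) (λ y → inl≢inr as y x) p) ; (inj₂ p) → p }) inj₂
      (λ _ → refl) (λ { (inj₁ p) → ⊥-elim (∉-weakened (gen (reO as)) (inl _) (λ y → inl≢inr as y x) p) ; (inj₂ p) → refl }))

  One-vr : ∀ {Γ Δ d} (m : Sm Γ d) (ρ : Ren Γ Δ) {c} (x : Var Γ c) →
    (∀ {d} {y : Var Γ d} → _≡_ {A = ∃ (Var Δ)} (d , ρ y) (c , ρ x) → _≡_ {A = ∃ (Var Γ)} (d , y) (c , x)) →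
    One m (at x) → One (m ⟪ vr ρ ⟫) (at (ρ x))
  One-vr m ρ x inj u = One-bind (λ { (at y) p → cong (λ z → _ , at (proj₂ z)) (inj (fiber-v p)) }) u (One-ret (at (ρ x)))

  inl-injective : ∀ {Γ : Ctx} Δ {c d} {x : Var Γ c} {y : Var Γ d} →
    _≡_ {A = ∃ (Var (Γ ++ Δ))} (c , inl Δ x) (d , inl Δ y) → _≡_ {A = ∃ (Var Γ)} (c , x) (d , y)
  inl-injective {Γ} Δ {x = x} {y} e with splitting-inl e
    where
    splitting-inl : _≡_ {A = ∃ (Var (Γ ++ Δ))} (_ , inl Δ x) (_ , inl Δ y) →
      _≡_ {A = ∃ λ c → Var Γ c ⊎ Var Δ c} (_ , split Γ (inl Δ x)) (_ , split Γ (inl Δ y))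
    splitting-inl e = cong (λ (c , z) → c , split Γ z) e
  ... | e' rewrite split-inl Γ {Δ} x | split-inl Γ {Δ} y with refl ← e' = refl

  One-opened-inl : ∀ {Γ d} as (N : Sm (tensor as ∷ Γ) d) → One N (at vz) → ∀ {c} (x : Var as c) → One (opened as N) (at (inl Γ x))
  One-opened-inl {Γ} as N u x = One-bind only u (One-vr (gen (reO as)) (inl Γ) x (inl-injective Γ) (One-gen (reO as) (at x)))
    where
    only : ∀ {c} (w : VarO (tensor as ∷ Γ) c) → Fiber (on (unpack as) w) (at (inl Γ x)) →
      _≡_ {A = ∃ (VarO (tensor as ∷ Γ))} (c , w) (φ (tensor as) , at vz)
    only (at vz) p = refl
    only (at (vs y)) p = ⊥-elim (inl≢inr as x y (sym (fiber-v p)))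

  -- Stated as a bijection so that the sums in `occ` correspond to disjoint unions of fibres. In the
  -- let case `Fiber-opened` removes the weakening under the binder, since `re` contributes bound
  -- variables only.
  ⊩-occ : ∀ {Γ a} (s : Tm Γ a) {m : Sm Γ (φ a)} → s ⊩ m → ∀ {c} (x : Var Γ c) → Fiber m (at x) ↔ Fin (occ s x)
  ⊩s-occ : ∀ {Γ as} (ts : Tms Γ as) {e : Env as Γ} → ts ⊩s e → ∀ {c} (x : Var Γ c) →
    (∃ λ d → Σ (Var as d) λ y → Fiber (e y) (at x)) ↔ Fin (occs ts x)
  ⊩-occ (var y) p x = ↔-trans (Fiber-≈ p) occurs
    where
    occurs : Fiber (v y) (at x) ↔ Fin (if sameVar y x then 1 else 0)
    occurs with sameVar y x in e
    ... | true with refl ← sameVar-sound y x e = One⇒Fin1 (One-ret (at y))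
    ... | false = mk↔ₛ′ (λ p → ⊥-elim (different p)) (λ ()) (λ ()) (λ p → ⊥-elim (different p))
      where
      different : Fiber (v y) (at x) → ⊥
      different p with refl ← fiber-v p with () ← trans (sym e) (sameVar-refl y)
  ⊩-occ (tup ts) (e , d , p) x = ↔-trans (Fiber-≈ p) (↔-trans (Fiber-gen⟪⟫ _ e) (⊩s-occ ts d x))
  ⊩-occ (lett as t u) (n , N , d , w , b , p) x = ↔-trans (Fiber-≈ p)
    (↔-trans (Fiber-▸ N n (λ y → y) (λ q → q) w)
    (↔-trans (⊩-occ t d x ⊎-↔ ↔-trans (↔-sym (Fiber-opened as N x w)) (⊩-occ u b (inr as x))) (↔-sym +↔⊎)))
  ⊩-occ (app f ts) (e , d , p) x = ↔-trans (Fiber-≈ p) (↔-trans (Fiber-gen⟪⟫ _ e) (⊩s-occ ts d x))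
  ⊩s-occ [] d x = mk↔ₛ′ (λ { (_ , () , _) }) (λ ()) (λ ()) (λ { (_ , () , _) })
  ⊩s-occ (t ∷ ts) {e} (d , ds) x = ↔-trans (mk↔ₛ′
      (λ { (_ , vz , p) → inj₁ p ; (_ , vs y , p) → inj₂ (_ , y , p) })
      (λ { (inj₁ p) → _ , vz , p ; (inj₂ (_ , y , p)) → _ , vs y , p })
      (λ { (inj₁ _) → refl ; (inj₂ _) → refl }) (λ { (_ , vz , _) → refl ; (_ , vs _ , _) → refl }))
    (↔-trans (⊩-occ t d x ⊎-↔ ⊩s-occ ts ds x) (↔-sym +↔⊎))

  occ⇒One : ∀ {Γ a} (s : Tm Γ a) {m : Sm Γ (φ a)} → s ⊩ m → ∀ {c} {x : Var Γ c} → occ s x ≡ 1 → One m (at x)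
  occ⇒One s {m} d {x = x} e = Fin1⇒One (subst (λ n → Fiber m (at x) ↔ Fin n) e (⊩-occ s d x))

  One⇒occ : ∀ {Γ a} (s : Tm Γ a) {m : Sm Γ (φ a)} → s ⊩ m → ∀ {c} {x : Var Γ c} → One m (at x) → occ s x ≡ 1
  One⇒occ s d {x = x} u = ↔⇒≡ (↔-trans (↔-sym (⊩-occ s d x)) (One⇒Fin1 u))

  lett⇒⊩ : ∀ {Γ as b} (t : Tm Γ (tensor as)) (u : Tm (as ++ Γ) b) → Σ (Sm Γ (φ (tensor as))) (t ⊩_) →
    (body : Σ (Sm (as ++ Γ) (φ b)) (u ⊩_)) → (Σ (Sm (tensor as ∷ Γ) (φ b)) λ N → One N (at vz) × opened as N ≈ proj₁ body) →
    Σ (Sm Γ (φ b)) (lett as t u ⊩_)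
  lett⇒⊩ t u (n , d) (m , b) (N , w , p) = N ⟪ n ▸ v ⟫ , n , N , d , w , ⊩-≈ u (≈-sym p) b , ≈-refl

  -- The linearity condition at a let turns, through `⊩-occ`, into the hypothesis of
  -- `opened-surjective`, which supplies the packed body.
  boundLinear⇒⊩ : ∀ {Γ a} (s : Tm Γ a) → BoundLinear s → Σ (Sm Γ (φ a)) (s ⊩_)
  boundLinears⇒⊩s : ∀ {Γ as} (ts : Tms Γ as) → BoundLinears ts → Σ (Env as Γ) λ e → ts ⊩s e
  boundLinear⇒⊩ (var x) l = v x , ≈-refl
  boundLinear⇒⊩ (tup ts) l = gen (reO _) ⟪ proj₁ (boundLinears⇒⊩s ts l) ⟫ , proj₁ (boundLinears⇒⊩s ts l) , proj₂ (boundLinears⇒⊩s ts l) , ≈-refl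
  boundLinear⇒⊩ (lett as t u) (l , l' , ones) = lett⇒⊩ t u (boundLinear⇒⊩ t l) (boundLinear⇒⊩ u l')
    (opened-surjective as (proj₁ (boundLinear⇒⊩ u l')) (λ x → occ⇒One u (proj₂ (boundLinear⇒⊩ u l')) (ones x)))
  boundLinear⇒⊩ (app f ts) l = gen ⟨ arr f ⟩ ⟪ proj₁ (boundLinears⇒⊩s ts l) ⟫ , proj₁ (boundLinears⇒⊩s ts l) , proj₂ (boundLinears⇒⊩s ts l) , ≈-refl
  boundLinears⇒⊩s [] l = (λ ()) , tt
  boundLinears⇒⊩s (t ∷ ts) (l , ls) =
    (proj₁ (boundLinear⇒⊩ t l) ▸ proj₁ (boundLinears⇒⊩s ts ls)) , proj₂ (boundLinear⇒⊩ t l) , proj₂ (boundLinears⇒⊩s ts ls)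

  -- With this converse, linearity of composed, permuted and packed terms is proved by exhibiting a
  -- meaning, and no occurrences are counted in substituted terms.
  ⊩⇒boundLinear : ∀ {Γ a} (s : Tm Γ a) {m : Sm Γ (φ a)} → s ⊩ m → BoundLinear s
  ⊩s⇒boundLinears : ∀ {Γ as} (ts : Tms Γ as) {e : Env as Γ} → ts ⊩s e → BoundLinears ts
  ⊩⇒boundLinear (var x) p = tt
  ⊩⇒boundLinear (tup ts) (e , d , p) = ⊩s⇒boundLinears ts d
  ⊩⇒boundLinear (lett as t u) (n , N , d , w , b , p) =
    ⊩⇒boundLinear t d , ⊩⇒boundLinear u b , λ x → One⇒occ u b (One-opened-inl as N w x)
  ⊩⇒boundLinear (app f ts) (e , d , p) = ⊩s⇒boundLinears ts d
  ⊩s⇒boundLinears [] d = tt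
  ⊩s⇒boundLinears (t ∷ ts) (d , ds) = ⊩⇒boundLinear t d , ⊩s⇒boundLinears ts ds

  opaque
    linear⇒⊩ : ∀ {Γ a} (s : Tm Γ a) → Linear s → Σ (HX (lst (map φ Γ)) (φ a)) λ f → s ⊩ gen f
    linear⇒⊩ s (l , ones) = proj₁ g , ⊩-≈ s (proj₂ g) (proj₂ (boundLinear⇒⊩ s l))
      where
      g : Σ (HX (lst (map φ _)) _) λ f → proj₁ (boundLinear⇒⊩ s l) ≈ gen f
      g = linear⇒gen (proj₁ (boundLinear⇒⊩ s l)) (λ x → occ⇒One s (proj₂ (boundLinear⇒⊩ s l)) (ones x))

  ⊩⇒linear : ∀ {Γ a} (s : Tm Γ a) {m : Sm Γ (φ a)} → s ⊩ m → (∀ {c} (x : Var Γ c) → One m (at x)) → Linear s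
  ⊩⇒linear s d ones = ⊩⇒boundLinear s d , λ x → One⇒occ s d (ones x)

-- Soundness of β and of the commutations, on the level of meanings.

module Soundness {ℓ o h} (R : RepSig ℓ) (S : SymRepMulticat o h) (i : SigMap R S) where
  open RepSig R
  open FreeRep R
  open SymRepMulticat S using (Ob; Hom; ⨂; re)
  open SigMap i renaming (obj to φ; obj-⊗ to φ-⊗)
  open Shaped S
  open Monad S
  open Fibers S
  open Contexts R S i
  open Occurrences R S i

  One-▸ : ∀ {a b Γ Δ d} {N : Sm (a ∷ Γ) d} {n : Sm (b ∷ Δ) (φ a)} (ρ : Ren Γ Δ) →
    One N (at vz) → One n (at vz) → One (N ⟪ n ▸ vr (λ x → vs (ρ x)) ⟫) (at vz)
  One-▸ {a} {Γ = Γ} {n = n} ρ w w' = One-bind only w w'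
    where
    only : ∀ {c} (z : VarO (a ∷ Γ) c) → Fiber (on (n ▸ vr (λ x → vs (ρ x))) z) (at vz) →
      _≡_ {A = ∃ (VarO (a ∷ Γ))} (c , z) (φ a , at vz)
    only (at vz) p = refl
    only (at (vs x)) p with () ← fiber-v p

  βenv : ∀ {as Γ Δ} → Env as Δ → Ren Γ Δ → Env (as ++ Γ) Δ
  βenv {[]} e ρ x = v (ρ x)
  βenv {_ ∷ as} e ρ vz = e vz
  βenv {_ ∷ as} e ρ (vs x) = βenv {as} (λ y → e (vs y)) ρ x

  βenv-inl : ∀ {as Γ Δ} (e : Env as Δ) (ρ : Ren Γ Δ) {c} (x : Var as c) → βenv e ρ (inl Γ x) ≈ e x
  βenv-inl e ρ vz = ≈-refl
  βenv-inl e ρ (vs x) = βenv-inl (λ y → e (vs y)) ρ x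

  βenv-inr : ∀ {as Γ Δ} (e : Env as Δ) (ρ : Ren Γ Δ) {c} (x : Var Γ c) → βenv e ρ (inr as x) ≈ v (ρ x)
  βenv-inr {[]} e ρ x = ≈-refl
  βenv-inr {_ ∷ as} e ρ x = βenv-inr {as} (λ y → e (vs y)) ρ x

  ⊩-βsub : ∀ {as Γ Δ} (ts : Tms Δ as) {e : Env as Δ} (ρ : Ren Γ Δ) → ts ⊩s e →
    ∀ {c} (x : Var (as ++ Γ) c) → βsub ts ρ x ⊩ βenv {as} e ρ x
  ⊩-βsub [] ρ d x = ≈-refl
  ⊩-βsub (t ∷ ts) ρ (d , ds) vz = d
  ⊩-βsub (t ∷ ts) ρ (d , ds) (vs x) = ⊩-βsub ts ρ ds x

  -- `ρ` accumulates the weakenings met under the bindings of `L`, which makes the induction go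
  -- through. At the hole `n` is `re` filled with the tuple, so associativity turns `N` filled with
  -- `n` into the opened body filled with the components.
  ⊩-plugL : ∀ {Γ₀ Γ Γ' as b} (L : LCtx Γ Γ') (ts : Tms Γ' as) (ρ : Ren Γ₀ Γ) (s : Tm (as ++ Γ₀) b)
    {n : Sm Γ (φ (tensor as))} (N : Sm (tensor as ∷ Γ₀) (φ b)) → One N (at vz) →
    plugL L (tup ts) ⊩ n → s ⊩ opened as N → plugL L (sub (βsub ts (λ x → wkL L (ρ x))) s) ⊩ N ⟪ n ▸ vr ρ ⟫
  ⊩-plugL {as = as} hole ts ρ s N w (e , d , p) b = ⊩-≈ (sub (βsub ts ρ) s)
    (⟪⟫-tri N λ { vz → ≈-trans (⟪⟫-tri _ λ x → ≈-trans (v-⟪⟫ _) (βenv-inl e ρ x)) (≈-sym p)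
                ; (vs x) → ≈-trans (v-⟪⟫ _) (βenv-inr e ρ x) })
    (⊩-sub (⊩-βsub ts {e} ρ d) s b)
  ⊩-plugL {as = as} (lctx bs u L) ts ρ s N w (nᵤ , N₂ , d , w₂ , b₂ , p) b =
    -- The new packed body is `N` with `N₂` in place of its head; the head of `N₂`, the tensor
    -- opened by the outer binding of `L`, becomes the head of the whole.
    nᵤ , N ⟪ N₂ ▸ vr (λ x → vs (ρ x)) ⟫ , d , One-▸ ρ w w₂ ,
    ⊩-≈ (plugL L (sub (βsub ts (λ x → wkL L (inr bs (ρ x)))) s))
      (≈-sym (⟪⟫-tri N λ { vz → ≈-refl ; (vs x) → v-⟪⟫ _ }))
      (⊩-plugL L ts (λ x → inr bs (ρ x)) s N w b₂ b) ,
    ≈-sym (⟪⟫-tri N λ { vz → ≈-sym p ; (vs x) → v-⟪⟫ _ })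

  ⊩s-++⁻ : ∀ {Γ as bs} (ts : Tms Γ as) {us : Tms Γ bs} {e : Env (as ++ bs) Γ} → (ts ++ₜ us) ⊩s e →
    (ts ⊩s λ x → e (inl bs x)) × (us ⊩s λ x → e (inr as x))
  ⊩s-++⁻ [] d = tt , d
  ⊩s-++⁻ (t ∷ ts) (d , ds) = (d , proj₁ (⊩s-++⁻ ts ds)) , proj₂ (⊩s-++⁻ ts ds)

  ⊩s-++⁺ : ∀ {Γ as bs} (ts : Tms Γ as) {us : Tms Γ bs} {e : Env (as ++ bs) Γ} →
    (ts ⊩s λ x → e (inl bs x)) → (us ⊩s λ x → e (inr as x)) → (ts ++ₜ us) ⊩s e
  ⊩s-++⁺ [] d d' = d'
  ⊩s-++⁺ (t ∷ ts) (d , ds) d' = d , ⊩s-++⁺ ts ds d'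

  -- The arguments of a tuple or generator just before the tensor of an inner let is filled: the
  -- entry of the let is its packed body `N`, the others are weakened. Filling the tensor gives back
  -- `e`, as `hole-env-fill` shows.
  hole-env : ∀ {bs₁ bs₂ a c Γ} → Env (bs₁ ++ c ∷ bs₂) Γ → Sm (a ∷ Γ) (φ c) → Env (bs₁ ++ c ∷ bs₂) (a ∷ Γ)
  hole-env {[]} e N vz = N
  hole-env {[]} e N (vs x) = e (vs x) ⟪ vr vs ⟫
  hole-env {_ ∷ bs₁} e N vz = e vz ⟪ vr vs ⟫
  hole-env {_ ∷ bs₁} e N (vs x) = hole-env {bs₁} (λ y → e (vs y)) N x

  -- Weakened entries cannot contain the new head variable. Hence the tensor is used by the hole
  -- alone, and the commuted body is linear in it.
  hole-env-aside : ∀ bs₁ {bs₂ a c Γ} (e : Env (bs₁ ++ c ∷ bs₂) Γ) (N : Sm (a ∷ Γ) (φ c)) {d} (x : Var (bs₁ ++ c ∷ bs₂) d) →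
    (Fiber (hole-env {bs₁} {bs₂} e N x) (at vz) → _≡_ {A = ∃ (Var (bs₁ ++ c ∷ bs₂))} (d , x) (c , inr bs₁ vz))
  hole-env-aside [] e N vz p = refl
  hole-env-aside [] e N (vs x) p = ⊥-elim (weakened-∌vz (e (vs x)) p)
  hole-env-aside (_ ∷ bs₁) e N vz p = ⊥-elim (weakened-∌vz (e vz) p)
  hole-env-aside (_ ∷ bs₁) e N (vs x) p with refl ← hole-env-aside bs₁ (λ y → e (vs y)) N x p = refl

  hole-env-inl : ∀ bs₁ {bs₂ a c Γ} (e : Env (bs₁ ++ c ∷ bs₂) Γ) (N : Sm (a ∷ Γ) (φ c)) {d} (x : Var bs₁ d) →
    hole-env {bs₁} {bs₂} e N (inl (c ∷ bs₂) x) ≡ e (inl (c ∷ bs₂) x) ⟪ vr vs ⟫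
  hole-env-inl (_ ∷ bs₁) e N vz = refl
  hole-env-inl (_ ∷ bs₁) e N (vs x) = hole-env-inl bs₁ (λ y → e (vs y)) N x

  hole-env-mid : ∀ bs₁ {bs₂ a c Γ} (e : Env (bs₁ ++ c ∷ bs₂) Γ) (N : Sm (a ∷ Γ) (φ c)) →
    hole-env {bs₁} {bs₂} e N (inr bs₁ vz) ≡ N
  hole-env-mid [] e N = refl
  hole-env-mid (_ ∷ bs₁) e N = hole-env-mid bs₁ (λ y → e (vs y)) N

  hole-env-inr : ∀ bs₁ {bs₂ a c Γ} (e : Env (bs₁ ++ c ∷ bs₂) Γ) (N : Sm (a ∷ Γ) (φ c)) {d} (x : Var bs₂ d) →
    hole-env {bs₁} {bs₂} e N (inr bs₁ (vs x)) ≡ e (inr bs₁ (vs x)) ⟪ vr vs ⟫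
  hole-env-inr [] e N x = refl
  hole-env-inr (_ ∷ bs₁) e N x = hole-env-inr bs₁ (λ y → e (vs y)) N x

  hole-env-fill : ∀ bs₁ {bs₂ a c Γ} (e : Env (bs₁ ++ c ∷ bs₂) Γ) (N : Sm (a ∷ Γ) (φ c)) (n : Sm Γ (φ a)) →
    e (inr bs₁ vz) ≈ N ⟪ n ▸ v ⟫ → ∀ {d} (x : Var (bs₁ ++ c ∷ bs₂) d) → e x ≈ hole-env {bs₁} {bs₂} e N x ⟪ n ▸ v ⟫
  hole-env-fill [] e N n p vz = p
  hole-env-fill [] e N n p (vs x) = ≈-sym (≈-trans (⟪⟫-assoc _) (⟪v⟫ _ λ y → v-⟪⟫ (vs y)))
  hole-env-fill (_ ∷ bs₁) e N n p vz = ≈-sym (≈-trans (⟪⟫-assoc _) (⟪v⟫ _ λ y → v-⟪⟫ (vs y)))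
  hole-env-fill (_ ∷ bs₁) e N n p (vs x) = hole-env-fill bs₁ (λ y → e (vs y)) N n p x

  -- Tuples and generators both mean `gen f` filled with their arguments, so one construction serves
  -- `c-tup` and `c-app`. The fields are what a meaning of the commuted let requires.
  record Commuted {Γ as bs₁ c bs₂ d} (ss₁ : Tms Γ bs₁) (t : Tm Γ (tensor as)) (s : Tm (as ++ Γ) c) (ss₂ : Tms Γ bs₂)
      (f : HX (lst (map φ (bs₁ ++ c ∷ bs₂))) (φ d)) (e : Env (bs₁ ++ c ∷ bs₂) Γ) : Set (ℓ ⊔ o ⊔ h) where
    field
      def  : Sm Γ (φ (tensor as))
      body : Sm (tensor as ∷ Γ) (φ d)
      args : Env (bs₁ ++ c ∷ bs₂) (as ++ Γ)
      ⊩-def   : t ⊩ def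
      One-body : One body (at vz)
      ⊩s-args : (rens (inr as) ss₁ ++ₜ (s ∷ rens (inr as) ss₂)) ⊩s args
      body-eq : opened as body ≈ gen f ⟪ args ⟫
      all-eq  : gen f ⟪ e ⟫ ≈ body ⟪ def ▸ v ⟫

  commuted : ∀ {Γ as bs₁ c bs₂ d} (ss₁ : Tms Γ bs₁) (t : Tm Γ (tensor as)) (s : Tm (as ++ Γ) c) (ss₂ : Tms Γ bs₂)
    (f : HX (lst (map φ (bs₁ ++ c ∷ bs₂))) (φ d)) (e : Env (bs₁ ++ c ∷ bs₂) Γ) →
    (ss₁ ++ₜ (lett as t s ∷ ss₂)) ⊩s e → Commuted ss₁ t s ss₂ f e
  commuted {Γ} {as} {bs₁} {c} {bs₂} ss₁ t s ss₂ f e d = go (⊩s-++⁻ ss₁ {e = e} d)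
    where
    go : (ss₁ ⊩s λ x → e (inl (c ∷ bs₂) x)) × ((lett as t s ∷ ss₂) ⊩s λ x → e (inr bs₁ x)) → Commuted ss₁ t s ss₂ f e
    go (d₁ , (n , N , dt , w , ds , p) , d₂) = record
      { def = n
      ; body = gen f ⟪ e' ⟫
      ; args = λ x → e' x ⟪ unpack as ⟫
      ; ⊩-def = dt
      ; One-body = One-bind (λ { (at x) q → cong (λ (_ , z) → _ , at z) (hole-env-aside bs₁ e N x q) })
          (One-gen f (at (inr bs₁ vz))) (subst (λ z → One z (at vz)) (sym (hole-env-mid bs₁ e N)) w)
      ; ⊩s-args = ⊩s-++⁺ (rens (inr as) ss₁)
          (⊩s-≈ _ (λ x → aside (e (inl (c ∷ bs₂) x)) (hole-env-inl bs₁ e N x)) (⊩s-rens (inr as) ss₁ d₁))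
          (subst (λ z → s ⊩ z ⟪ unpack as ⟫) (sym (hole-env-mid bs₁ e N)) ds ,
           ⊩s-≈ _ (λ x → aside (e (inr bs₁ (vs x))) (hole-env-inr bs₁ e N x)) (⊩s-rens (inr as) ss₂ d₂))
      ; body-eq = ⟪⟫-assoc _
      ; all-eq = ≈-sym (⟪⟫-tri _ λ x → ≈-sym (hole-env-fill bs₁ e N n p x)) }
      where
      e' : Env (bs₁ ++ c ∷ bs₂) (tensor as ∷ Γ)
      e' = hole-env {bs₁} {bs₂} e N
      aside : ∀ {d} {m' : Sm (tensor as ∷ Γ) d} (m : Sm Γ d) → m' ≡ m ⟪ vr vs ⟫ → m ⟪ vr (inr as) ⟫ ≈ m' ⟪ unpack as ⟫
      aside m refl = ≈-sym (⟪⟫-tri m λ y → v-⟪⟫ (vs y))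

  ⊩s-vars : ∀ {Γ} as (ρ : Ren as Γ) → vars as ρ ⊩s vr ρ
  ⊩s-vars [] ρ = tt
  ⊩s-vars (a ∷ as) ρ = ≈-refl , ⊩s-vars as (λ x → ρ (vs x))

  -- Both sides are instances of a single M, obtained from N₂ by packing the variables
  -- bound by the outer binding as well.
  c-body-sound : ∀ {Γ as bs d} {nᵤ : Sm Γ (φ (tensor bs))} {nₜ : Sm Γ (φ (tensor as))}
    {N₁ : Sm (tensor bs ∷ Γ) d} {N₂ : Sm (tensor as ∷ bs ++ Γ) d}
    {N₁' : Sm (tensor as ∷ Γ) d} {N₂' : Sm (tensor bs ∷ as ++ Γ) d} →
    One N₁ (at vz) → One N₂ (at vz) → One N₁' (at vz) → One N₂' (at vz) →
    opened bs N₁ ≈ N₂ ⟪ nₜ ⟪ vr (inr bs) ⟫ ▸ v ⟫ →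
    opened as N₁' ≈ N₂' ⟪ nᵤ ⟪ vr (inr as) ⟫ ▸ v ⟫ →
    opened as N₂ ⟪ vr (swapR as bs) ⟫ ≈ opened bs N₂' →
    N₁ ⟪ nᵤ ▸ v ⟫ ≈ N₁' ⟪ nₜ ▸ v ⟫
  c-body-sound {Γ} {as} {bs} {d} {nᵤ} {nₜ} {N₁} {N₂} {N₁'} {N₂'} w₁ w₂ w₁' w₂' p p' q = go (opened-surjective bs K K-ones)
    where
    σ : Env (bs ++ Γ) (bs ++ tensor as ∷ Γ)
    σ x = [ (λ y → v (inl (tensor as ∷ Γ) y)) , (λ y → v (inr bs (vs y))) ]′ (split bs x)
    σ-inl : ∀ {c} (x : Var bs c) → σ (inl Γ x) ≡ v (inl (tensor as ∷ Γ) x)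
    σ-inl x rewrite split-inl bs {Γ} x = refl
    σ-inr : ∀ {c} (x : Var Γ c) → σ (inr bs x) ≡ v (inr bs (vs x))
    σ-inr x rewrite split-inr bs x = refl
    -- `N₂` with its head tensor moved behind the block `bs`, which thereby stands in front and can
    -- be packed.
    K : Sm (bs ++ tensor as ∷ Γ) d
    K = N₂ ⟪ v (inr bs vz) ▸ σ ⟫
    -- By `p`, filling `N₂` gives `opened bs N₁`, where a variable of `bs` occurs once. The weakened
    -- `nₜ` contains no such variable, so the occurrence belongs to `N₂`.
    N₂-ones : ∀ {c} (x : Var bs c) → One N₂ (at (vs (inl Γ x)))
    N₂-ones x = Fin1⇒One (↔-trans (↔-sym (mk↔ₛ′ (λ { (inj₁ r) → ⊥-elim (absent r) ; (inj₂ r) → r }) inj₂ (λ _ → refl)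
        (λ { (inj₁ r) → ⊥-elim (absent r) ; (inj₂ r) → refl })))
      (↔-trans (↔-sym (Fiber-▸ N₂ (nₜ ⟪ vr (inr bs) ⟫) (λ y → y) (λ e → e) w₂))
      (↔-trans (↔-sym (Fiber-≈ p)) (One⇒Fin1 (One-opened-inl bs N₁ w₁ x)))))
      where
      absent : Fiber (nₜ ⟪ vr (inr bs) ⟫) (at (inl Γ x)) → ⊥
      absent = ∉-weakened nₜ (inr bs) λ y e → inl≢inr bs x y (sym e)
    σ-fiber : ∀ {c e} (y : Var (bs ++ Γ) c) (x : Var bs e) → Fiber (σ y) (at (inl (tensor as ∷ Γ) x)) →
      _≡_ {A = ∃ (Var (bs ++ Γ))} (c , y) (e , inl Γ x)
    σ-fiber y x r with appendView bs y
    ... | left y' rewrite σ-inl y' with refl ← inl-injective (tensor as ∷ Γ) (fiber-v r) = refl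
    ... | right y' rewrite σ-inr y' = ⊥-elim (inl≢inr bs x (vs y') (sym (fiber-v r)))
    σ-fiber' : ∀ {c} (y : Var (bs ++ Γ) c) → Fiber (σ y) (at (inr bs (vz {x = tensor as} {Γ}))) → ⊥
    σ-fiber' y r with appendView bs y
    ... | left y' rewrite σ-inl y' = inl≢inr bs y' vz (fiber-v r)
    ... | right y' rewrite σ-inr y' with () ← inr-injective bs (fiber-v r)
    K-ones : ∀ {c} (x : Var bs c) → One K (at (inl (tensor as ∷ Γ) x))
    K-ones x = One-bind
      (λ { (at vz) r → ⊥-elim (inl≢inr bs x vz (sym (fiber-v r)))
         ; (at (vs y)) r → cong (λ (_ , z) → _ , at (vs z)) (σ-fiber y x r) })
      (N₂-ones x) (subst (λ z → One z (at (inl (tensor as ∷ Γ) x))) (sym (σ-inl x)) (One-ret _))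
    K-tensor : One K (at (inr bs vz))
    K-tensor = One-bind (λ { (at vz) r → refl ; (at (vs y)) r → ⊥-elim (σ-fiber' y r) }) w₂ (One-ret _)
    go : (Σ (Sm (tensor bs ∷ tensor as ∷ Γ) d) λ M → One M (at vz) × opened bs M ≈ K) → N₁ ⟪ nᵤ ▸ v ⟫ ≈ N₁' ⟪ nₜ ▸ v ⟫
    go (M , w , k) = ≈-trans (⟪⟫-congˡ first) (≈-trans
        (⟪⟫-sq M λ { vz → ≈-trans (v-⟪⟫ vz) (≈-sym (back nᵤ))
                   ; (vs vz) → ≈-trans (back nₜ) (≈-sym (v-⟪⟫ vz))
                   ; (vs (vs x)) → ≈-trans (v-⟪⟫ (vs x)) (≈-sym (v-⟪⟫ (vs x))) })
        (≈-sym (⟪⟫-congˡ second)))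
      where
      back : ∀ {a c} {n : Sm Γ (φ a)} (m : Sm Γ c) → m ⟪ vr vs ⟫ ⟪ n ▸ v ⟫ ≈ m
      back m = ≈-trans (⟪⟫-assoc m) (⟪v⟫ m λ y → v-⟪⟫ (vs y))
      w' : One M (at (vs vz))
      w' = Fin1⇒One (↔-trans (↔-sym (Fiber-opened bs M vz w)) (One⇒Fin1 (One-≈ (≈-sym k) K-tensor)))
      -- The three other packed bodies as instances of `M`: for `N₁` its second tensor is filled by
      -- `nₜ`, for `N₁'` its first by `nᵤ`, and for `N₂'` its second is opened by `re`.
      M₁ : Sm (tensor bs ∷ Γ) d
      M₁ = M ⟪ v vz ▸ nₜ ⟪ vr vs ⟫ ▸ vr vs ⟫
      M₂ : Sm (tensor as ∷ Γ) d
      M₂ = M ⟪ nᵤ ⟪ vr vs ⟫ ▸ v vz ▸ vr vs ⟫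
      M₃ : Sm (tensor bs ∷ as ++ Γ) d
      M₃ = M ⟪ v vz ▸ gen (reO as) ⟪ vr (λ x → vs (inl Γ x)) ⟫ ▸ vr (λ x → vs (inr as x)) ⟫
      One-M₁ : One M₁ (at vz)
      One-M₁ = One-bind (λ { (at vz) r → refl ; (at (vs vz)) r → ⊥-elim (weakened-∌vz nₜ r)
                           ; (at (vs (vs x))) r → ⊥-elim (Fiber-v-absurd (λ ()) r) }) w (One-ret _)
      One-M₂ : One M₂ (at vz)
      One-M₂ = One-bind (λ { (at vz) r → ⊥-elim (weakened-∌vz nᵤ r) ; (at (vs vz)) r → refl
                           ; (at (vs (vs x))) r → ⊥-elim (Fiber-v-absurd (λ ()) r) }) w' (One-ret _)
      One-M₃ : One M₃ (at vz)
      One-M₃ = One-bind (λ { (at vz) r → refl ; (at (vs vz)) r → ⊥-elim (∉-weakened (gen (reO as)) (λ x → vs (inl Γ x)) (λ _ ()) r)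
                           ; (at (vs (vs x))) r → ⊥-elim (Fiber-v-absurd (λ ()) r) }) w (One-ret _)
      fill : ∀ {Δ} → Env bs Δ → Sm Δ (φ (tensor as)) → Env Γ Δ → Env (bs ++ tensor as ∷ Γ) Δ
      fill e n k x = [ e , n ▸ k ]′ (split bs x)
      fill-inl : ∀ {Δ} (e : Env bs Δ) (n : Sm Δ (φ (tensor as))) (k : Env Γ Δ) {c} (x : Var bs c) →
        fill e n k (inl (tensor as ∷ Γ) x) ≈ e x
      fill-inl e n k x rewrite split-inl bs {tensor as ∷ Γ} x = ≈-refl
      fill-inr : ∀ {Δ} (e : Env bs Δ) (n : Sm Δ (φ (tensor as))) (k : Env Γ Δ) {c} (x : Var (tensor as ∷ Γ) c) →
        fill e n k (inr bs x) ≈ (n ▸ k) x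
      fill-inr e n k x rewrite split-inr bs x = ≈-refl
      M-fill : ∀ {Δ} (ρ : Ren bs Δ) (n : Sm Δ (φ (tensor as))) (τ : Ren Γ Δ) →
        opened bs M ⟪ fill (vr ρ) n (vr τ) ⟫ ≈ M ⟪ gen (reO bs) ⟪ vr ρ ⟫ ▸ n ▸ vr τ ⟫
      M-fill ρ n τ = ⟪⟫-tri M λ
        { vz → ⟪⟫-tri _ λ x → ≈-trans (v-⟪⟫ _) (fill-inl (vr ρ) n (vr τ) x)
        ; (vs vz) → ≈-trans (v-⟪⟫ _) (fill-inr (vr ρ) n (vr τ) vz)
        ; (vs (vs x)) → ≈-trans (v-⟪⟫ _) (fill-inr (vr ρ) n (vr τ) (vs x)) }
      N₂-fill : ∀ {Δ} (ρ : Ren bs Δ) (n : Sm Δ (φ (tensor as))) (τ : Ren Γ Δ) (θ : Ren (bs ++ Γ) Δ) →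
        (∀ {c} (x : Var bs c) → θ (inl Γ x) ≡ ρ x) → (∀ {c} (x : Var Γ c) → θ (inr bs x) ≡ τ x) →
        N₂ ⟪ n ▸ vr θ ⟫ ≈ M ⟪ gen (reO bs) ⟪ vr ρ ⟫ ▸ n ▸ vr τ ⟫
      N₂-fill ρ n τ θ θl θr = ≈-trans (≈-sym (⟪⟫-tri N₂ λ
          { vz → ≈-trans (v-⟪⟫ _) (fill-inr (vr ρ) n (vr τ) vz) ; (vs x) → aside x }))
        (≈-trans (≈-sym (⟪⟫-congˡ k)) (M-fill ρ n τ))
        where
        aside : ∀ {c} (x : Var (bs ++ Γ) c) → σ x ⟪ fill (vr ρ) n (vr τ) ⟫ ≈ v (θ x)
        aside x with appendView bs x
        ... | left y = ≈-trans (⟪⟫-congˡ (≡⇒≈ (σ-inl y))) (≈-trans (v-⟪⟫ _)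
              (≈-trans (fill-inl (vr ρ) n (vr τ) y) (≡⇒≈ (cong v (sym (θl y))))))
        ... | right y = ≈-trans (⟪⟫-congˡ (≡⇒≈ (σ-inr y))) (≈-trans (v-⟪⟫ _)
              (≈-trans (fill-inr (vr ρ) n (vr τ) (vs y)) (≡⇒≈ (cong v (sym (θr y))))))
      first : N₁ ≈ M₁
      first = opened-injective bs N₁ M₁ w₁ One-M₁ (≈-trans p (≈-trans
        (N₂-fill (inl Γ) (nₜ ⟪ vr (inr bs) ⟫) (inr bs) (λ x → x) (λ _ → refl) (λ _ → refl))
        (≈-sym (⟪⟫-tri M λ { vz → v-⟪⟫ vz ; (vs vz) → ⟪⟫-tri nₜ (λ y → v-⟪⟫ (vs y)) ; (vs (vs x)) → v-⟪⟫ (vs x) }))))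
      third : N₂' ≈ M₃
      third = opened-injective bs N₂' M₃ w₂' One-M₃ (≈-trans (≈-sym q) (≈-trans
        (⟪⟫-tri N₂ λ { vz → ⟪⟫-tri _ (λ x → ≈-trans (v-⟪⟫ _) (≡⇒≈ (cong v (swap-inl x)))) ; (vs x) → v-⟪⟫ _ })
        (≈-trans (N₂-fill (inl (as ++ Γ)) (gen (reO as) ⟪ vr (λ x → inr bs (inl Γ x)) ⟫) (λ x → inr bs (inr as x))
            (λ x → swapR as bs (inr as x)) swap-inr-inl swap-inr-inr)
        (≈-sym (⟪⟫-tri M λ { vz → v-⟪⟫ vz ; (vs vz) → ⟪⟫-tri _ (λ y → v-⟪⟫ (vs _)) ; (vs (vs x)) → v-⟪⟫ (vs _) })))))
        where
        swap-inl : ∀ {c} (x : Var as c) → swapR {Γ} as bs (inl (bs ++ Γ) x) ≡ inr bs (inl Γ x)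
        swap-inl x rewrite split-inl as {bs ++ Γ} x = refl
        swap-inr-inl : ∀ {c} (x : Var bs c) → swapR {Γ} as bs (inr as (inl Γ x)) ≡ inl (as ++ Γ) x
        swap-inr-inl x rewrite split-inr as {bs ++ Γ} (inl Γ x) | split-inl bs {Γ} x = refl
        swap-inr-inr : ∀ {c} (x : Var Γ c) → swapR {Γ} as bs (inr as (inr bs x)) ≡ inr bs (inr as x)
        swap-inr-inr x rewrite split-inr as {bs ++ Γ} (inr bs x) | split-inr bs {Γ} x = refl
      second : N₁' ≈ M₂
      second = opened-injective as N₁' M₂ w₁' One-M₂ (≈-trans p' (≈-trans (⟪⟫-congˡ third) (⟪⟫-sq M λ
        { vz → ≈-trans (v-⟪⟫ vz) (≈-sym (⟪⟫-tri nᵤ λ y → v-⟪⟫ (vs y)))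
        ; (vs vz) → ≈-trans (⟪⟫-tri _ (λ y → v-⟪⟫ (vs _))) (≈-sym (v-⟪⟫ vz))
        ; (vs (vs x)) → ≈-trans (v-⟪⟫ (vs _)) (≈-sym (v-⟪⟫ (vs x))) })))

-- Existence: rewriting preserves meanings, and the functor laws.

module _ {a b} {A : Set a} {B : Set b} (f : A → B) where

  idx-mapVar : ∀ {Γ : List A} {c} (x : Var Γ c) → idx (mapVar f x) ≡ idx x
  idx-mapVar vz = refl
  idx-mapVar (vs x) = cong suc (idx-mapVar x)

module Functor {ℓ o h} (R : RepSig ℓ) (S : SymRepMulticat o h) (i : SigMap R S) where
  open RepSig R
  open FreeRep R
  open SymRepMulticat S using (Ob; Hom; ⨂; re; id; comp; _·_; ·-ext; ·-id)
  open SigMap i renaming (obj to φ; obj-⊗ to φ-⊗)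
  open Shaped S
  open Monad S
  open Fibers S
  open Contexts R S i
  open Occurrences R S i
  open Soundness R S i

  beta-sound : ∀ {Γ a} {s s' : Tm Γ a} {m : Sm Γ (φ a)} → Beta s s' → s ⊩ m → s' ⊩ m
  beta-sound (beta L ts s) (n , N , d , w , b , p) =
    ⊩-≈ (plugL L (sub (βsub ts (wkL L)) s)) (≈-sym p) (⊩-plugL L ts (λ x → x) s N w d b)

  -- Meanings of both sides are given, which avoids inverting a renaming: in `c-body` the meaning of
  -- `t` is taken from the right-hand side and that of `u` from the left-hand side, where each
  -- stands unweakened.
  comm-sound : ∀ {Γ a} {s s' : Tm Γ a} {m m' : Sm Γ (φ a)} → Comm s s' → s ⊩ m → s' ⊩ m' → m ≈ m'
  comm-sound (c-tup {as = as} ss₁ t s ss₂) (e , d , p) d' = ⊩-functional (lett as t (tup (rens (inr as) ss₁ ++ₜ (s ∷ rens (inr as) ss₂))))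
    (def , body , ⊩-def , One-body , ((λ x → args x) , ⊩s-args , body-eq) , ≈-trans p all-eq) d'
    where open Commuted (commuted ss₁ t s ss₂ (reO _) e d)
  comm-sound (c-app {as = as} f ss₁ t s ss₂) (e , d , p) d' = ⊩-functional (lett as t (app f (rens (inr as) ss₁ ++ₜ (s ∷ rens (inr as) ss₂))))
    (def , body , ⊩-def , One-body , ((λ x → args x) , ⊩s-args , body-eq) , ≈-trans p all-eq) d'
    where open Commuted (commuted ss₁ t s ss₂ ⟨ arr f ⟩ e d)
  comm-sound (c-def {as = as} {bs} t s u) (n₁ , N , (n , N' , d , w' , ds , p₁) , w , du , p) d' =
    ⊩-functional (lett as t (lett bs s (ren (liftR bs (inr as)) u)))
      -- The outer let now encloses the inner one, so its packed body is `N` with the packed body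
      -- `N'` of the definition in place of its head.
      (n , N ⟪ N' ▸ vr vs ⟫ , d , One-▸ (λ x → x) w w' ,
        (opened as N' , N ⟪ ⇑ vr (inr as) ⟫ , ds , One-⇑ N (vr (inr as)) w ,
         ⊩-≈ (ren (liftR bs (inr as)) u)
           (opened-⇑ (vr (inr as)) (vr (liftR bs (inr as)))
             (λ x → ≡⇒≈ (cong v (liftR-inl bs (inr as) x)))
             (λ x → ≈-trans (≡⇒≈ (cong v (liftR-inr bs (inr as) x))) (≈-sym (v-⟪⟫ (inr as x)))) N)
           (⊩-ren (liftR bs (inr as)) u du) ,
         ⟪⟫-sq N λ { vz → ≈-sym (v-⟪⟫ vz)
                   ; (vs x) → ≈-trans (v-⟪⟫ (vs x)) (≈-sym (≈-trans (⟪⟫-congˡ (v-⟪⟫ _)) (v-⟪⟫ _))) }) ,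
        ≈-trans p (≈-sym (⟪⟫-tri N λ { vz → ≈-sym p₁ ; (vs x) → v-⟪⟫ (vs x) })))
      d'
  comm-sound (c-body {as = as} {bs} u t s) (nᵤ , N₁ , du , w₁ , (n₁ , N₂ , d₁ , w₂ , ds , q) , p)
      (nₜ , N₁' , dt , w₁' , (n₁' , N₂' , d₁' , w₂' , ds' , q') , p') =
    ≈-trans p (≈-trans (c-body-sound w₁ w₂ w₁' w₂'
        (≈-trans q (⟪⟫-congʳ N₂ λ { vz → ⊩-functional (ren (inr bs) t) d₁ (⊩-ren (inr bs) t dt) ; (vs x) → ≈-refl }))
        (≈-trans q' (⟪⟫-congʳ N₂' λ { vz → ⊩-functional (ren (inr as) u) d₁' (⊩-ren (inr as) u du) ; (vs x) → ≈-refl }))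
        (⊩-functional (ren (swapR as bs) s) (⊩-ren (swapR as bs) s ds) ds'))
      (≈-sym p'))

  eta-sound : ∀ {Γ a} {s s' : Tm Γ a} {m : Sm Γ (φ a)} → Eta s s' → s ⊩ m → s' ⊩ m
  -- The packed body of an η-expansion is the bare tensor variable: once opened it is `re`, the
  -- meaning of the tuple of bound variables.
  eta-sound {m = m} (eta {Γ} {as} s _) d = m , v vz , d , One-ret (at vz) ,
      (vr (inl Γ) , ⊩s-vars as (inl Γ) , v-⟪⟫ vz) , ≈-sym (v-⟪⟫ vz)

  lett-sound : ∀ {Γ as b} {t t' : Tm Γ (tensor as)} {u u' : Tm (as ++ Γ) b} {m m' : Sm Γ (φ b)} →
    (∀ {n n'} → t ⊩ n → t' ⊩ n' → n ≈ n') → (∀ {n n'} → u ⊩ n → u' ⊩ n' → n ≈ n') →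
    lett as t u ⊩ m → lett as t' u' ⊩ m' → m ≈ m'
  lett-sound {as = as} f g (n , N , d , w , b , p) (n' , N' , d' , w' , b' , p') =
    ≈-trans p (≈-trans (⟪⟫-cong (opened-injective as N N' w w' (g b b')) λ { vz → f d d' ; (vs x) → ≈-refl }) (≈-sym p'))

  cstep-sound : ∀ {Γ a} {s s' : Tm Γ a} → CStep s s' → ∀ {m m' : Sm Γ (φ a)} → s ⊩ m → s' ⊩ m' → m ≈ m'
  csteps-sound : ∀ {Γ as} {ss ss' : Tms Γ as} → CSteps ss ss' → ∀ {e e' : Env as Γ} →
    ss ⊩s e → ss' ⊩s e' → ∀ {c} (x : Var as c) → e x ≈ e' x
  cstep-sound {s' = s'} (root (inj₁ r)) d d' = ⊩-functional s' (beta-sound r d) d'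
  cstep-sound (root (inj₂ r)) d d' = comm-sound r d d'
  cstep-sound (tupC r) (e , d , p) (e' , d' , p') =
    ≈-trans p (≈-trans (⟪⟫-congʳ _ (csteps-sound r {λ x → e x} {λ x → e' x} d d')) (≈-sym p'))
  cstep-sound (letD {u = u} r) d d' = lett-sound (cstep-sound r) (⊩-functional u) d d'
  cstep-sound (letB {t = t} r) d d' = lett-sound (⊩-functional t) (cstep-sound r) d d'
  cstep-sound (appC r) (e , d , p) (e' , d' , p') =
    ≈-trans p (≈-trans (⟪⟫-congʳ _ (csteps-sound r {λ x → e x} {λ x → e' x} d d')) (≈-sym p'))
  csteps-sound (hd r) (d , ds) (d' , ds') vz = cstep-sound r d d'
  csteps-sound (hd {ss = ss} r) (d , ds) (d' , ds') (vs x) = ⊩s-functional ss ds ds' x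
  csteps-sound (tl {s = s} r) (d , ds) (d' , ds') vz = ⊩-functional s d d'
  csteps-sound (tl r) (d , ds) (d' , ds') (vs x) = csteps-sound r ds ds' x

  estep-sound : ∀ {Γ a} {s s' : Tm Γ a} → EStep s s' → ∀ {m m' : Sm Γ (φ a)} → s ⊩ m → s' ⊩ m' → m ≈ m'
  estep′-sound : ∀ {Γ a} {s s' : Tm Γ a} → EStep′ s s' → ∀ {m m' : Sm Γ (φ a)} → s ⊩ m → s' ⊩ m' → m ≈ m'
  esteps-sound : ∀ {Γ as} {ss ss' : Tms Γ as} → ESteps ss ss' → ∀ {e e' : Env as Γ} →
    ss ⊩s e → ss' ⊩s e' → ∀ {c} (x : Var as c) → e x ≈ e' x
  estep-sound {s' = s'} (root r) d d' = ⊩-functional s' (eta-sound r d) d'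
  estep-sound (deep r) d d' = estep′-sound r d d'
  estep′-sound (tupE r) (e , d , p) (e' , d' , p') =
    ≈-trans p (≈-trans (⟪⟫-congʳ _ (esteps-sound r {λ x → e x} {λ x → e' x} d d')) (≈-sym p'))
  estep′-sound (letD {u = u} r) d d' = lett-sound (estep′-sound r) (⊩-functional u) d d'
  estep′-sound (letB {t = t} r) d d' = lett-sound (⊩-functional t) (estep-sound r) d d'
  estep′-sound (appE r) (e , d , p) (e' , d' , p') =
    ≈-trans p (≈-trans (⟪⟫-congʳ _ (esteps-sound r {λ x → e x} {λ x → e' x} d d')) (≈-sym p'))
  esteps-sound (hd r) (d , ds) (d' , ds') vz = estep-sound r d d'
  esteps-sound (hd {ss = ss} r) (d , ds) (d' , ds') (vs x) = ⊩s-functional ss ds ds' x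
  esteps-sound (tl {s = s} r) (d , ds) (d' , ds') vz = ⊩-functional s d d'
  esteps-sound (tl r) (d , ds) (d' , ds') (vs x) = esteps-sound r ds ds' x

  step-sound : ∀ {Γ a} {s s' : Tm Γ a} → Step s s' → ∀ {m m' : Sm Γ (φ a)} → s ⊩ m → s' ⊩ m' → m ≈ m'
  step-sound (inj₁ r) = cstep-sound r
  step-sound (inj₂ r) = estep-sound r

  interp : ∀ {Γ a} → Rep Γ a → HX (lst (map φ Γ)) (φ a)
  interp (s , l) = proj₁ (linear⇒⊩ s l)

  ⊩-interp : ∀ {Γ a} (s : Rep Γ a) → proj₁ s ⊩ gen (interp s)
  ⊩-interp (s , l) = proj₂ (linear⇒⊩ s l)

  F₁ : ∀ {Γ a} → Rep Γ a → Hom (map φ Γ) (φ a)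
  F₁ s = raw (interp s)

  F₁-≡ : ∀ {Γ a} (s : Tm Γ a) (l : Linear s) {f : HX (lst (map φ Γ)) (φ a)} → s ⊩ gen f → F₁ (s , l) ≡ raw f
  F₁-≡ s l d = cong raw (gen-injective (⊩-functional s (⊩-interp (s , l)) d))

  opaque
    unfolding act
    act-enumI : ∀ {X b} (f : HX X b) → act (symI (enumI X)) ⟨ raw f ⟩ ≡ f
    act-enumI {X} f = hx-ext (trans (·-ext (raw f) (listPerm (symI (enumI X))) idPerm (enc-dec X)) (·-id (raw f)))

  permI : ∀ {Γ Δ : List Ob} → Perm Γ Δ → Iso (lst Γ) (lst Δ)
  permI σ = record { to = Perm.to σ ; from = Perm.from σ ; from-to = Perm.from-to σ ; to-from = Perm.to-from σ }

  opaque
    unfolding act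
    raw-act-permI : ∀ {Γ Δ b} (σ : Perm Γ Δ) (f : HX (lst Γ) b) → raw (act (permI σ) f) ≡ raw f · σ
    raw-act-permI σ f = ·-ext (raw f) (listPerm (permI σ)) σ (λ _ → refl)

  gen-id : ∀ {a} → gen {a ∷ []} ⟨ id {φ a} ⟩ ≈ v vz
  gen-id = record { iso = symI (enumI (leaf _)) ; lab-eq = λ { vz → refl } ; hom-eq = act-enumI idX }

  gen-act : ∀ {Γ Δ d} (σ : Perm Γ Δ) (σ' : Perm (map φ Γ) (map φ Δ)) →
    (∀ {c} (x : Var Γ c) → Perm.to σ' (mapVar φ x) ≡ mapVar φ (Perm.to σ x)) →
    (f : HX (lst (map φ Γ)) d) → gen f ⟪ vr (Perm.to σ) ⟫ ≈ gen (act (permI σ') f)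
  gen-act {Γ} {Δ} σ σ' p f = ≈-trans (⟪⟫-relabel (gen f) (Perm.to σ) (λ _ → ≈-refl)) record
    { iso = permI σ'
    ; lab-eq = λ x → trans (cong (λ z → decO Δ (Perm.to σ' z)) (sym (encO-decO Γ x))) (labels (decO Γ x))
    ; hom-eq = refl }
    where
    labels : ∀ {c} (x : VarO Γ c) → decO Δ (Perm.to σ' (encO x)) ≡ mapO (Perm.to σ) x
    labels (at x) = trans (cong (decO Δ) (p x)) (decO-mapVar (Perm.to σ x))

  appendI : ∀ Γ Δ → Iso (lst (map φ (Γ ++ Δ))) (lst (map φ Γ) ⊕ lst (map φ Δ))
  appendI Γ Δ = record
    { to = λ x → map₂ encO (splitO Γ (decO (Γ ++ Δ) x))
    ; from = λ z → encO (joinO Γ (map₂ (decO Δ) z))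
    ; from-to = λ x → trans (cong (λ z → encO (joinO Γ z)) (undo (splitO Γ (decO (Γ ++ Δ) x))))
        (trans (cong encO (joinO-splitO Γ (decO (Γ ++ Δ) x))) (encO-decO (Γ ++ Δ) x))
    ; to-from = λ z → trans (cong (map₂ encO) (trans (cong (splitO Γ) (decO-encO (joinO Γ (map₂ (decO Δ) z)))) (splitO-joinO Γ (map₂ (decO Δ) z)))) (redo z) }
    where
    undo : ∀ {c} (z : Var (map φ Γ) c ⊎ VarO Δ c) → map₂ (decO Δ) (map₂ encO z) ≡ z
    undo (inj₁ x) = refl
    undo (inj₂ y) = cong inj₂ (decO-encO y)
    redo : ∀ {c} (z : Var (map φ Γ) c ⊎ Var (map φ Δ) c) → map₂ encO (map₂ (decO Δ) z) ≡ z
    redo (inj₁ x) = refl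
    redo (inj₂ y) = cong inj₂ (encO-decO Δ y)

  -- Since positions are preserved, `subst-act` can exchange the casts along `map-++` for actions of
  -- isomorphisms built from `appendI`.
  appendI-idx : ∀ Γ Δ {c} (x : Var (map φ (Γ ++ Δ)) c) →
    idx x ≡ idx (enc (lst (map φ Γ) ⊕ lst (map φ Δ)) (to (appendI Γ Δ) x))
  appendI-idx Γ Δ x = trans (cong idx (sym (encO-decO (Γ ++ Δ) x))) (indices (decO (Γ ++ Δ) x))
    where
    indices : ∀ {c} (z : VarO (Γ ++ Δ) c) →
      idx (encO z) ≡ idx (enc (lst (map φ Γ) ⊕ lst (map φ Δ)) (map₂ encO (splitO Γ z)))
    indices (at x) with appendView Γ x
    ... | left y rewrite split-inl Γ {Δ} y = trans (idx-mapVar φ (inl Δ y)) (trans (idx-inl Δ y)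
          (sym (trans (idx-inl (map φ Δ) (mapVar φ y)) (idx-mapVar φ y))))
    ... | right y rewrite split-inr Γ y = trans (idx-mapVar φ (inr Γ y)) (trans (idx-inr Γ y)
          (sym (trans (idx-inr (map φ Γ) (mapVar φ y)) (cong₂ _+_ (length-map φ Γ) (idx-mapVar φ y)))))

  appendI-lab : ∀ Γ Δ {c} (x : Var (map φ (Γ ++ Δ)) c) → joinO Γ (map₂ (decO Δ) (to (appendI Γ Δ) x)) ≡ decO (Γ ++ Δ) x
  appendI-lab Γ Δ x = trans (sym (decO-encO _)) (cong (decO (Γ ++ Δ)) (from-to (appendI Γ Δ) x))

  mapO-∘ : ∀ {Γ Δ Ε : Ctx} (ρ : Ren Γ Δ) (τ : Ren Δ Ε) {d} (x : VarO Γ d) → mapO τ (mapO ρ x) ≡ mapO (λ y → τ (ρ y)) x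
  mapO-∘ ρ τ (at x) = refl

  plugE : ∀ Γ {Δ Θ a} → Sm Θ (φ a) → Env (Γ ++ a ∷ Δ) (Γ ++ Θ ++ Δ)
  plugE [] {Δ} n vz = n ⟪ vr (inl Δ) ⟫
  plugE [] {Θ = Θ} n (vs y) = v (inr Θ y)
  plugE (c ∷ Γ) n vz = v vz
  plugE (c ∷ Γ) n (vs x) = plugE Γ n x ⟪ vr vs ⟫

  ⊩-plugSub : ∀ Γ {Δ Θ a} (t : Tm Θ a) {n : Sm Θ (φ a)} → t ⊩ n → ∀ {c} (x : Var (Γ ++ a ∷ Δ) c) → plugSub Γ t x ⊩ plugE Γ n x
  ⊩-plugSub [] {Δ} t d vz = ⊩-ren (inl Δ) t d
  ⊩-plugSub [] t d (vs y) = ≈-refl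
  ⊩-plugSub (c ∷ Γ) t d vz = ≈-refl
  ⊩-plugSub (c ∷ Γ) t d (vs x) = ⊩-ren vs (plugSub Γ t x) (⊩-plugSub Γ t d x)

  plugE-inl : ∀ Γ {Δ Θ a} (n : Sm Θ (φ a)) {c} (x : Var Γ c) → plugE Γ {Δ} n (inl (a ∷ Δ) x) ≈ v (inl (Θ ++ Δ) x)
  plugE-inl (_ ∷ Γ) n vz = ≈-refl
  plugE-inl (_ ∷ Γ) n (vs x) = ≈-trans (⟪⟫-congˡ (plugE-inl Γ n x)) (v-⟪⟫ _)

  plugE-mid : ∀ Γ {Δ Θ a} (n : Sm Θ (φ a)) → plugE Γ {Δ} n (inr Γ vz) ≈ n ⟪ vr (λ x → inr Γ (inl Δ x)) ⟫
  plugE-mid [] n = ≈-refl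
  plugE-mid (_ ∷ Γ) n = ≈-trans (⟪⟫-congˡ (plugE-mid Γ n)) (⟪⟫-tri n λ x → v-⟪⟫ _)

  plugE-inr : ∀ Γ {Δ Θ a} (n : Sm Θ (φ a)) {c} (y : Var Δ c) → plugE Γ {Δ} n (inr Γ (vs y)) ≈ v (inr Γ (inr Θ y))
  plugE-inr [] n y = ≈-refl
  plugE-inr (_ ∷ Γ) n y = ≈-trans (⟪⟫-congˡ (plugE-inr Γ n y)) (v-⟪⟫ _)

  opaque
    unfolding compAt
    raw-compAt : ∀ P D {a b Θ} (f : HX (P ⊕ (leaf a ⊕ D)) b) (g : HX Θ a) →
      raw (compAt P D f g) ≡ comp (enum P) (enum D) (raw f) (raw g)
    raw-compAt P D f g = refl

  module _ (Γ Δ : Ctx) {a : T} {Θ : Ctx} {d : Ob}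
    (f : HX (lst (map φ (Γ ++ a ∷ Δ))) d) (g : HX (lst (map φ Θ)) (φ a)) where

    private
      P = lst (map φ Γ)
      D = lst (map φ Δ)
      M = lst (map φ Θ)

      splitD : Iso (lst (map φ (Γ ++ a ∷ Δ))) (P ⊕ (leaf (φ a) ⊕ D))
      splitD = appendI Γ (a ∷ Δ) ⨟ (idI ⊕I consI)

      splitM : Iso (lst (map φ (Γ ++ Θ ++ Δ))) (P ⊕ (M ⊕ D))
      splitM = appendI Γ (Θ ++ Δ) ⨟ (idI ⊕I appendI Θ Δ)

      f₁ = act splitD f

      labD : ∀ {c} → El (leaf (φ a) ⊕ (P ⊕ D)) c → VarO (Γ ++ a ∷ Δ) c
      labD (inj₁ refl) = at (inr Γ vz)
      labD (inj₂ (inj₁ p)) = mapO (inl (a ∷ Δ)) (decO Γ p)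
      labD (inj₂ (inj₂ y)) = mapO (inr Γ) (mapO vs (decO Δ y))

      labR : ∀ {c} → El (P ⊕ D) c → VarO (Γ ++ Θ ++ Δ) c
      labR (inj₁ p) = mapO (inl (Θ ++ Δ)) (decO Γ p)
      labR (inj₂ y) = mapO (λ z → inr Γ (inr Θ z)) (decO Δ y)

      labM : ∀ {c} → Var (map φ Θ) c → VarO (Γ ++ Θ ++ Δ) c
      labM x = mapO (λ z → inr Γ (inl Δ z)) (decO Θ x)

      fronted : gen f ≈ sem (leaf (φ a) ⊕ (P ⊕ D)) labD (act rotI f₁)
      fronted = record
        { iso = splitD ⨟ rotI
        ; lab-eq = λ x → trans (labels (to (appendI Γ (a ∷ Δ)) x)) (appendI-lab Γ (a ∷ Δ) x)
        ; hom-eq = sym (act-⨟ f splitD rotI) }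
        where
        labels : ∀ {c} (z : El (P ⊕ lst (φ a ∷ map φ Δ)) c) →
          labD (to rotI (to (idI {X = P} ⊕I consI) z)) ≡ joinO Γ (map₂ (decO (a ∷ Δ)) z)
        labels (inj₁ p) = refl
        labels (inj₂ vz) = refl
        labels (inj₂ (vs y)) = refl

      plugged : sem (leaf (φ a) ⊕ (P ⊕ D)) labD (act rotI f₁) ⟪ plugE Γ (gen g) ⟫
        ≈ sem (M ⊕ (P ⊕ D)) [ labM , labR ]′ (cmp (act rotI f₁) g)
      plugged = bind-front labR
        (≈-trans (plugE-mid Γ (gen g)) (⟪⟫-relabel (gen g) (λ z → inr Γ (inl Δ z)) (λ _ → ≈-refl)))
        λ { (inj₁ p) → inner (decO Γ p) ; (inj₂ y) → right-of (decO Δ y) }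
        where
        inner : ∀ {c} (z : VarO Γ c) → on (plugE Γ {Δ} (gen g)) (mapO (inl (a ∷ Δ)) z) ≈ ret (mapO (inl (Θ ++ Δ)) z)
        inner (at x) = plugE-inl Γ (gen g) x
        right-of : ∀ {c} (z : VarO Δ c) → on (plugE Γ {Δ} (gen g)) (mapO (inr Γ) (mapO vs z)) ≈ ret (mapO (λ z → inr Γ (inr Θ z)) z)
        right-of (at y) = plugE-inr Γ (gen g) y

      merged : sem (M ⊕ (P ⊕ D)) [ labM , labR ]′ (cmp (act rotI f₁) g) ≈ gen (act (symI splitM) (compAt P D f₁ g))
      merged = record
        { iso = rotI ⨟ symI splitM
        ; lab-eq = λ { (inj₁ x) → trans (decO-encO (mapO (inr Γ) (decO (Θ ++ Δ) (encO (mapO (inl Δ) (decO Θ x))))))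
                         (trans (cong (mapO (inr Γ)) (decO-encO (mapO (inl Δ) (decO Θ x)))) (mapO-∘ (inl Δ) (inr Γ) (decO Θ x)))
                     ; (inj₂ (inj₁ p)) → decO-encO (mapO (inl (Θ ++ Δ)) (decO Γ p))
                     ; (inj₂ (inj₂ y)) → trans (decO-encO (mapO (inr Γ) (decO (Θ ++ Δ) (encO (mapO (inr Θ) (decO Δ y))))))
                         (trans (cong (mapO (inr Γ)) (decO-encO (mapO (inr Θ) (decO Δ y)))) (mapO-∘ (inr Θ) (inr Γ) (decO Δ y))) }
        ; hom-eq = trans (sym (act-⨟ _ rotI (symI splitM))) (cong (act (symI splitM)) (sym (compAt-front f₁ g))) }

      splitD-idx : ∀ {c} (x : Var (map φ (Γ ++ a ∷ Δ)) c) → idx x ≡ idx (enc (P ⊕ (leaf (φ a) ⊕ D)) (to splitD x))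
      splitD-idx x = trans (appendI-idx Γ (a ∷ Δ) x) (indices (to (appendI Γ (a ∷ Δ)) x))
        where
        indices : ∀ {c} (z : El (P ⊕ lst (φ a ∷ map φ Δ)) c) →
          idx (enc (P ⊕ lst (φ a ∷ map φ Δ)) z) ≡ idx (enc (P ⊕ (leaf (φ a) ⊕ D)) (to (idI {X = P} ⊕I consI) z))
        indices (inj₁ p) = trans (idx-inl (φ a ∷ map φ Δ) p) (sym (idx-inl (φ a ∷ map φ Δ) p))
        indices (inj₂ vz) = refl
        indices (inj₂ (vs y)) = refl

      splitM-idx : ∀ {c} (x : Var (map φ (Γ ++ Θ ++ Δ)) c) → idx x ≡ idx (enc (P ⊕ (M ⊕ D)) (to splitM x))
      splitM-idx x = trans (appendI-idx Γ (Θ ++ Δ) x) (indices (to (appendI Γ (Θ ++ Δ)) x))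
        where
        indices : ∀ {c} (z : El (P ⊕ lst (map φ (Θ ++ Δ))) c) →
          idx (enc (P ⊕ lst (map φ (Θ ++ Δ))) z) ≡ idx (enc (P ⊕ (M ⊕ D)) (to (idI {X = P} ⊕I appendI Θ Δ) z))
        indices (inj₁ p) = trans (idx-inl (map φ (Θ ++ Δ)) p) (sym (idx-inl (map φ Θ ++ map φ Δ) p))
        indices (inj₂ y) = trans (idx-inr (map φ Γ) y) (trans (cong (length (map φ Γ) +_) (appendI-idx Θ Δ y))
          (sym (idx-inr (map φ Γ) (enc (M ⊕ D) (to (appendI Θ Δ) y)))))

    composite : HX (lst (map φ (Γ ++ Θ ++ Δ))) d
    composite = act (symI splitM) (compAt P D f₁ g)

    -- The input to be replaced is rotated to the front, where `bind-front` yields one composition;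
    -- `compAt-front` identifies the result with composition at the original place.
    gen-comp : gen f ⟪ plugE Γ (gen g) ⟫ ≈ gen composite
    gen-comp = ≈-trans (⟪⟫-congˡ fronted) (≈-trans plugged merged)

    -- `splitD` and `splitM` preserve positions, so the actions in `composite` are the two casts in
    -- the law for preservation of composition.
    raw-composite : raw composite ≡ castH (map-++₃ φ Γ Θ Δ)
      (comp (map φ Γ) (map φ Δ) (castH (map-++ φ Γ (a ∷ Δ)) (raw f)) (raw g))
    raw-composite = trans (sym (subst-act (map-++₃ φ Γ Θ Δ) (symI splitM) back (compAt P D f₁ g)))
      (cong (castH (map-++₃ φ Γ Θ Δ)) (trans (raw-compAt P D f₁ g)
        (cong (λ z → comp (map φ Γ) (map φ Δ) z (raw g)) (sym (subst-act (map-++ φ Γ (a ∷ Δ)) splitD splitD-idx f)))))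
      where
      back : ∀ {c} (x : El (P ⊕ (M ⊕ D)) c) → idx (enc (P ⊕ (M ⊕ D)) x) ≡ idx (from splitM x)
      back x = trans (cong (λ z → idx (enc (P ⊕ (M ⊕ D)) z)) (sym (to-from splitM x))) (sym (splitM-idx (from splitM x)))

  raw-subst : ∀ {X : Sh Ob} {b c} (e : b ≡ c) (f : HX X b) → raw (subst (HX X) e f) ≡ subst (Hom (enum X)) e (raw f)
  raw-subst refl f = refl

  opaque
    unfolding reX
    raw-reO : ∀ as → raw (reO as) ≡ subst (Hom (map φ as)) (sym (φ-⊗ as)) (re (map φ as))
    raw-reO as = raw-subst (sym (φ-⊗ as)) (reX (map φ as))

  F-resp : ∀ {Γ a} {s t : Rep Γ a} → s ∼ t → F₁ s ≡ F₁ t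
  F-resp = gfold isEquivalence F₁ λ {s} {t} r → cong raw (gen-injective (step-sound r (⊩-interp s) (⊩-interp t)))

  F-comp : ∀ Γ Δ {a b Θ} (s : Rep (Γ ++ a ∷ Δ) b) (t : Rep Θ a) (l : Linear (compTm Γ Δ (proj₁ s) (proj₁ t))) →
    F₁ (compTm Γ Δ (proj₁ s) (proj₁ t) , l) ≡ castH (map-++₃ φ Γ Θ Δ)
      (comp (map φ Γ) (map φ Δ) (castH (map-++ φ Γ (a ∷ Δ)) (F₁ s)) (F₁ t))
  F-comp Γ Δ s t l = trans
    (F₁-≡ (compTm Γ Δ (proj₁ s) (proj₁ t)) l (⊩-≈ (compTm Γ Δ (proj₁ s) (proj₁ t)) (gen-comp Γ Δ (interp s) (interp t))
      (⊩-sub {k = plugE Γ (gen (interp t))} (⊩-plugSub Γ (proj₁ t) (⊩-interp t)) (proj₁ s) (⊩-interp s))))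
    (raw-composite Γ Δ (interp s) (interp t))

  F-act : ∀ {Γ Δ a} (σ : Perm Γ Δ) (σ' : Perm (map φ Γ) (map φ Δ)) →
    (∀ {c} (x : Var Γ c) → Perm.to σ' (mapVar φ x) ≡ mapVar φ (Perm.to σ x)) →
    (s : Rep Γ a) (l : Linear (actTm σ (proj₁ s))) → F₁ (actTm σ (proj₁ s) , l) ≡ F₁ s · σ'
  F-act σ σ' p s l = trans
    (F₁-≡ (actTm σ (proj₁ s)) l (⊩-≈ (actTm σ (proj₁ s)) (gen-act σ σ' p (interp s))
      (⊩-ren (Perm.to σ) (proj₁ s) (⊩-interp s))))
    (raw-act-permI σ' (interp s))

  ⊩-generator : ∀ {as d} (f : HX (lst (map φ as)) d) → gen f ≈ gen {as} f ⟪ v ⟫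
  ⊩-generator f = ≈-sym (⟪v⟫ (gen f) λ _ → ≈-refl)

  functor : SymRepFunctor R S φ φ-⊗
  functor = record
    { F₁ = F₁
    ; F-resp = F-resp
    ; F-id = λ l → F₁-≡ idTm l gen-id
    ; F-comp = F-comp
    ; F-act = F-act
    ; F-re = λ as l → trans (F₁-≡ (reTm as) l (v , ⊩s-vars as (λ x → x) , ⊩-generator (reO as))) (raw-reO as) }

  functor-generates : Generates R S i functor
  functor-generates {as} f l = F₁-≡ (genTm f) l (v , ⊩s-vars as (λ x → x) , ⊩-generator ⟨ arr f ⟩)

-- Algebra of renamings and substitutions on terms.

module Substitution {ℓ} (R : RepSig ℓ) where
  open RepSig R
  open FreeRep R

  liftR-ext : ∀ {Γ Δ} as {ρ τ : Ren Γ Δ} → (∀ {c} (x : Var Γ c) → ρ x ≡ τ x) →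
    ∀ {c} (x : Var (as ++ Γ) c) → liftR as ρ x ≡ liftR as τ x
  liftR-ext [] e x = e x
  liftR-ext (_ ∷ as) e vz = refl
  liftR-ext (_ ∷ as) e (vs x) = cong vs (liftR-ext as e x)

  ren-ext : ∀ {Γ Δ a} {ρ τ : Ren Γ Δ} → (∀ {c} (x : Var Γ c) → ρ x ≡ τ x) → (s : Tm Γ a) → ren ρ s ≡ ren τ s
  rens-ext : ∀ {Γ Δ as} {ρ τ : Ren Γ Δ} → (∀ {c} (x : Var Γ c) → ρ x ≡ τ x) → (ts : Tms Γ as) → rens ρ ts ≡ rens τ ts
  ren-ext e (var x) = cong var (e x)
  ren-ext e (tup ts) = cong tup (rens-ext e ts)
  ren-ext e (lett as t u) = cong₂ (lett as) (ren-ext e t) (ren-ext (liftR-ext as e) u)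
  ren-ext e (app f ts) = cong (app f) (rens-ext e ts)
  rens-ext e [] = refl
  rens-ext e (t ∷ ts) = cong₂ _∷_ (ren-ext e t) (rens-ext e ts)

  liftS-ext : ∀ {Γ Δ} as {σ τ : Sub Γ Δ} → (∀ {c} (x : Var Γ c) → σ x ≡ τ x) →
    ∀ {c} (x : Var (as ++ Γ) c) → liftS as σ x ≡ liftS as τ x
  liftS-ext [] e x = e x
  liftS-ext (_ ∷ as) e vz = refl
  liftS-ext (_ ∷ as) e (vs x) = cong (ren vs) (liftS-ext as e x)

  sub-ext : ∀ {Γ Δ a} {σ τ : Sub Γ Δ} → (∀ {c} (x : Var Γ c) → σ x ≡ τ x) → (s : Tm Γ a) → sub σ s ≡ sub τ s
  subs-ext : ∀ {Γ Δ as} {σ τ : Sub Γ Δ} → (∀ {c} (x : Var Γ c) → σ x ≡ τ x) → (ts : Tms Γ as) → subs σ ts ≡ subs τ ts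
  sub-ext e (var x) = e x
  sub-ext e (tup ts) = cong tup (subs-ext e ts)
  sub-ext e (lett as t u) = cong₂ (lett as) (sub-ext e t) (sub-ext (liftS-ext as e) u)
  sub-ext e (app f ts) = cong (app f) (subs-ext e ts)
  subs-ext e [] = refl
  subs-ext e (t ∷ ts) = cong₂ _∷_ (sub-ext e t) (subs-ext e ts)

  liftS-var : ∀ {Γ Δ} as (ρ : Ren Γ Δ) {c} (x : Var (as ++ Γ) c) → liftS as (λ y → var (ρ y)) x ≡ var (liftR as ρ x)
  liftS-var [] ρ x = refl
  liftS-var (_ ∷ as) ρ vz = refl
  liftS-var (_ ∷ as) ρ (vs x) = cong (ren vs) (liftS-var as ρ x)

  sub-var : ∀ {Γ Δ a} (ρ : Ren Γ Δ) (s : Tm Γ a) → sub (λ x → var (ρ x)) s ≡ ren ρ s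
  subs-var : ∀ {Γ Δ as} (ρ : Ren Γ Δ) (ts : Tms Γ as) → subs (λ x → var (ρ x)) ts ≡ rens ρ ts
  sub-var ρ (var x) = refl
  sub-var ρ (tup ts) = cong tup (subs-var ρ ts)
  sub-var ρ (lett as t u) = cong₂ (lett as) (sub-var ρ t) (trans (sub-ext (liftS-var as ρ) u) (sub-var (liftR as ρ) u))
  sub-var ρ (app f ts) = cong (app f) (subs-var ρ ts)
  subs-var ρ [] = refl
  subs-var ρ (t ∷ ts) = cong₂ _∷_ (sub-var ρ t) (subs-var ρ ts)

  liftR-id : ∀ {Γ} as {c} (x : Var (as ++ Γ) c) → liftR as (λ y → y) x ≡ x
  liftR-id [] x = refl
  liftR-id (_ ∷ as) vz = refl
  liftR-id (_ ∷ as) (vs x) = cong vs (liftR-id as x)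

  ren-id : ∀ {Γ a} (s : Tm Γ a) → ren (λ x → x) s ≡ s
  rens-id : ∀ {Γ as} (ts : Tms Γ as) → rens (λ x → x) ts ≡ ts
  ren-id (var x) = refl
  ren-id (tup ts) = cong tup (rens-id ts)
  ren-id (lett as t u) = cong₂ (lett as) (ren-id t) (trans (ren-ext (liftR-id as) u) (ren-id u))
  ren-id (app f ts) = cong (app f) (rens-id ts)
  rens-id [] = refl
  rens-id (t ∷ ts) = cong₂ _∷_ (ren-id t) (rens-id ts)

  sub-id : ∀ {Γ a} {σ : Sub Γ Γ} → (∀ {c} (x : Var Γ c) → σ x ≡ var x) → (s : Tm Γ a) → sub σ s ≡ s
  sub-id e s = trans (sub-ext e s) (trans (sub-var (λ x → x) s) (ren-id s))

  liftS-liftR : ∀ {Γ Δ Ε} as (σ : Sub Δ Ε) (ρ : Ren Γ Δ) {c} (x : Var (as ++ Γ) c) →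
    liftS as σ (liftR as ρ x) ≡ liftS as (λ y → σ (ρ y)) x
  liftS-liftR [] σ ρ x = refl
  liftS-liftR (_ ∷ as) σ ρ vz = refl
  liftS-liftR (_ ∷ as) σ ρ (vs x) = cong (ren vs) (liftS-liftR as σ ρ x)

  sub-ren : ∀ {Γ Δ Ε a} (σ : Sub Δ Ε) (ρ : Ren Γ Δ) (s : Tm Γ a) → sub σ (ren ρ s) ≡ sub (λ x → σ (ρ x)) s
  subs-rens : ∀ {Γ Δ Ε as} (σ : Sub Δ Ε) (ρ : Ren Γ Δ) (ts : Tms Γ as) → subs σ (rens ρ ts) ≡ subs (λ x → σ (ρ x)) ts
  sub-ren σ ρ (var x) = refl
  sub-ren σ ρ (tup ts) = cong tup (subs-rens σ ρ ts)
  sub-ren σ ρ (lett as t u) = cong₂ (lett as) (sub-ren σ ρ t)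
    (trans (sub-ren (liftS as σ) (liftR as ρ) u) (sub-ext (liftS-liftR as σ ρ) u))
  sub-ren σ ρ (app f ts) = cong (app f) (subs-rens σ ρ ts)
  subs-rens σ ρ [] = refl
  subs-rens σ ρ (t ∷ ts) = cong₂ _∷_ (sub-ren σ ρ t) (subs-rens σ ρ ts)

  ren-ren : ∀ {Γ Δ Ε a} (τ : Ren Δ Ε) (ρ : Ren Γ Δ) (s : Tm Γ a) → ren τ (ren ρ s) ≡ ren (λ x → τ (ρ x)) s
  ren-ren τ ρ s = trans (sym (sub-var τ (ren ρ s))) (trans (sub-ren _ ρ s) (sub-var (λ x → τ (ρ x)) s))

  rens-rens : ∀ {Γ Δ Ε as} (τ : Ren Δ Ε) (ρ : Ren Γ Δ) (ts : Tms Γ as) → rens τ (rens ρ ts) ≡ rens (λ x → τ (ρ x)) ts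
  rens-rens τ ρ [] = refl
  rens-rens τ ρ (t ∷ ts) = cong₂ _∷_ (ren-ren τ ρ t) (rens-rens τ ρ ts)

  liftR-liftS : ∀ {Γ Δ Ε} as (ρ : Ren Δ Ε) (σ : Sub Γ Δ) {c} (x : Var (as ++ Γ) c) →
    ren (liftR as ρ) (liftS as σ x) ≡ liftS as (λ y → ren ρ (σ y)) x
  liftR-liftS [] ρ σ x = refl
  liftR-liftS (_ ∷ as) ρ σ vz = refl
  liftR-liftS (_ ∷ as) ρ σ (vs x) = trans (ren-ren _ vs (liftS as σ x))
    (trans (sym (ren-ren vs (liftR as ρ) (liftS as σ x))) (cong (ren vs) (liftR-liftS as ρ σ x)))

  ren-sub : ∀ {Γ Δ Ε a} (ρ : Ren Δ Ε) (σ : Sub Γ Δ) (s : Tm Γ a) → ren ρ (sub σ s) ≡ sub (λ x → ren ρ (σ x)) s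
  rens-subs : ∀ {Γ Δ Ε as} (ρ : Ren Δ Ε) (σ : Sub Γ Δ) (ts : Tms Γ as) → rens ρ (subs σ ts) ≡ subs (λ x → ren ρ (σ x)) ts
  ren-sub ρ σ (var x) = refl
  ren-sub ρ σ (tup ts) = cong tup (rens-subs ρ σ ts)
  ren-sub ρ σ (lett as t u) = cong₂ (lett as) (ren-sub ρ σ t)
    (trans (ren-sub (liftR as ρ) (liftS as σ) u) (sub-ext (liftR-liftS as ρ σ) u))
  ren-sub ρ σ (app f ts) = cong (app f) (rens-subs ρ σ ts)
  rens-subs ρ σ [] = refl
  rens-subs ρ σ (t ∷ ts) = cong₂ _∷_ (ren-sub ρ σ t) (rens-subs ρ σ ts)

  liftS-liftS : ∀ {Γ Δ Ε} as (τ : Sub Δ Ε) (σ : Sub Γ Δ) {c} (x : Var (as ++ Γ) c) →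
    sub (liftS as τ) (liftS as σ x) ≡ liftS as (λ y → sub τ (σ y)) x
  liftS-liftS [] τ σ x = refl
  liftS-liftS (_ ∷ as) τ σ vz = refl
  liftS-liftS (_ ∷ as) τ σ (vs x) = trans (sub-ren _ vs (liftS as σ x))
    (trans (sym (ren-sub vs (liftS as τ) (liftS as σ x))) (cong (ren vs) (liftS-liftS as τ σ x)))

  sub-sub : ∀ {Γ Δ Ε a} (τ : Sub Δ Ε) (σ : Sub Γ Δ) (s : Tm Γ a) → sub τ (sub σ s) ≡ sub (λ x → sub τ (σ x)) s
  subs-subs : ∀ {Γ Δ Ε as} (τ : Sub Δ Ε) (σ : Sub Γ Δ) (ts : Tms Γ as) → subs τ (subs σ ts) ≡ subs (λ x → sub τ (σ x)) ts
  sub-sub τ σ (var x) = refl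
  sub-sub τ σ (tup ts) = cong tup (subs-subs τ σ ts)
  sub-sub τ σ (lett as t u) = cong₂ (lett as) (sub-sub τ σ t)
    (trans (sub-sub (liftS as τ) (liftS as σ) u) (sub-ext (liftS-liftS as τ σ) u))
  sub-sub τ σ (app f ts) = cong (app f) (subs-subs τ σ ts)
  subs-subs τ σ [] = refl
  subs-subs τ σ (t ∷ ts) = cong₂ _∷_ (sub-sub τ σ t) (subs-subs τ σ ts)

  lookupT : ∀ {Γ as c} → Tms Γ as → Var as c → Tm Γ c
  lookupT (t ∷ ts) vz = t
  lookupT (t ∷ ts) (vs x) = lookupT ts x

  lookupT-rens : ∀ {Γ Δ as c} (ρ : Ren Γ Δ) (ts : Tms Γ as) (x : Var as c) → lookupT (rens ρ ts) x ≡ ren ρ (lookupT ts x)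
  lookupT-rens ρ (t ∷ ts) vz = refl
  lookupT-rens ρ (t ∷ ts) (vs x) = lookupT-rens ρ ts x

  lookupT-vars : ∀ {Γ as c} (ρ : Ren as Γ) (x : Var as c) → lookupT (vars as ρ) x ≡ var (ρ x)
  lookupT-vars ρ vz = refl
  lookupT-vars ρ (vs x) = lookupT-vars (λ y → ρ (vs y)) x

  subs-vars : ∀ {Γ Δ as} (σ : Sub Γ Δ) (ρ : Ren as Γ) (ts : Tms Δ as) →
    (∀ {c} (x : Var as c) → σ (ρ x) ≡ lookupT ts x) → subs σ (vars as ρ) ≡ ts
  subs-vars σ ρ [] e = refl
  subs-vars σ ρ (t ∷ ts) e = cong₂ _∷_ (e vz) (subs-vars σ (λ x → ρ (vs x)) ts (λ x → e (vs x)))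

  βsub-inl : ∀ {Γ Δ as} (ts : Tms Δ as) (ρ : Ren Γ Δ) {c} (x : Var as c) → βsub ts ρ (inl Γ x) ≡ lookupT ts x
  βsub-inl (t ∷ ts) ρ vz = refl
  βsub-inl (t ∷ ts) ρ (vs x) = βsub-inl ts ρ x

  βsub-inr : ∀ {Γ Δ as} (ts : Tms Δ as) (ρ : Ren Γ Δ) {c} (x : Var Γ c) → βsub ts ρ (inr as x) ≡ var (ρ x)
  βsub-inr [] ρ x = refl
  βsub-inr (t ∷ ts) ρ x = βsub-inr ts ρ x

  plugSub-inl : ∀ Γ {Δ Θ a} (t : Tm Θ a) {c} (x : Var Γ c) → plugSub Γ {Δ} t (inl (a ∷ Δ) x) ≡ var (inl (Θ ++ Δ) x)
  plugSub-inl (_ ∷ Γ) t vz = refl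
  plugSub-inl (_ ∷ Γ) t (vs x) = cong (ren vs) (plugSub-inl Γ t x)

  plugSub-mid : ∀ Γ {Δ Θ a} (t : Tm Θ a) → plugSub Γ {Δ} t (inr Γ vz) ≡ ren (λ x → inr Γ (inl Δ x)) t
  plugSub-mid [] t = refl
  plugSub-mid (_ ∷ Γ) t = trans (cong (ren vs) (plugSub-mid Γ t)) (ren-ren vs _ t)

  plugSub-inr : ∀ Γ {Δ Θ a} (t : Tm Θ a) {c} (y : Var Δ c) → plugSub Γ {Δ} t (inr Γ (vs y)) ≡ var (inr Γ (inr Θ y))
  plugSub-inr [] t y = refl
  plugSub-inr (_ ∷ Γ) t y = cong (ren vs) (plugSub-inr Γ t y)

-- Uniqueness: two functors that agree on the generators agree on every linear term.

module Uniqueness {ℓ o h} (R : RepSig ℓ) (S : SymRepMulticat o h) (i : SigMap R S)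
  (F G : SymRepFunctor R S (SigMap.obj i) (SigMap.obj-⊗ i))
  (F-gen : Generates R S i F) (G-gen : Generates R S i G) where
  open RepSig R
  open FreeRep R
  open SymRepMulticat S using (Ob; Hom; ⨂; re; re⁻¹; re⁻¹-comp; id; comp; _·_)
  open SigMap i renaming (obj to φ; obj-⊗ to φ-⊗)
  open Shaped S
  open Monad S
  open Fibers S
  open Contexts R S i
  open Occurrences R S i
  open Soundness R S i
  open Functor R S i hiding (F₁; F-resp; F-comp; F-act)
  open Substitution R
  private
    module F = SymRepFunctor F
    module G = SymRepFunctor G

  gen⇒linear : ∀ {Γ a} (s : Tm Γ a) {f : HX (lst (map φ Γ)) (φ a)} → s ⊩ gen f → Linear s
  gen⇒linear s {f} d = ⊩⇒linear s d (λ x → One-gen f (at x))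

  -- A proof of linearity contains a function, so two such proofs are not identified without
  -- extensionality; agreement is therefore required for every pair of them.
  record Good {Γ a} (s : Tm Γ a) : Set (ℓ ⊔ h) where
    constructor good
    field
      linear : Linear s
      agree  : ∀ l l' → F.F₁ (s , l) ≡ G.F₁ (s , l')

    ⊩-core : s ⊩ gen (interp (s , linear))
    ⊩-core = ⊩-interp (s , linear)
  open Good

  mapPerm : ∀ {Γ Δ} → Perm Γ Δ → Perm (map φ Γ) (map φ Δ)
  mapPerm {Γ} {Δ} σ = record
    { to = λ x → encO (mapO (Perm.to σ) (decO Γ x))
    ; from = λ x → encO (mapO (Perm.from σ) (decO Δ x))
    ; from-to = λ x → trans (cong (λ z → encO (mapO (Perm.from σ) z)) (decO-encO (mapO (Perm.to σ) (decO Γ x))))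
        (trans (cong encO (undo σ (decO Γ x))) (encO-decO Γ x))
    ; to-from = λ x → trans (cong (λ z → encO (mapO (Perm.to σ) z)) (decO-encO (mapO (Perm.from σ) (decO Δ x))))
        (trans (cong encO (redo σ (decO Δ x))) (encO-decO Δ x)) }
    where
    undo : ∀ {Γ Δ} (σ : Perm Γ Δ) {d} (x : VarO Γ d) → mapO (Perm.from σ) (mapO (Perm.to σ) x) ≡ x
    undo σ (at x) = cong at (Perm.from-to σ x)
    redo : ∀ {Γ Δ} (σ : Perm Γ Δ) {d} (x : VarO Δ d) → mapO (Perm.to σ) (mapO (Perm.from σ) x) ≡ x
    redo σ (at x) = cong at (Perm.to-from σ x)

  mapPerm-mapVar : ∀ {Γ Δ} (σ : Perm Γ Δ) {c} (x : Var Γ c) → Perm.to (mapPerm σ) (mapVar φ x) ≡ mapVar φ (Perm.to σ x)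
  mapPerm-mapVar σ x = cong (λ z → encO (mapO (Perm.to σ) z)) (decO-mapVar x)

  good-act : ∀ {Γ Δ a} (σ : Perm Γ Δ) {s : Tm Γ a} → Good s → Good (ren (Perm.to σ) s)
  good-act σ {s} g = good
    (gen⇒linear (ren (Perm.to σ) s) (⊩-≈ (ren (Perm.to σ) s) (gen-act σ (mapPerm σ) (mapPerm-mapVar σ) _) (⊩-ren (Perm.to σ) s (⊩-core g))))
    λ l l' → trans (F.F-act σ (mapPerm σ) (mapPerm-mapVar σ) (s , linear g) l)
      (trans (cong (_· mapPerm σ) (agree g _ _)) (sym (G.F-act σ (mapPerm σ) (mapPerm-mapVar σ) (s , linear g) l')))

  linear-comp : ∀ Γ Δ {a b Θ} (s : Tm (Γ ++ a ∷ Δ) b) (t : Tm Θ a) → Linear s → Linear t → Linear (compTm Γ Δ s t)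
  linear-comp Γ Δ s t l l' = gen⇒linear (compTm Γ Δ s t) (⊩-≈ (compTm Γ Δ s t) (gen-comp Γ Δ (interp (s , l)) (interp (t , l')))
    (⊩-sub {k = plugE Γ (gen (interp (t , l')))} (⊩-plugSub Γ t (⊩-interp (t , l'))) s (⊩-interp (s , l))))

  good-comp : ∀ Γ Δ {a b Θ} {s : Tm (Γ ++ a ∷ Δ) b} {t : Tm Θ a} → Good s → Good t → Good (compTm Γ Δ s t)
  good-comp Γ Δ {s = s} {t} g g' = good (linear-comp Γ Δ s t (linear g) (linear g'))
    λ l l' → trans (F.F-comp Γ Δ (s , linear g) (t , linear g') l)
      (trans (cong₂ (λ x y → castH (map-++₃ φ Γ _ Δ) (comp (map φ Γ) (map φ Δ) (castH (map-++ φ Γ (_ ∷ Δ)) x) y)) (agree g _ _) (agree g' _ _))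
        (sym (G.F-comp Γ Δ (s , linear g) (t , linear g') l')))

  good-re : ∀ as → Good (reTm as)
  good-re as = good (gen⇒linear (reTm as) (v , ⊩s-vars as (λ x → x) , ⊩-generator (reO as)))
    λ l l' → trans (F.F-re as l) (sym (G.F-re as l'))

  good-gen : ∀ {as b} (f : Arr as b) → Good (genTm f)
  good-gen {as} f = good (gen⇒linear (genTm f) (v , ⊩s-vars as (λ x → x) , ⊩-generator ⟨ arr f ⟩))
    λ l l' → trans (F-gen f l) (sym (G-gen f l'))

  good-id : ∀ {a} → Good (idTm {a})
  good-id = good (gen⇒linear idTm gen-id) λ l l' → trans (F.F-id l) (sym (G.F-id l'))

  re-cancel : ∀ {t D b} as (e : t ≡ ⨂ as) {f g : Hom (t ∷ D) b} →
    comp [] D f (subst (Hom as) (sym e) (re as)) ≡ comp [] D g (subst (Hom as) (sym e) (re as)) → f ≡ g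
  re-cancel {D = D} as refl {f} {g} p = trans (sym (re⁻¹-comp [] D as f)) (trans (cong (re⁻¹ [] D as) p) (re⁻¹-comp [] D as g))

  -- The syntactic inverse of composition with `re`: the tensor is the first variable and is opened
  -- by a let.
  packTm : ∀ as {Θ b} → Tm (as ++ Θ) b → Tm (tensor as ∷ Θ) b
  packTm as u = lett as (var vz) (ren (liftR as vs) u)

  compTm-packTm : ∀ as {Θ₁ Θ b} (u : Tm (as ++ Θ) b) (t : Tm Θ₁ (tensor as)) →
    compTm [] Θ (packTm as u) t ≡ lett as (ren (inl Θ) t) (ren (liftR as (inr Θ₁)) u)
  compTm-packTm as {Θ₁} {Θ} u t = cong (lett as (ren (inl Θ) t)) (trans (sub-ren _ (liftR as vs) u)
    (trans (sub-ext (λ x → trans (liftS-liftR as (plugSub [] t) vs x) (liftS-var as (inr Θ₁) x)) u) (sub-var _ u)))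

  -- One β-step with an empty `L`: the tuple composed in for the tensor consists of the variables
  -- themselves, so the resulting substitution is the identity.
  packTm-β : ∀ as {Θ b} (u : Tm (as ++ Θ) b) → Step (compTm [] Θ (packTm as u) (reTm as)) u
  packTm-β as {Θ} u = subst₂ Step (sym (compTm-packTm as u (reTm as))) contracted
      (inj₁ (root (inj₁ (beta hole ts (ren (liftR as (inr as)) u)))))
    where
    ts = rens (inl Θ) (vars as (λ x → x))
    β = βsub ts (λ x → x)
    point : ∀ {c} (x : Var (as ++ Θ) c) → β (liftR as (inr as) x) ≡ var x
    point x with appendView as x
    ... | left y = trans (cong β (liftR-inl as (inr as) y)) (trans (βsub-inl ts _ y)
          (trans (lookupT-rens (inl Θ) (vars as _) y) (cong (ren (inl Θ)) (lookupT-vars _ y))))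
    ... | right y = trans (cong β (liftR-inr as (inr as) y)) (βsub-inr ts _ (inr as y))
    contracted : sub β (ren (liftR as (inr as)) u) ≡ u
    contracted = trans (sub-ren β _ u) (sub-id point u)

  linear-pack : ∀ as {Θ b} (u : Tm (as ++ Θ) b) → Linear u → Linear (packTm as u)
  linear-pack as {Θ} {b} u l = go (opened-surjective as (gen f) (λ x → One-gen f (at (inl Θ x))))
    where
    f = interp (u , l)
    go : (Σ (Sm (tensor as ∷ Θ) (φ b)) λ N → One N (at vz) × opened as N ≈ gen f) → Linear (packTm as u)
    go (N , w , p) = ⊩⇒linear (packTm as u) {N}
      (v vz , N ⟪ ⇑ vr vs ⟫ , ≈-refl , One-⇑ N (vr vs) w ,
        ⊩-≈ (ren (liftR as vs) u) (opened-⇑ (vr vs) (vr (liftR as vs))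
            (λ x → ≡⇒≈ (cong v (liftR-inl as vs x)))
            (λ x → ≈-trans (≡⇒≈ (cong v (liftR-inr as vs x))) (≈-sym (v-⟪⟫ (vs x)))) N)
          (⊩-ren (liftR as vs) u (⊩-≈ u (≈-sym p) (⊩-interp (u , l)))) ,
        ≈-sym (≈-trans (⟪⟫-assoc N) (⟪v⟫ N λ { vz → v-⟪⟫ vz ; (vs x) → ≈-trans (⟪⟫-congˡ (v-⟪⟫ (vs x))) (v-⟪⟫ (vs (vs x))) })))
      λ { vz → w ; (vs x) → Fin1⇒One (↔-trans (↔-sym (Fiber-opened as N x w))
            (↔-trans (Fiber-≈ p) (One⇒Fin1 (One-gen f (at (inr as x)))))) }
      where open import Function.Properties.Inverse using (↔-sym; ↔-trans)

  -- Composition with `re` followed by the β-step leads back to `u`, where the functors agree. Both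
  -- send `reTm as` to `re`, which `re-cancel` removes.
  good-pack : ∀ as {Θ b} {u : Tm (as ++ Θ) b} → Good u → Good (packTm as u)
  good-pack as {Θ} {b} {u} g = good lk λ l l' → castH-injective (map-++ φ [] (tensor as ∷ Θ))
      (re-cancel (map φ as) (φ-⊗ as) (castH-injective (map-++₃ φ [] as Θ) (begin
        both (F.F₁ (k , l)) (reᵗ) ≡⟨ cong (both (F.F₁ (k , l))) (sym (F.F-re as (linear (good-re as)))) ⟩
        both (F.F₁ (k , l)) (F.F₁ (reTm as , linear (good-re as)))
          ≡⟨ sym (F.F-comp [] Θ (k , l) (reTm as , linear (good-re as)) lc) ⟩
        F.F₁ (compTm [] Θ k (reTm as) , lc) ≡⟨ F.F-resp (return (packTm-β as u)) ⟩
        F.F₁ (u , linear g) ≡⟨ agree g _ _ ⟩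
        G.F₁ (u , linear g) ≡⟨ sym (G.F-resp (return (packTm-β as u))) ⟩
        G.F₁ (compTm [] Θ k (reTm as) , lc) ≡⟨ G.F-comp [] Θ (k , l') (reTm as , linear (good-re as)) lc ⟩
        both (G.F₁ (k , l')) (G.F₁ (reTm as , linear (good-re as))) ≡⟨ cong (both (G.F₁ (k , l'))) (G.F-re as (linear (good-re as))) ⟩
        both (G.F₁ (k , l')) (reᵗ) ∎)))
    where
    open ≡-Reasoning
    k = packTm as u
    lk = linear-pack as u (linear g)
    lc = linear-comp [] Θ k (reTm as) lk (linear (good-re as))
    reᵗ = subst (Hom (map φ as)) (sym (φ-⊗ as)) (re (map φ as))
    both : Hom (map φ (tensor as ∷ Θ)) (φ b) → Hom (map φ as) (φ (tensor as)) → Hom (map φ (as ++ Θ)) (φ b)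
    both x y = castH (map-++₃ φ [] as Θ) (comp [] (map φ Θ) (castH (map-++ φ [] (tensor as ∷ Θ)) x) y)

  -- By `compTm-packTm` a let whose parts live in disjoint contexts is equal, as a term, to the
  -- packed body composed with the definition.
  good-lett : ∀ as {Θ₁ Θ₂ b} {t : Tm Θ₁ (tensor as)} {u : Tm (as ++ Θ₂) b} → Good t → Good u →
    Good (lett as (ren (inl Θ₂) t) (ren (liftR as (inr Θ₁)) u))
  good-lett as {Θ₂ = Θ₂} {t = t} {u} g g' = subst Good (compTm-packTm as u t) (good-comp [] Θ₂ (good-pack as g') g)

  -- Each variable sent to `y` occurs once in the linear `s` and gives an occurrence of `y` in the
  -- renamed term. Exactly one such occurrence exists, so exactly one such variable does.
  unique-preimage : ∀ {Θ Γ a} (s : Tm Θ a) → Linear s → (ρ : Ren Θ Γ) → ∀ {c} (y : Var Γ c) → occ (ren ρ s) y ≡ 1 →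
    Σ (Var Θ c) λ z → ρ z ≡ y × ∀ w → ρ w ≡ y → w ≡ z
  unique-preimage {Θ} {Γ} s l ρ {c} y e = find (Inverse.to fibers (centre u))
    where
    f = interp (s , l)
    u : One (gen f ⟪ vr ρ ⟫) (at y)
    u = occ⇒One (ren ρ s) (⊩-ren ρ s (⊩-interp (s , l))) e
    E : Set _
    E = ∃ λ d → Σ (Var Θ d) λ z → Fiber (gen f) (at z) × Fiber (v (ρ z)) (at y)
    fibers : Fiber (gen f ⟪ vr ρ ⟫) (at y) ↔ E
    fibers = Fiber-⟪⟫ (gen f) (vr ρ)
    all-equal : (p q : E) → p ≡ q
    all-equal p q = trans (sym (Inverse.strictlyInverseˡ fibers p))
      (trans (cong (Inverse.to fibers) (one-fiber u _ _)) (Inverse.strictlyInverseˡ fibers q))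
    find : E → Σ (Var Θ c) λ z → ρ z ≡ y × ∀ w → ρ w ≡ y → w ≡ z
    find (d , z , p , q) = found d z p q (fiber-v q)
      where
      found : ∀ d (z : Var Θ d) → Fiber (gen f) (at z) → Fiber (v (ρ z)) (at y) → _≡_ {A = ∃ (Var Γ)} (d , ρ z) (c , y) →
        Σ (Var Θ c) λ z → ρ z ≡ y × ∀ w → ρ w ≡ y → w ≡ z
      found d z p q refl = z , refl , λ w e' → same w e' (all-equal (d , w , centre (One-gen f (at w)) , fib refl (cong at e')) (d , z , p , q))
        where
        same : ∀ w (e' : ρ w ≡ ρ z) {p p'} → _≡_ {A = E} (d , w , p) (d , z , p') → w ≡ z
        same w e' refl = refl

  -- core gives every variable occurrence of s its own variable; ρ identifies them again.
  record Linearised {Γ a} (s : Tm Γ a) : Set (ℓ ⊔ h) where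
    field
      {ctx}  : Ctx
      ρ      : Ren ctx Γ
      core   : Tm ctx a
      isGood : Good core
      ren-eq : ren ρ core ≡ s

  -- A list of terms is not a morphism, so its goodness is stated by its effect: filling the first
  -- inputs of any good `K` with it is good. `D` leaves room for inputs that are filled later.
  record Linearisedₛ {Γ as} (ts : Tms Γ as) : Set (ℓ ⊔ h) where
    field
      {ctx}   : Ctx
      ρ       : Ren ctx Γ
      cores   : Tms ctx as
      isGood  : ∀ D {b} {K : Tm (as ++ D) b} → Good K → Good (sub (βsub (rens (inl D) cores) (inr ctx)) K)
      rens-eq : rens ρ cores ≡ ts

  copairR : ∀ Θ₁ {Θ₂ Γ : Ctx} → Ren Θ₁ Γ → Ren Θ₂ Γ → Ren (Θ₁ ++ Θ₂) Γ
  copairR Θ₁ ρ τ x = [ ρ , τ ]′ (split Θ₁ x)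

  copairR-inl : ∀ Θ₁ {Θ₂ Γ : Ctx} (ρ : Ren Θ₁ Γ) (τ : Ren Θ₂ Γ) {c} (x : Var Θ₁ c) → copairR Θ₁ ρ τ (inl Θ₂ x) ≡ ρ x
  copairR-inl Θ₁ {Θ₂} ρ τ x = cong [ ρ , τ ]′ (split-inl Θ₁ x)

  copairR-inr : ∀ Θ₁ {Θ₂ Γ : Ctx} (ρ : Ren Θ₁ Γ) (τ : Ren Θ₂ Γ) {c} (x : Var Θ₂ c) → copairR Θ₁ ρ τ (inr Θ₁ x) ≡ τ x
  copairR-inr Θ₁ ρ τ x = cong [ ρ , τ ]′ (split-inr Θ₁ x)

  linearise-cons : ∀ {Γ a as} {t : Tm Γ a} {ts : Tms Γ as} → Linearised t → Linearisedₛ ts → Linearisedₛ (t ∷ ts)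
  linearise-cons {Γ} {a} {as} {t} {ts} lt lts = record
    { ρ = copairR Θ₁ T.ρ Ts.ρ
    ; cores = ren (inl Θ₂) T.core ∷ rens (inr Θ₁) Ts.cores
    ; isGood = goods
    ; rens-eq = cong₂ _∷_
        (trans (ren-ren _ (inl Θ₂) T.core) (trans (ren-ext (copairR-inl Θ₁ T.ρ Ts.ρ) T.core) T.ren-eq))
        (trans (rens-rens _ (inr Θ₁) Ts.cores) (trans (rens-ext (copairR-inr Θ₁ T.ρ Ts.ρ) Ts.cores) Ts.rens-eq)) }
    where
    module T = Linearised lt
    module Ts = Linearisedₛ lts
    Θ₁ = T.ctx
    Θ₂ = Ts.ctx
    cores = ren (inl Θ₂) T.core ∷ rens (inr Θ₁) Ts.cores
    goods : ∀ D {b} {K : Tm (a ∷ as ++ D) b} → Good K → Good (sub (βsub (rens (inl D) cores) (inr (Θ₁ ++ Θ₂))) K)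
    goods D {K = K} g = subst Good (trans (cong (ren σ₂) (trans (cong (sub σc) (sub-ren σβ σ₁ K)) (sub-sub σc _ K)))
        (trans (ren-sub σ₂ _ K) (sub-ext point K)))
      -- The input of the head term is set aside behind `as` by `p₁`, the tail is filled with `D`
      -- enlarged by that input, the head term is composed in, and `p₂` exchanges the two contexts.
      (good-act p₂ (good-comp Θ₂ D (Ts.isGood (a ∷ D) (good-act p₁ g)) T.isGood))
      where
      p₁ : Perm (a ∷ as ++ D) (as ++ a ∷ D)
      p₁ = listPerm {X = leaf a ⊕ (lst as ⊕ lst D)} {Y = lst as ⊕ (leaf a ⊕ lst D)} rotI
      p₂ : Perm (Θ₂ ++ Θ₁ ++ D) ((Θ₁ ++ Θ₂) ++ D)
      p₂ = listPerm {X = lst Θ₂ ⊕ (lst Θ₁ ⊕ lst D)} {Y = (lst Θ₁ ⊕ lst Θ₂) ⊕ lst D} (rotI ⨟ symI assocI)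
      σ₁ : Ren (a ∷ as ++ D) (as ++ a ∷ D)
      σ₁ = Perm.to p₁
      σ₂ : Ren (Θ₂ ++ Θ₁ ++ D) ((Θ₁ ++ Θ₂) ++ D)
      σ₂ = Perm.to p₂
      σβ : Sub (as ++ a ∷ D) (Θ₂ ++ a ∷ D)
      σβ = βsub (rens (inl (a ∷ D)) Ts.cores) (inr Θ₂)
      σc : Sub (Θ₂ ++ a ∷ D) (Θ₂ ++ Θ₁ ++ D)
      σc = plugSub Θ₂ T.core
      σ₁-as : ∀ {c} (y : Var as c) → σ₁ (vs (inl D y)) ≡ inl (a ∷ D) y
      σ₁-as y = cong (λ z → enc (lst as ⊕ (leaf a ⊕ lst D)) (to (rotI {X = leaf a} {Y = lst as} {Z = lst D}) (inj₂ z))) (dec-inl (lst as) (lst D) y)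
      σ₁-D : ∀ {c} (y : Var D c) → σ₁ (vs (inr as y)) ≡ inr as (vs y)
      σ₁-D y = cong (λ z → enc (lst as ⊕ (leaf a ⊕ lst D)) (to (rotI {X = leaf a} {Y = lst as} {Z = lst D}) (inj₂ z))) (dec-inr (lst as) (lst D) y)
      Y = (lst Θ₁ ⊕ lst Θ₂) ⊕ lst D
      iso₂ : Iso (lst Θ₂ ⊕ (lst Θ₁ ⊕ lst D)) Y
      iso₂ = rotI ⨟ symI assocI
      σ₂-Θ₂ : ∀ {c} (y : Var Θ₂ c) → σ₂ (inl (Θ₁ ++ D) y) ≡ inl D (inr Θ₁ y)
      σ₂-Θ₂ y = listPerm-inl iso₂ y
      σ₂-Θ₁ : ∀ {c} (y : Var Θ₁ c) → σ₂ (inr Θ₂ (inl D y)) ≡ inl D (inl Θ₂ y)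
      σ₂-Θ₁ y = trans (listPerm-inr iso₂ (inl D y)) (cong (λ z → enc Y (to iso₂ (inj₂ z))) (dec-inl (lst Θ₁) (lst D) y))
      σ₂-D : ∀ {c} (y : Var D c) → σ₂ (inr Θ₂ (inr Θ₁ y)) ≡ inr (Θ₁ ++ Θ₂) y
      σ₂-D y = trans (listPerm-inr iso₂ (inr Θ₁ y)) (cong (λ z → enc Y (to iso₂ (inj₂ z))) (dec-inr (lst Θ₁) (lst D) y))
      target : Sub (a ∷ as ++ D) ((Θ₁ ++ Θ₂) ++ D)
      target = βsub (rens (inl D) cores) (inr (Θ₁ ++ Θ₂))
      point : ∀ {c} (x : Var (a ∷ as ++ D) c) → ren σ₂ (sub σc (σβ (σ₁ x))) ≡ target x
      point vz = begin
        ren σ₂ (sub σc (σβ (inr as vz))) ≡⟨ cong (λ z → ren σ₂ (sub σc z)) (βsub-inr (rens (inl (a ∷ D)) Ts.cores) (inr Θ₂) vz) ⟩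
        ren σ₂ (plugSub Θ₂ T.core (inr Θ₂ vz)) ≡⟨ cong (ren σ₂) (plugSub-mid Θ₂ T.core) ⟩
        ren σ₂ (ren (λ x → inr Θ₂ (inl D x)) T.core) ≡⟨ ren-ren σ₂ _ T.core ⟩
        ren (λ x → σ₂ (inr Θ₂ (inl D x))) T.core ≡⟨ ren-ext σ₂-Θ₁ T.core ⟩
        ren (λ x → inl D (inl Θ₂ x)) T.core ≡⟨ sym (ren-ren (inl D) (inl Θ₂) T.core) ⟩
        ren (inl D) (ren (inl Θ₂) T.core) ∎
        where open ≡-Reasoning
      point (vs x) with appendView as x
      ... | left y = begin
        ren σ₂ (sub σc (σβ (σ₁ (vs (inl D y))))) ≡⟨ cong (λ z → ren σ₂ (sub σc (σβ z))) (σ₁-as y) ⟩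
        ren σ₂ (sub σc (σβ (inl (a ∷ D) y))) ≡⟨ cong (λ z → ren σ₂ (sub σc z)) (trans (βsub-inl (rens (inl (a ∷ D)) Ts.cores) (inr Θ₂) y) (lookupT-rens (inl (a ∷ D)) Ts.cores y)) ⟩
        ren σ₂ (sub σc (ren (inl (a ∷ D)) q)) ≡⟨ cong (ren σ₂) (trans (sub-ren σc _ q) (trans (sub-ext (plugSub-inl Θ₂ T.core) q) (sub-var _ q))) ⟩
        ren σ₂ (ren (inl (Θ₁ ++ D)) q) ≡⟨ trans (ren-ren σ₂ _ q) (ren-ext σ₂-Θ₂ q) ⟩
        ren (λ x → inl D (inr Θ₁ x)) q ≡⟨ sym (ren-ren (inl D) (inr Θ₁) q) ⟩
        ren (inl D) (ren (inr Θ₁) q) ≡⟨ cong (ren (inl D)) (sym (lookupT-rens (inr Θ₁) Ts.cores y)) ⟩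
        ren (inl D) (lookupT (rens (inr Θ₁) Ts.cores) y) ≡⟨ sym (lookupT-rens (inl D) (rens (inr Θ₁) Ts.cores) y) ⟩
        lookupT (rens (inl D) (rens (inr Θ₁) Ts.cores)) y ≡⟨ sym (βsub-inl (rens (inl D) (rens (inr Θ₁) Ts.cores)) (inr (Θ₁ ++ Θ₂)) y) ⟩
        target (vs (inl D y)) ∎
        where
        open ≡-Reasoning
        q = lookupT Ts.cores y
      ... | right y = begin
        ren σ₂ (sub σc (σβ (σ₁ (vs (inr as y))))) ≡⟨ cong (λ z → ren σ₂ (sub σc (σβ z))) (σ₁-D y) ⟩
        ren σ₂ (sub σc (σβ (inr as (vs y)))) ≡⟨ cong (λ z → ren σ₂ (sub σc z)) (βsub-inr (rens (inl (a ∷ D)) Ts.cores) (inr Θ₂) (vs y)) ⟩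
        ren σ₂ (plugSub Θ₂ T.core (inr Θ₂ (vs y))) ≡⟨ cong (ren σ₂) (plugSub-inr Θ₂ T.core y) ⟩
        var (σ₂ (inr Θ₂ (inr Θ₁ y))) ≡⟨ cong var (σ₂-D y) ⟩
        var (inr (Θ₁ ++ Θ₂) y) ≡⟨ sym (βsub-inr (rens (inl D) (rens (inr Θ₁) Ts.cores)) (inr (Θ₁ ++ Θ₂)) y) ⟩
        target (vs (inr as y)) ∎
        where open ≡-Reasoning

  linearise-nil : ∀ {Γ} → Linearisedₛ {Γ} []
  linearise-nil = record
    { ρ = λ ()
    ; cores = []
    ; isGood = λ D {b} {K} g → subst Good (sym (sub-id (λ _ → refl) K)) g
    ; rens-eq = refl }

  -- The case of empty `D`. The trailing `[]` is added and removed by permutations, for which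
  -- goodness is known, so no terms are cast.
  good-filled : ∀ {Γ as b} {ts : Tms Γ as} (l : Linearisedₛ ts) {K : Tm as b} → Good K →
    Good (sub (lookupT (Linearisedₛ.cores l)) K)
  good-filled {as = as} l {K} g = subst Good
      (trans (cong (ren (Perm.to p⁻¹)) (sub-ren _ (Perm.to p) K)) (trans (ren-sub (Perm.to p⁻¹) _ K) (sub-ext point K)))
      (good-act p⁻¹ (isGood [] (good-act p g)))
    where
    open Linearisedₛ l
    p : Perm as (as ++ [])
    p = listPerm {X = lst as} {Y = lst as ⊕ lst []} nilʳI
    p⁻¹ : Perm (ctx ++ []) ctx
    p⁻¹ = listPerm {X = lst ctx ⊕ lst []} {Y = lst ctx} (symI nilʳI)
    point : ∀ {c} (x : Var as c) → ren (Perm.to p⁻¹) (βsub (rens (inl []) cores) (inr ctx) (inl [] x)) ≡ lookupT cores x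
    point x = trans (cong (ren (Perm.to p⁻¹)) (trans (βsub-inl (rens (inl []) cores) (inr ctx) x) (lookupT-rens (inl []) cores x)))
      (trans (ren-ren _ (inl []) (lookupT cores x))
        (trans (ren-ext (λ y → listPerm-inl {X = lst ctx} {Y = lst []} (symI nilʳI) y) (lookupT cores x)) (ren-id _)))

  -- A bound variable occurs once in `u`, so by `unique-preimage` exactly one variable of the core
  -- of `u` lies over it. `splitting` moves these variables to the front in the order of `as`, and
  -- `good-lett` applies to the permuted core.
  linearise-lett : ∀ {Γ as b} {t : Tm Γ (tensor as)} {u : Tm (as ++ Γ) b} →
    (∀ {c} (x : Var as c) → occ u (inl Γ x) ≡ 1) → Linearised t → Linearised u → Linearised (lett as t u)
  linearise-lett {Γ} {as} {b} {t} {u} ones lt lu = record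
    { ρ = copairR Θ₁ T.ρ rest-ρ
    ; core = lett as (ren (inl Θ₂) T.core) (ren (liftR as (inr Θ₁)) (ren τ U.core))
    ; isGood = good-lett as T.isGood (good-act perm U.isGood)
    ; ren-eq = cong₂ (lett as)
        (trans (ren-ren _ (inl Θ₂) T.core) (trans (ren-ext (copairR-inl Θ₁ T.ρ rest-ρ) T.core) T.ren-eq))
        (trans (ren-ren _ (liftR as (inr Θ₁)) (ren τ U.core)) (trans (ren-ren _ τ U.core) (trans (ren-ext point U.core) U.ren-eq))) }
    where
    module T = Linearised lt
    module U = Linearised lu
    side : ∀ {c} → Var U.ctx c → Var as c ⊎ Var Γ c
    side x = split as (U.ρ x)
    unside : ∀ {c} {x : Var U.ctx c} {y : Var as c ⊎ Var Γ c} → side x ≡ y → U.ρ x ≡ [ inl Γ , inr as ]′ y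
    unside {x = x} e = helper (U.ρ x) e
      where
      helper : ∀ {c} (z : Var (as ++ Γ) c) {y} → split as z ≡ y → z ≡ [ inl Γ , inr as ]′ y
      helper z refl with appendView as z
      ... | left x rewrite split-inl as {Γ} x = refl
      ... | right x rewrite split-inr as x = refl
    pre : ∀ {c} (x : Var as c) → Σ (Var U.ctx c) λ z → U.ρ z ≡ inl Γ x × ∀ w → U.ρ w ≡ inl Γ x → w ≡ z
    pre x = unique-preimage U.core (linear U.isGood) U.ρ (inl Γ x) (subst (λ s → occ s (inl Γ x) ≡ 1) (sym U.ren-eq) (ones x))
    open Splitting (splitting {X = Var Γ} as (lst U.ctx) side λ x →
      proj₁ (pre x) , trans (cong (split as) (proj₁ (proj₂ (pre x)))) (split-inl as x) ,
      λ w e → proj₂ (proj₂ (pre x)) w (unside e))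
    Θ₁ = T.ctx
    Θ₂ = enum rest
    rest-ρ : Ren Θ₂ Γ
    rest-ρ x = rest-lab (dec rest x)
    perm : Perm U.ctx (as ++ Θ₂)
    perm = listPerm {X = lst U.ctx} {Y = lst as ⊕ rest} (symI splitI)
    τ : Ren U.ctx (as ++ Θ₂)
    τ = Perm.to perm
    back : Ren (as ++ Θ₂) (as ++ Γ)
    back x = liftR as (copairR Θ₁ T.ρ rest-ρ) (liftR as (inr Θ₁) x)
    back-enc : ∀ {c} (z : El (lst as ⊕ rest) c) → back (enc (lst as ⊕ rest) z) ≡ [ inl Γ , inr as ]′ (map₂ rest-lab z)
    back-enc (inj₁ y) = trans (cong (liftR as _) (liftR-inl as (inr Θ₁) y)) (liftR-inl as _ y)
    back-enc (inj₂ y) = trans (cong (liftR as _) (liftR-inr as (inr Θ₁) (enc rest y))) (trans (liftR-inr as _ _)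
      (cong (inr as) (trans (copairR-inr Θ₁ T.ρ rest-ρ (enc rest y)) (cong rest-lab (dec-enc rest y)))))
    point : ∀ {c} (x : Var U.ctx c) → back (τ x) ≡ U.ρ x
    point x = trans (back-enc (from splitI x)) (sym (unside (trans (cong side (sym (to-from splitI x))) (split-lab (from splitI x)))))

  linearise  : ∀ {Γ a} (s : Tm Γ a) → BoundLinear s → Linearised s
  linearises : ∀ {Γ as} (ts : Tms Γ as) → BoundLinears ts → Linearisedₛ ts
  linearise (var x) l = record { ρ = λ { vz → x ; (vs ()) } ; core = var vz ; isGood = good-id ; ren-eq = refl }
  linearise (tup {as = as} ts) l = record
    { ρ = L.ρ ; core = tup L.cores
    ; isGood = subst (λ z → Good (tup z)) (subs-vars _ _ L.cores (λ _ → refl)) (good-filled (linearises ts l) (good-re as))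
    ; ren-eq = cong tup L.rens-eq }
    where module L = Linearisedₛ (linearises ts l)
  linearise (lett as t u) (l , l' , ones) = linearise-lett ones (linearise t l) (linearise u l')
  linearise (app f ts) l = record
    { ρ = L.ρ ; core = app f L.cores
    ; isGood = subst (λ z → Good (app f z)) (subs-vars _ _ L.cores (λ _ → refl)) (good-filled (linearises ts l) (good-gen f))
    ; ren-eq = cong (app f) L.rens-eq }
    where module L = Linearisedₛ (linearises ts l)
  linearises [] l = linearise-nil
  linearises (t ∷ ts) (l , ls) = linearise-cons (linearise t l) (linearises ts ls)

  -- For a linear term `unique-preimage` makes the renaming of its linearisation bijective, so
  -- `good-act` carries agreement from the core to the term.
  functors-agree : ∀ {Γ a} (s : Rep Γ a) → F.F₁ s ≡ G.F₁ s
  functors-agree {Γ} (s , l) = agree (subst Good ren-eq (good-act perm isGood)) l l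
    where
    open Linearised (linearise s (proj₁ l))
    pre : ∀ {c} (y : Var Γ c) → Σ (Var ctx c) λ z → ρ z ≡ y × ∀ w → ρ w ≡ y → w ≡ z
    pre y = unique-preimage core (linear isGood) ρ y (subst (λ s → occ s y ≡ 1) (sym ren-eq) (proj₂ l y))
    perm : Perm ctx Γ
    perm = record
      { to = ρ ; from = λ y → proj₁ (pre y)
      ; from-to = λ x → sym (proj₂ (proj₂ (pre (ρ x))) x refl)
      ; to-from = λ y → proj₁ (proj₂ (pre y)) }

theorem4p7 : ∀ {ℓ o h} (R : RepSig ℓ) (S : SymRepMulticat o h) (i : SigMap R S) →
    Σ (SymRepFunctor R S (SigMap.obj i) (SigMap.obj-⊗ i)) (λ F →
    Generates R S i F
    × (∀ (G : SymRepFunctor R S (SigMap.obj i) (SigMap.obj-⊗ i)) → Generates R S i G →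
    ∀ {Γ a} (s : FreeRep.Rep R Γ a) →
    SymRepFunctor.F₁ G s ≡ SymRepFunctor.F₁ F s))
theorem4p7 R S i = functor , functor-generates ,
    λ G G-gen s → Uniqueness.functors-agree R S i G functor G-gen functor-generates s
  where open Functor R S i
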